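{- Let $r\ge1$ and let $F$ be a graph with chromatic number $\chi(F)=r+1$. Then for every real $p>1$, as $n\to\infty$, $$\mathrm{ex}^{(p)}_\lambda(n,F)=\lambda^{(p)}(T_r(n))+o\!\left(n^{2-2/p}\right)=\left(1-\frac1r+o(1)\right)n^{2-2/p}.$$
   Context: For a graph $G$ on vertex set $\{1,\dots,n\}$ and real $p\ge1$, the $p$-spectral radius is $\lambda^{(p)}(G)=\max\{2\sum_{\{i,j\}\in E(G)}x_ix_j:\ x\in\mathbb R^n,\ |x_1|^p+\dots+|x_n|^p=1\}$. $\mathrm{ex}^{(p)}_\lambda(n,F)$ is the maximum of $\lambda^{(p)}(G)$ over all $n$-vertex graphs $G$ containing no subgraph isomorphic to $F$. $T_r(n)$ is the Turán graph: the complete $r$-partite graph on $n$ vertices with part sizes as equal as possible. -}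

module Defs where

open import Level using (0ℓ)
open import Algebra.Bundles using (CommutativeRing; module Semiring)
import Algebra.Construct.NaturalChoice.Max as Max
import Algebra.Definitions.RawMonoid as RawMonoidDefs
import Algebra.Definitions.RawSemiring as RawSemiringDefs
open import Axiom.ExcludedMiddle using (ExcludedMiddle)
open import Data.Bool using (Bool; true; false; not; _∧_; if_then_else_)
open import Data.Fin using (Fin; toℕ)
open import Data.Nat as ℕ using (ℕ; suc; NonZero)
open import Data.Nat.DivMod using (_%_)
open import Data.Product using (Σ; ∃; _×_; _,_; proj₁)
open import Data.Sum using (_⊎_)
open import Data.Vec.Functional using (Vector)
open import Function.Bundles using (mk⇔)
open import Function.Definitions using (Injective)
open import Relation.Binary.Bundles using (TotalOrder)
open import Relation.Binary.Core using (Rel)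
open import Relation.Binary.PropositionalEquality using (_≡_; _≢_; refl; sym; cong)
open import Relation.Binary.Structures using (IsTotalOrder)
open import Relation.Nullary using (¬_; yes; no; does)
open import Relation.Nullary.Decidable using (dec-true; does-⇔)
open import Relation.Unary using (Pred; _∈_)

------------------------------------------------------------------------
-- Finite simple graphs

record Graph (n : ℕ) : Set where
  field
    adj     : Fin n → Fin n → Bool
    adj-sym : ∀ i j → adj i j ≡ adj j i
    adj-irr : ∀ i → adj i i ≡ false

  Adj : Fin n → Fin n → Set
  Adj i j = adj i j ≡ true

open Graph public

-- G contains a (not necessarily induced) subgraph isomorphic to F.
Contains : ∀ {n m} → Graph n → Graph m → Set
Contains {n} {m} G F =
  Σ (Fin m → Fin n) λ f →
    Injective _≡_ _≡_ f × (∀ i j → Adj F i j → Adj G (f i) (f j))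

Colourable : ∀ {n} → Graph n → ℕ → Set
Colourable {n} G k =
  Σ (Fin n → Fin k) λ c → ∀ i j → Adj G i j → c i ≢ c j

HasChromaticNumber : ∀ {n} → Graph n → ℕ → Set
HasChromaticNumber G k =
  Colourable G k × (∀ j → Colourable G j → k ℕ.≤ j)

-- The parts are the residue classes mod r, so their sizes differ by at
-- most one; when n < r the classes that are not hit are empty.
turán : (r : ℕ) .{{_ : NonZero r}} (n : ℕ) → Graph n
turán r n = record
  { adj     = λ i j → not (does (part i ℕ.≟ part j))
  ; adj-sym = λ i j → cong not
                  (does-⇔ (mk⇔ sym sym) (part i ℕ.≟ part j) (part j ℕ.≟ part i))
  ; adj-irr = λ i → cong not (dec-true (part i ℕ.≟ part i) refl)
  }
  where
  part : Fin n → ℕ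
  part i = toℕ i % r

------------------------------------------------------------------------
-- The real numbers, characterised (uniquely up to isomorphism) as the
-- complete ordered field

record CompleteOrderedField : Set₁ where
  field
    commutativeRing : CommutativeRing 0ℓ 0ℓ

  open CommutativeRing commutativeRing public

  infix  4 _≤_ _<_
  infixl 8 _⁻¹

  field
    _≤_          : Rel Carrier 0ℓ
    isTotalOrder : IsTotalOrder _≈_ _≤_
    +-monoˡ-≤    : ∀ {x y} z → x ≤ y → x + z ≤ y + z
    *-nonNeg     : ∀ {x y} → 0# ≤ x → 0# ≤ y → 0# ≤ x * y
    0≉1          : ¬ 0# ≈ 1#
    -- 0# ⁻¹ is an unspecified element.
    _⁻¹          : Carrier → Carrier
    ⁻¹-inverseʳ  : ∀ x → ¬ x ≈ 0# → x * x ⁻¹ ≈ 1#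

  totalOrder : TotalOrder 0ℓ 0ℓ 0ℓ
  totalOrder = record { isTotalOrder = isTotalOrder }

  open Max totalOrder public using (_⊔_)

  _<_ : Rel Carrier 0ℓ
  x < y = x ≤ y × ¬ x ≈ y

  IsUpperBound : Pred Carrier 0ℓ → Carrier → Set
  IsUpperBound S b = ∀ x → x ∈ S → x ≤ b

  IsSupremum : Pred Carrier 0ℓ → Carrier → Set
  IsSupremum S s = IsUpperBound S s × (∀ b → IsUpperBound S b → s ≤ b)

  IsMaximum : Pred Carrier 0ℓ → Carrier → Set
  IsMaximum S s = s ∈ S × IsUpperBound S s

  field
    complete : ∀ (S : Pred Carrier 0ℓ) → ∃ S → ∃ (IsUpperBound S) →
               ∃ (IsSupremum S)

  ∣_∣ : Carrier → Carrier
  ∣ x ∣ = x ⊔ (- x)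

  open RawMonoidDefs +-rawMonoid public using (sum) renaming (_×_ to _·_)
  open RawSemiringDefs (Semiring.rawSemiring semiring) public using (_^_)

  fromℕ : ℕ → Carrier
  fromℕ n = n · 1#

  -- f = o(g) as n → ∞
  infix 4 _=o_
  _=o_ : (ℕ → Carrier) → (ℕ → Carrier) → Set
  f =o g = ∀ ε → 0# < ε →
           ∃ λ N → ∀ n → N ℕ.≤ n → ∣ f n ∣ ≤ ε * ∣ g n ∣

module Classical (em : ExcludedMiddle 0ℓ) (ℝ : CompleteOrderedField) where

  open CompleteOrderedField ℝ

  -- 0# when S has no supremum.
  sup : Pred Carrier 0ℓ → Carrier
  sup S with em {∃ (IsSupremum S)}
  ... | yes s = proj₁ s
  ... | no  _ = 0#

  -- 0# when S has no greatest element.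
  max : Pred Carrier 0ℓ → Carrier
  max S with em {∃ (IsMaximum S)}
  ... | yes s = proj₁ s
  ... | no  _ = 0#

  -- x to the real power p, for x ≥ 0 and p ≥ 0.  It is the supremum of
  -- the y ≥ 0 with y ≤ x^(a/b), where a/b ranges over the rationals ≤ p
  -- if x ≥ 1 and over the rationals ≥ p if x ≤ 1 (q ↦ x^q being
  -- decreasing in that case).
  infixr 8 _^ᴿ_
  _^ᴿ_ : Carrier → Carrier → Carrier
  x ^ᴿ p = sup λ y →
    0# ≤ y × ∃ λ (a : ℕ) → ∃ λ (b : ℕ) → 1 ℕ.≤ b × y ^ b ≤ x ^ a ×
      ((1# ≤ x × fromℕ a ≤ fromℕ b * p) ⊎ (x ≤ 1# × fromℕ b * p ≤ fromℕ a))

  edgeSum : ∀ {n} → Graph n → Vector Carrier n → Carrier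
  edgeSum G x = sum λ i → sum λ j →
    if does (toℕ i ℕ.<? toℕ j) ∧ adj G i j then x i * x j else 0#

  spectralRadius : ∀ {n} → Carrier → Graph n → Carrier
  spectralRadius {n} p G = max λ v →
    Σ (Vector Carrier n) λ x →
      sum (λ i → ∣ x i ∣ ^ᴿ p) ≈ 1# × v ≈ fromℕ 2 * edgeSum G x

  ex : ∀ {m} → Carrier → ℕ → Graph m → Carrier
  ex p n F = max λ v →
    Σ (Graph n) λ G → ¬ Contains G F × v ≈ spectralRadius p G

-- Lower bound: T_r(n) contains no copy of F, and the constant vector
-- n^(-1/p) shows λ(T_r(n)) ≥ (1 - 1/r - o(1)) n^(2 - 2/p).
--
-- Upper bound: let G be F-free, let x ≥ 0 attain λ(G), and rescale it to
-- y = n^(1/p) x, so that Σ yᵢ^p = n.  Bernoulli's inequality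
-- y^p ≥ 1 + p (y - 1) gives Σ yᵢ ≤ n, and since p > 1 the entries above a
-- large constant M contribute only η n to Σ yᵢ; dropping them changes
-- Σ aᵢⱼ yᵢ yⱼ by at most 2 η n².  What remains are vertex weights in [0, M],
-- to which a weighted Erdős–Stone theorem applies: weights of total at most
-- n, each at most δ n, with Σ aᵢⱼ wᵢ wⱼ ≥ (1 - 1/r + κ) n² force a complete
-- (r+1)-partite subgraph with parts of any prescribed size, hence a copy
-- of F.  The weighted theorem follows the classical argument: zero some
-- weights to get a large minimum degree, then build up the parts one at a
-- time, each new part being found by pigeonhole among the vertices with
-- many neighbours in all the previous ones.
--
-- Real powers are handled through x^a ≤ (x^p)^b ≤ x^(a+1), a = ⌊b p⌋
-- (x ≥ 1), which determines x^p since a bounded ratio of n-th powers for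
-- all n forces an inequality of the bases.

module Submission where

open import Level using (0ℓ)
open import Axiom.ExcludedMiddle using (ExcludedMiddle)
open import Algebra.Bundles using (CommutativeRing)
import Algebra.Construct.NaturalChoice.Max as Max
open import Algebra.Construct.NaturalChoice.Base using (module MaxOperator)
import Algebra.Properties.CommutativeMonoid.Sum as CommutativeMonoidSum
import Algebra.Properties.CommutativeSemiring.Exp as Exp
import Algebra.Properties.Ring as RingProperties
import Algebra.Properties.Semiring.Mult as Multiples
import Algebra.Properties.Semiring.Sum as SemiringSum
import Algebra.Solver.Ring as RingSolver
open import Algebra.Solver.Ring.AlmostCommutativeRing
  using (AlmostCommutativeRing; fromCommutativeRing; _-Raw-AlmostCommutative⟶_)
open import Data.Bool as Bool using (Bool; true; false; if_then_else_)
open import Data.Empty using (⊥; ⊥-elim)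
open import Data.Fin as Fin using (Fin; zero; suc; toℕ)
import Data.Fin.Properties as Fin
open import Data.Integer as ℤ using (ℤ; -[1+_])
import Data.Integer.Properties as ℤ
open import Data.Maybe using (just; nothing)
open import Data.Nat as ℕ using (ℕ; zero; suc; NonZero; _≥_; z≤n; s≤s)
open import Data.Nat.DivMod using (_%_; _/_; m%n<n; m≡m%n+[m/n]*n; /-mono-≤; m/n*n≤m)
import Data.Nat.Properties as ℕ
open import Data.Product using (Σ; ∃; _×_; _,_; proj₁; proj₂)
open import Data.Sum using (_⊎_; inj₁; inj₂)
open import Data.Vec.Functional using (Vector)
open import Function.Base using (_∘_)
open import Function.Definitions using (Injective)
open import Relation.Binary.Bundles using (TotalOrder)
open import Relation.Binary.Definitions using (WeaklyDecidable; tri<; tri≈; tri>)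
open import Relation.Binary.PropositionalEquality as ≡ using (_≡_; _≢_)
import Relation.Binary.Reasoning.PartialOrder as PartialOrderReasoning
import Relation.Binary.Reasoning.Setoid as SetoidReasoning
open import Relation.Binary.Structures using (IsTotalOrder)
open import Relation.Nullary using (¬_; Dec; yes; no; does)
open import Relation.Nullary.Decidable using (dec-true; dec-false)
open import Relation.Unary using (Pred; _∈_; _⊆_)
open import Defs

-- The field is abstract, so no calculus is at hand. Beyond order arguments the analysis rests on
-- one inequality, 1 + p (y - 1) ≤ y^p, which also supplies the Lipschitz bound for the compactness
-- argument; the exponent laws established are (x y)^p = x^p y^p, (x^(1/p))^p = x and x^(2-2/p)
-- x^(1/p) x^(1/p) = x². Since `spectralRadius` and `ex` default to zero when no maximum exists,
-- nothing can be read off from them before attainment is proved: for vectors by a cluster point of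
-- near-maximisers, for graphs by a search through the finitely many Boolean matrices. The cap δ n
-- on single weights is what turns weight into vertices: a set carrying a fixed share of the total
-- must then contain many of them. Without it, a few heavy vertices could account for the whole
-- share. Estimates are kept multiplied by r, and each is written as an exact ring identity with
-- nonnegative remainder, so that the solver checks all the arithmetic.

-- Ring identities by normalisation with integer coefficients

module IntegerCoefficientSolver (R : CommutativeRing 0ℓ 0ℓ) where
  open CommutativeRing R hiding (zero)
  open Multiples semiring using (×-homo-+; ×1-homo-*) renaming (_×_ to _·_)
  open RingProperties ring using (-‿distribˡ-*; -‿involutive; -0#≈0#; -‿+-comm)
  open SetoidReasoning setoid

  almostCommutativeRing : AlmostCommutativeRing 0ℓ 0ℓ
  almostCommutativeRing = fromCommutativeRing R

  private
    infixr 8 _∙1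
    -- The separate case `suc zero` makes the images of 1 and 2 literally `1#` and `1# + 1#`,
    -- whereas `n · 1#` ends in a zero. Solver constants thus match `1#` and `two` definitionally,
    -- while `fromℕ 3` is spelled `:1 :+ (:1 :+ (:1 :+ :0))`.
    _∙1 : ℕ → Carrier
    zero        ∙1 = 0#
    suc zero    ∙1 = 1#
    suc (suc n) ∙1 = 1# + suc n ∙1

    ∙1-suc : ∀ n → suc n ∙1 ≈ 1# + n ∙1
    ∙1-suc zero    = sym (+-identityʳ 1#)
    ∙1-suc (suc n) = refl

    ∙1≈· : ∀ n → n ∙1 ≈ n · 1#
    ∙1≈· zero    = refl
    ∙1≈· (suc n) = trans (∙1-suc n) (+-congˡ (∙1≈· n))

    ⟦_⟧ : ℤ → Carrier
    ⟦ ℤ.+ n ⟧    = n ∙1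
    ⟦ -[1+ n ] ⟧ = - (suc n ∙1)

    -‿homo : ∀ i → ⟦ ℤ.- i ⟧ ≈ - ⟦ i ⟧
    -‿homo (ℤ.+ zero)  = sym -0#≈0#
    -‿homo (ℤ.+ suc n) = refl
    -‿homo -[1+ n ]    = sym (-‿involutive _)

    ∙1-homo-+ : ∀ m n → (m ℕ.+ n) ∙1 ≈ m ∙1 + n ∙1
    ∙1-homo-+ m n = begin
      (m ℕ.+ n) ∙1       ≈⟨ ∙1≈· (m ℕ.+ n) ⟩
      (m ℕ.+ n) · 1#     ≈⟨ ×-homo-+ 1# m n ⟩
      m · 1# + n · 1#    ≈⟨ +-cong (∙1≈· m) (∙1≈· n) ⟨
      m ∙1 + n ∙1        ∎

    ⊖-homo : ∀ m n → ⟦ m ℤ.⊖ n ⟧ ≈ m ∙1 - n ∙1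
    ⊖-homo zero zero = sym (-‿inverseʳ 0#)
    ⊖-homo zero (suc n) = sym (+-identityˡ _)
    ⊖-homo (suc m) zero = sym (trans (+-congˡ -0#≈0#) (+-identityʳ _))
    ⊖-homo (suc m) (suc n) = begin
      ⟦ suc m ℤ.⊖ suc n ⟧              ≡⟨ ≡.cong ⟦_⟧ (ℤ.[1+m]⊖[1+n]≡m⊖n m n) ⟩
      ⟦ m ℤ.⊖ n ⟧                      ≈⟨ ⊖-homo m n ⟩
      m ∙1 - n ∙1                      ≈⟨ +-congʳ (+-identityʳ _) ⟨
      (m ∙1 + 0#) - n ∙1               ≈⟨ +-congʳ (+-congˡ (-‿inverseʳ 1#)) ⟨
      (m ∙1 + (1# - 1#)) - n ∙1        ≈⟨ +-congʳ (+-assoc _ _ _) ⟨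
      ((m ∙1 + 1#) - 1#) - n ∙1        ≈⟨ +-assoc _ _ _ ⟩
      (m ∙1 + 1#) + (- 1# - n ∙1)      ≈⟨ +-cong (+-comm _ _) (-‿+-comm 1# (n ∙1)) ⟩
      (1# + m ∙1) - (1# + n ∙1)        ≈⟨ +-cong (∙1-suc m) (-‿cong (∙1-suc n)) ⟨
      suc m ∙1 - suc n ∙1              ∎

    +-homo : ∀ i j → ⟦ i ℤ.+ j ⟧ ≈ ⟦ i ⟧ + ⟦ j ⟧
    +-homo (ℤ.+ m)  (ℤ.+ n)  = ∙1-homo-+ m n
    +-homo (ℤ.+ m)  -[1+ n ] = ⊖-homo m (suc n)
    +-homo -[1+ m ] (ℤ.+ n)  = trans (⊖-homo n (suc m)) (+-comm _ _)
    +-homo -[1+ m ] -[1+ n ] = begin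
      - ((suc (suc (m ℕ.+ n))) ∙1)   ≡⟨ ≡.cong (λ k → - (suc k ∙1)) (ℕ.+-suc m n) ⟨
      - ((suc m ℕ.+ suc n) ∙1)       ≈⟨ -‿cong (∙1-homo-+ (suc m) (suc n)) ⟩
      - (suc m ∙1 + suc n ∙1)        ≈⟨ -‿+-comm (suc m ∙1) (suc n ∙1) ⟨
      - (suc m ∙1) - suc n ∙1        ∎

    *-homo-+ˡ : ∀ m j → ⟦ ℤ.+ m ℤ.* j ⟧ ≈ ⟦ ℤ.+ m ⟧ * ⟦ j ⟧
    *-homo-+ˡ m (ℤ.+ n) = begin
      ⟦ ℤ.+ m ℤ.* ℤ.+ n ⟧     ≡⟨ ≡.cong ⟦_⟧ (ℤ.pos-* m n) ⟨
      (m ℕ.* n) ∙1            ≈⟨ ∙1≈· (m ℕ.* n) ⟩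
      (m ℕ.* n) · 1#          ≈⟨ ×1-homo-* m n ⟩
      (m · 1#) * (n · 1#)     ≈⟨ *-cong (∙1≈· m) (∙1≈· n) ⟨
      m ∙1 * n ∙1             ∎
    *-homo-+ˡ m -[1+ n ] = begin
      ⟦ ℤ.+ m ℤ.* -[1+ n ] ⟧          ≡⟨ ≡.cong ⟦_⟧ (ℤ.neg-distribʳ-* (ℤ.+ m) (ℤ.+ suc n)) ⟨
      ⟦ ℤ.- (ℤ.+ m ℤ.* ℤ.+ suc n) ⟧   ≈⟨ -‿homo (ℤ.+ m ℤ.* ℤ.+ suc n) ⟩
      - ⟦ ℤ.+ m ℤ.* ℤ.+ suc n ⟧       ≈⟨ -‿cong (*-homo-+ˡ m (ℤ.+ suc n)) ⟩
      - (m ∙1 * suc n ∙1)             ≈⟨ RingProperties.-‿distribʳ-* ring _ _ ⟩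
      m ∙1 * - (suc n ∙1)             ∎

    *-homo : ∀ i j → ⟦ i ℤ.* j ⟧ ≈ ⟦ i ⟧ * ⟦ j ⟧
    *-homo (ℤ.+ m) j = *-homo-+ˡ m j
    *-homo -[1+ m ] j = begin
      ⟦ -[1+ m ] ℤ.* j ⟧              ≡⟨ ≡.cong ⟦_⟧ (ℤ.neg-distribˡ-* (ℤ.+ suc m) j) ⟨
      ⟦ ℤ.- (ℤ.+ suc m ℤ.* j) ⟧       ≈⟨ -‿homo (ℤ.+ suc m ℤ.* j) ⟩
      - ⟦ ℤ.+ suc m ℤ.* j ⟧           ≈⟨ -‿cong (*-homo-+ˡ (suc m) j) ⟩
      - (suc m ∙1 * ⟦ j ⟧)            ≈⟨ -‿distribˡ-* _ _ ⟩
      - (suc m ∙1) * ⟦ j ⟧            ∎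

    ℤ⟶R : ℤ.+-*-rawRing -Raw-AlmostCommutative⟶ almostCommutativeRing
    ℤ⟶R = record
      { ⟦_⟧ = ⟦_⟧ ; +-homo = +-homo ; *-homo = *-homo ; -‿homo = -‿homo
      ; 0-homo = refl ; 1-homo = refl }

    -- Comparing integers instead of their images is sound in every ring; answering `nothing` for
    -- distinct integers with equal images merely leaves terms uncancelled.
    coefficientsEqual? : WeaklyDecidable (λ i j → ⟦ i ⟧ ≈ ⟦ j ⟧)
    coefficientsEqual? i j with i ℤ.≟ j
    ... | yes i≡j = just (reflexive (≡.cong ⟦_⟧ i≡j))
    ... | no  _   = nothing

  open RingSolver ℤ.+-*-rawRing almostCommutativeRing ℤ⟶R coefficientsEqual? public
    using (solve; _:=_; _:+_; _:*_; _:-_; :-_; _:^_; con; Polynomial)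

  :0 :1 :2 : ∀ {n} → Polynomial n
  :0 = con (ℤ.+ 0)
  :1 = con (ℤ.+ 1)
  :2 = con (ℤ.+ 2)

-- Consequences of the ordered field axioms

module OrderedField (em : ExcludedMiddle 0ℓ) (ℝ : CompleteOrderedField) where
  open CompleteOrderedField ℝ hiding (zero)
  open IsTotalOrder isTotalOrder public using ()
    renaming ( refl to ≤-refl; reflexive to ≤-reflexive; trans to ≤-trans
             ; antisym to ≤-antisym; total to ≤-total )
  open IntegerCoefficientSolver commutativeRing public
  open Exp commutativeSemiring public
    using (^-homo-*; ^-assocʳ; ^-distrib-*; ^-congˡ)
  open MaxOperator (Max.maxOperator totalOrder) using (x≤y⇒x⊔y≈y; x≥y⇒x⊔y≈x)
  module ≤-Reasoning = PartialOrderReasoning (TotalOrder.poset totalOrder)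
  module ≈-Reasoning = SetoidReasoning setoid

  x≤y⇒0≤y-x : ∀ {x y} → x ≤ y → 0# ≤ y - x
  x≤y⇒0≤y-x {x} x≤y = ≤-trans (≤-reflexive (sym (-‿inverseʳ x))) (+-monoˡ-≤ (- x) x≤y)

  -- An inequality is proved by exhibiting y as x plus a visibly
  -- nonnegative term, so that only a ring identity remains.
  ≤-by : ∀ {x y c} → 0# ≤ c → y ≈ x + c → x ≤ y
  ≤-by {x} {y} {c} 0≤c y≈x+c = begin
    x       ≈⟨ +-identityˡ x ⟨
    0# + x  ≤⟨ +-monoˡ-≤ x 0≤c ⟩
    c + x   ≈⟨ +-comm c x ⟩
    x + c   ≈⟨ y≈x+c ⟨
    y       ∎
    where open ≤-Reasoning

  infixl 6 _⊕_
  infixl 7 _⊗_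

  _⊕_ : ∀ {x y} → 0# ≤ x → 0# ≤ y → 0# ≤ x + y
  _⊕_ {x} {y} 0≤x 0≤y = ≤-trans 0≤x (≤-by 0≤y refl)

  _⊗_ : ∀ {x y} → 0# ≤ x → 0# ≤ y → 0# ≤ x * y
  _⊗_ = *-nonNeg

  +-mono-≤ : ∀ {w x y z} → w ≤ x → y ≤ z → w + y ≤ x + z
  +-mono-≤ {w} {x} {y} {z} w≤x y≤z = ≤-by (x≤y⇒0≤y-x w≤x ⊕ x≤y⇒0≤y-x y≤z)
    (solve 4 (λ w x y z → x :+ z := (w :+ y) :+ ((x :- w) :+ (z :- y))) refl w x y z)

  *-monoʳ-≤ : ∀ {x y} z → 0# ≤ z → x ≤ y → x * z ≤ y * z
  *-monoʳ-≤ {x} {y} z 0≤z x≤y = ≤-by (x≤y⇒0≤y-x x≤y ⊗ 0≤z)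
    (solve 3 (λ x y z → y :* z := x :* z :+ (y :- x) :* z) refl x y z)

  *-monoˡ-≤ : ∀ {x y} z → 0# ≤ z → x ≤ y → z * x ≤ z * y
  *-monoˡ-≤ {x} {y} z 0≤z x≤y = ≤-by (x≤y⇒0≤y-x x≤y ⊗ 0≤z)
    (solve 3 (λ x y z → z :* y := z :* x :+ (y :- x) :* z) refl x y z)

  *-mono-≤ : ∀ {w x y z} → 0# ≤ w → 0# ≤ y → w ≤ x → y ≤ z → w * y ≤ x * z
  *-mono-≤ {w} {x} {y} {z} 0≤w 0≤y w≤x y≤z =
    ≤-trans (*-monoʳ-≤ y 0≤y w≤x) (*-monoˡ-≤ x (≤-trans 0≤w w≤x) y≤z)

  neg-mono-≤ : ∀ {x y} → x ≤ y → - y ≤ - x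
  neg-mono-≤ {x} {y} x≤y = ≤-by (x≤y⇒0≤y-x x≤y)
    (solve 2 (λ x y → :- x := :- y :+ (y :- x)) refl x y)

  0≤1 : 0# ≤ 1#
  0≤1 with ≤-total 0# 1#
  ... | inj₁ 0≤1 = 0≤1
  ... | inj₂ 1≤0 = ≤-by (0≤-1 ⊗ 0≤-1) (solve 0 (:1 := :0 :+ (:0 :- :1) :* (:0 :- :1)) refl)
    where 0≤-1 = x≤y⇒0≤y-x 1≤0

  infix 4 _≤?_
  _≤?_ : ∀ x y → Dec (x ≤ y)
  x ≤? y = em

  ≰⇒> : ∀ {x y} → ¬ x ≤ y → y < x
  ≰⇒> {x} {y} x≰y with ≤-total x y
  ... | inj₁ x≤y = ⊥-elim (x≰y x≤y)
  ... | inj₂ y≤x = y≤x , λ y≈x → x≰y (≤-reflexive (sym y≈x))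

  <⇒≱ : ∀ {x y} → x < y → ¬ y ≤ x
  <⇒≱ (x≤y , x≉y) y≤x = x≉y (≤-antisym x≤y y≤x)

  ≤⇒≈⊎< : ∀ {x y} → x ≤ y → x ≈ y ⊎ x < y
  ≤⇒≈⊎< {x} {y} x≤y with em {x ≈ y}
  ... | yes x≈y = inj₁ x≈y
  ... | no  x≉y = inj₂ (x≤y , x≉y)

  ≤-by-contradiction : ∀ {x y} → (y < x → x ≤ y) → x ≤ y
  ≤-by-contradiction {x} {y} f with x ≤? y
  ... | yes x≤y = x≤y
  ... | no  x≰y = f (≰⇒> x≰y)

  <-≤-trans : ∀ {x y z} → x < y → y ≤ z → x < z
  <-≤-trans (x≤y , x≉y) y≤z = ≤-trans x≤y y≤z ,
    λ x≈z → x≉y (≤-antisym x≤y (≤-trans y≤z (≤-reflexive (sym x≈z))))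

  ≤-<-trans : ∀ {x y z} → x ≤ y → y < z → x < z
  ≤-<-trans x≤y (y≤z , y≉z) = ≤-trans x≤y y≤z ,
    λ x≈z → y≉z (≤-antisym y≤z (≤-trans (≤-reflexive (sym x≈z)) x≤y))

  0<1 : 0# < 1#
  0<1 = 0≤1 , 0≉1

  x<y⇒0<y-x : ∀ {x y} → x < y → 0# < y - x
  x<y⇒0<y-x {x} {y} (x≤y , x≉y) = x≤y⇒0≤y-x x≤y , λ 0≈y-x → x≉y (begin
    x            ≈⟨ +-identityˡ x ⟨
    0# + x       ≈⟨ +-congʳ 0≈y-x ⟩
    (y - x) + x  ≈⟨ solve 2 (λ x y → (y :- x) :+ x := y) refl x y ⟩
    y            ∎)
    where open ≈-Reasoning

  ⁻¹-inverseˡ : ∀ x → ¬ x ≈ 0# → x ⁻¹ * x ≈ 1#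
  ⁻¹-inverseˡ x x≉0 = trans (*-comm _ _) (⁻¹-inverseʳ x x≉0)

  >⇒≉0 : ∀ {x} → 0# < x → ¬ x ≈ 0#
  >⇒≉0 (_ , 0≉x) x≈0 = 0≉x (sym x≈0)

  0≤⁻¹ : ∀ {x} → 0# < x → 0# ≤ x ⁻¹
  0≤⁻¹ {x} 0<x with ≤-total 0# (x ⁻¹)
  ... | inj₁ 0≤x⁻¹ = 0≤x⁻¹
  ... | inj₂ x⁻¹≤0 = ⊥-elim (<⇒≱ 0<1 (≤-by (x≤y⇒0≤y-x x⁻¹≤0 ⊗ proj₁ 0<x) (begin
    0#                          ≈⟨ solve 2 (λ x y → :0 := x :* y :+ (:0 :- y) :* x) refl x (x ⁻¹) ⟩
    x * x ⁻¹ + (0# - x ⁻¹) * x  ≈⟨ +-congʳ (⁻¹-inverseʳ x (>⇒≉0 0<x)) ⟩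
    1# + (0# - x ⁻¹) * x        ∎)))
    where open ≈-Reasoning

  0<⁻¹ : ∀ {x} → 0# < x → 0# < x ⁻¹
  0<⁻¹ {x} 0<x = 0≤⁻¹ 0<x , λ 0≈x⁻¹ → 0≉1 (begin
    0#        ≈⟨ zeroʳ x ⟨
    x * 0#    ≈⟨ *-congˡ 0≈x⁻¹ ⟩
    x * x ⁻¹  ≈⟨ ⁻¹-inverseʳ x (>⇒≉0 0<x) ⟩
    1#        ∎)
    where open ≈-Reasoning

  *-cancelʳ-≤ : ∀ {x y} z → 0# < z → x * z ≤ y * z → x ≤ y
  *-cancelʳ-≤ {x} {y} z 0<z xz≤yz = begin
    x               ≈⟨ cancel x ⟨
    x * z * z ⁻¹    ≤⟨ *-monoʳ-≤ (z ⁻¹) (0≤⁻¹ 0<z) xz≤yz ⟩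
    y * z * z ⁻¹    ≈⟨ cancel y ⟩
    y               ∎
    where
    open ≤-Reasoning
    cancel : ∀ w → w * z * z ⁻¹ ≈ w
    cancel w = trans (*-assoc w z (z ⁻¹))
      (trans (*-congˡ (⁻¹-inverseʳ z (>⇒≉0 0<z))) (*-identityʳ w))

  *-cancelˡ-≤ : ∀ {x y} z → 0# < z → z * x ≤ z * y → x ≤ y
  *-cancelˡ-≤ {x} {y} z 0<z zx≤zy = *-cancelʳ-≤ z 0<z
    (≤-trans (≤-reflexive (*-comm x z)) (≤-trans zx≤zy (≤-reflexive (*-comm z y))))

  0<* : ∀ {x y} → 0# < x → 0# < y → 0# < x * y
  0<* {x} {y} 0<x 0<y = proj₁ 0<x ⊗ proj₁ 0<y , λ 0≈xy → <⇒≱ 0<x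
    (*-cancelʳ-≤ y 0<y (≤-reflexive (trans (sym 0≈xy) (sym (zeroˡ y)))))

  0<+ : ∀ {x y} → 0# < x → 0# ≤ y → 0# < x + y
  0<+ 0<x 0≤y = <-≤-trans 0<x (≤-by 0≤y refl)

  x<x+1 : ∀ x → x < x + 1#
  x<x+1 x = ≤-by 0≤1 refl , λ x≈x+1 → 0≉1 (begin
    0#            ≈⟨ -‿inverseʳ x ⟨
    x - x         ≈⟨ +-congʳ x≈x+1 ⟩
    (x + 1#) - x  ≈⟨ solve 1 (λ x → (x :+ :1) :- x := :1) refl x ⟩
    1#            ∎)
    where open ≈-Reasoning

  two : Carrier
  two = 1# + 1#

  0<two : 0# < two
  0<two = 0<+ 0<1 0≤1

  half : Carrier
  half = two ⁻¹

  half+half≈1 : half + half ≈ 1#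
  half+half≈1 = trans (solve 1 (λ h → h :+ h := :2 :* h) refl half)
                      (⁻¹-inverseʳ two (>⇒≉0 0<two))

  0<half : 0# < half
  0<half = 0<⁻¹ 0<two

  minimum : ∀ {x y} → 0# < x → 0# < y → ∃ λ z → 0# < z × z ≤ x × z ≤ y
  minimum {x} {y} 0<x 0<y with ≤-total x y
  ... | inj₁ x≤y = x , 0<x , ≤-refl , x≤y
  ... | inj₂ y≤x = y , 0<y , y≤x , ≤-refl

  maximum : ∀ x y → ∃ λ z → x ≤ z × y ≤ z
  maximum x y with ≤-total x y
  ... | inj₁ x≤y = y , x≤y , ≤-refl
  ... | inj₂ y≤x = x , ≤-refl , y≤x

  -- Natural numbers

  0≤fromℕ : ∀ n → 0# ≤ fromℕ n
  0≤fromℕ zero    = ≤-refl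
  0≤fromℕ (suc n) = 0≤1 ⊕ 0≤fromℕ n

  fromℕ-+ : ∀ m n → fromℕ (m ℕ.+ n) ≈ fromℕ m + fromℕ n
  fromℕ-+ = Multiples.×-homo-+ semiring 1#

  fromℕ-* : ∀ m n → fromℕ (m ℕ.* n) ≈ fromℕ m * fromℕ n
  fromℕ-* = Multiples.×1-homo-* semiring

  fromℕ-mono-≤ : ∀ {m n} → m ℕ.≤ n → fromℕ m ≤ fromℕ n
  fromℕ-mono-≤ {n = n} z≤n = 0≤fromℕ n
  fromℕ-mono-≤ (s≤s m≤n)   = +-mono-≤ ≤-refl (fromℕ-mono-≤ m≤n)

  0<fromℕ : ∀ {n} → 1 ℕ.≤ n → 0# < fromℕ n
  0<fromℕ (s≤s {n = n} _) = 0<+ 0<1 (0≤fromℕ n)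

  1≤fromℕ : ∀ {n} → 1 ℕ.≤ n → 1# ≤ fromℕ n
  1≤fromℕ (s≤s {n = n} _) = ≤-by (0≤fromℕ n) refl

  fromℕ-cancel-≤ : ∀ {m n} → fromℕ m ≤ fromℕ n → m ℕ.≤ n
  fromℕ-cancel-≤ {m} {n} m≤n with m ℕ.≤? n
  ... | yes p = p
  ... | no m≰n = ⊥-elim (<⇒≱ (x<x+1 (fromℕ n))
    (≤-trans (≤-reflexive (+-comm _ _)) (≤-trans (fromℕ-mono-≤ (ℕ.≰⇒> m≰n)) m≤n)))

  -- If x bounds all natural numbers, their supremum s satisfies n + 1 ≤ s for every n. Then s - 1
  -- bounds them too, against the minimality of s.
  archimedean : ∀ x → ∃ λ n → x ≤ fromℕ n
  archimedean x with em {∃ λ n → x ≤ fromℕ n}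
  ... | yes p = p
  ... | no ¬p = ⊥-elim (<⇒≱ (x<x+1 (s - 1#)) (≤-trans (≤-reflexive s-1+1≈s) s≤s-1))
    where
    fromℕ≤x : ∀ n → fromℕ n ≤ x
    fromℕ≤x n with ≤-total (fromℕ n) x
    ... | inj₁ q = q
    ... | inj₂ q = ⊥-elim (¬p (n , q))
    supremum : ∃ (IsSupremum (λ y → ∃ λ n → y ≈ fromℕ n))
    supremum = complete _ (0# , 0 , refl) (x , λ { y (n , y≈n) → ≤-trans (≤-reflexive y≈n) (fromℕ≤x n) })
    s = proj₁ supremum
    s-1+1≈s : (s - 1#) + 1# ≈ s
    s-1+1≈s = solve 1 (λ s → (s :- :1) :+ :1 := s) refl s
    s≤s-1 : s ≤ s - 1#
    s≤s-1 = proj₂ (proj₂ supremum) (s - 1#) λ { y (n , y≈n) →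
      ≤-by (x≤y⇒0≤y-x (proj₁ (proj₂ supremum) (fromℕ (suc n)) (suc n , refl)))
        (trans (solve 2 (λ s n → s :- :1 := n :+ (s :- (:1 :+ n))) refl s (fromℕ n))
               (+-congʳ (sym y≈n))) }

  0<1+ : ∀ {x} → 0# ≤ x → 0# < 1# + x
  0<1+ = 0<+ 0<1

  -- Removes an error of order 1/n: approximating a real exponent by fractions with denominator n
  -- loses C / n for every n, hence nothing.
  fromℕ-scaled-bounded⇒≤0 : ∀ {x C} → (∀ n → fromℕ n * x ≤ C) → x ≤ 0#
  fromℕ-scaled-bounded⇒≤0 {x} {C} bounded = ≤-by-contradiction λ 0<x →
    let n , q = archimedean ((C + 1#) * x ⁻¹)
        cancel = trans (*-assoc _ _ _) (trans (*-congˡ (⁻¹-inverseˡ x (>⇒≉0 0<x))) (*-identityʳ _))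
    in ⊥-elim (<⇒≱ (x<x+1 C) (begin
      C + 1#               ≈⟨ cancel ⟨
      (C + 1#) * x ⁻¹ * x  ≤⟨ *-monoʳ-≤ x (proj₁ 0<x) q ⟩
      fromℕ n * x          ≤⟨ bounded n ⟩
      C                    ∎))
    where open ≤-Reasoning

  -- If y < x, the choice ε = (x - y) / (1 + K) gives K ε < x - y, a contradiction.
  ≤-by-approximation : ∀ {x y} K → 0# ≤ K → (∀ ε → 0# < ε → x ≤ y + K * ε) → x ≤ y
  ≤-by-approximation {x} {y} K 0≤K approx = ≤-by-contradiction λ y<x →
    let d   = x - y
        i   = (1# + K) ⁻¹
        0<i = 0<⁻¹ (0<1+ 0≤K)
        0<ε = 0<* (x<y⇒0<y-x y<x) 0<i
    in ⊥-elim (<⇒≱ 0<ε (≤-by (x≤y⇒0≤y-x (approx (d * i) 0<ε)) (begin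
      -- The factor `1#` in `d * 1#` is written out so that the next step can replace it by
      -- `(1# + K) * i`.
      0#                                             ≈⟨ solve 3 (λ x y w → :0 := (x :- y) :* (:1 :- w :* :1)  :+ ((x :- y) :* w :- (x :- y))) refl x y 1# ⟩
      d * (1# - 1# * 1#) + (d * 1# - d)              ≈⟨ +-congˡ (+-congʳ (*-congˡ (⁻¹-inverseʳ _ (>⇒≉0 (0<1+ 0≤K))))) ⟨
      d * (1# - 1# * 1#) + (d * ((1# + K) * i) - d)  ≈⟨ solve 4 (λ x y K i →
          (x :- y) :* (:1 :- :1 :* :1) :+ ((x :- y) :* ((:1 :+ K) :* i) :- (x :- y))
          := (x :- y) :* i :+ (y :+ K :* ((x :- y) :* i) :- x)) refl x y K i ⟩
      d * i + (y + K * (d * i) - x)                  ∎)))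
    where open ≈-Reasoning

  floor : ∀ x → 0# ≤ x → ∃ λ n → fromℕ n ≤ x × x ≤ fromℕ (suc n)
  floor x 0≤x = let n , q = archimedean x in search n q
    where
    search : ∀ n → x ≤ fromℕ n → ∃ λ n → fromℕ n ≤ x × x ≤ fromℕ (suc n)
    search zero    x≤0   = 0 , 0≤x , ≤-trans x≤0 (0≤fromℕ 1)
    search (suc n) x≤1+n with ≤-total x (fromℕ n)
    ... | inj₁ x≤n = search n x≤n
    ... | inj₂ n≤x = n , n≤x , x≤1+n

  -- Natural powers

  0≤^ : ∀ {x} n → 0# ≤ x → 0# ≤ x ^ n
  0≤^ zero    0≤x = 0≤1
  0≤^ (suc n) 0≤x = 0≤x ⊗ 0≤^ n 0≤x

  0<^ : ∀ {x} n → 0# < x → 0# < x ^ n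
  0<^ zero    0<x = 0<1
  0<^ (suc n) 0<x = 0<* 0<x (0<^ n 0<x)

  ^-monoˡ-≤ : ∀ {x y} n → 0# ≤ x → x ≤ y → x ^ n ≤ y ^ n
  ^-monoˡ-≤ zero    0≤x x≤y = ≤-refl
  ^-monoˡ-≤ (suc n) 0≤x x≤y = *-mono-≤ 0≤x (0≤^ n 0≤x) x≤y (^-monoˡ-≤ n 0≤x x≤y)

  1^n≈1 : ∀ n → 1# ^ n ≈ 1#
  1^n≈1 zero    = refl
  1^n≈1 (suc n) = trans (*-identityˡ _) (1^n≈1 n)

  1≤^ : ∀ {x} n → 1# ≤ x → 1# ≤ x ^ n
  1≤^ {x} n 1≤x = ≤-trans (≤-reflexive (sym (1^n≈1 n))) (^-monoˡ-≤ n 0≤1 1≤x)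

  ^≤1 : ∀ {x} n → 0# ≤ x → x ≤ 1# → x ^ n ≤ 1#
  ^≤1 {x} n 0≤x x≤1 = ≤-trans (^-monoˡ-≤ n 0≤x x≤1) (≤-reflexive (1^n≈1 n))

  ^-monoʳ-≤ : ∀ {x m n} → 1# ≤ x → m ℕ.≤ n → x ^ m ≤ x ^ n
  ^-monoʳ-≤ {n = n} 1≤x z≤n = 1≤^ n 1≤x
  ^-monoʳ-≤ {x} 1≤x (s≤s m≤n) = *-monoˡ-≤ x (≤-trans 0≤1 1≤x) (^-monoʳ-≤ 1≤x m≤n)

  ^-antiʳ-≤ : ∀ {x m n} → 0# ≤ x → x ≤ 1# → m ℕ.≤ n → x ^ n ≤ x ^ m
  ^-antiʳ-≤ {n = n} 0≤x x≤1 z≤n = ^≤1 n 0≤x x≤1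
  ^-antiʳ-≤ {x} 0≤x x≤1 (s≤s m≤n) = *-monoˡ-≤ x 0≤x (^-antiʳ-≤ 0≤x x≤1 m≤n)

  ^-bernoulli : ∀ {u} n → 0# ≤ u → 1# + fromℕ n * u ≤ (1# + u) ^ n
  ^-bernoulli {u} zero 0≤u = ≤-reflexive (solve 1 (λ u → :1 :+ :0 :* u := :1) refl u)
  ^-bernoulli {u} (suc n) 0≤u = ≤-trans
    (≤-by (0≤fromℕ n ⊗ (0≤u ⊗ 0≤u))
      (solve 2 (λ u n → (:1 :+ u) :* (:1 :+ n :* u) :=
                        :1 :+ (:1 :+ n) :* u :+ n :* (u :* u)) refl u (fromℕ n)))
    (*-monoˡ-≤ (1# + u) (0≤1 ⊕ 0≤u) (^-bernoulli n 0≤u))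

  -- For x > 1 the Bernoulli inequality makes x^n at least n (x - 1), which is unbounded.
  ^-bounded⇒≤1 : ∀ {x C} → (∀ n → x ^ n ≤ C) → x ≤ 1#
  ^-bounded⇒≤1 {x} {C} bounded = ≤-by-contradiction λ 1<x →
    let 0≤x-1 = x≤y⇒0≤y-x (proj₁ 1<x)
        x≈1+[x-1] = solve 1 (λ x → x := :1 :+ (x :- :1)) refl x
        x-1≤0 : x - 1# ≤ 0#
        x-1≤0 = fromℕ-scaled-bounded⇒≤0 {C = C} λ n →
          ≤-trans (≤-trans (≤-by 0≤1 (+-comm _ _)) (^-bernoulli n 0≤x-1))
                  (≤-trans (≤-reflexive (^-congˡ n (sym x≈1+[x-1]))) (bounded n))
    in ≤-by (x≤y⇒0≤y-x x-1≤0) (solve 1 (λ x → :1 := x :+ (:0 :- (x :- :1))) refl x)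

  -- If y < x, then x · x^n ≤ y · y^n ≤ y · x^n, and the positive factor x^n cancels.
  ^-cancelˡ-≤ : ∀ {x y} n → 0# ≤ x → 0# ≤ y → 1 ℕ.≤ n → x ^ n ≤ y ^ n → x ≤ y
  ^-cancelˡ-≤ {x} {y} (suc n) 0≤x 0≤y _ xⁿ≤yⁿ = ≤-by-contradiction λ y<x →
    let 0<x = ≤-<-trans 0≤y y<x in
    *-cancelʳ-≤ (x ^ n) (0<^ n 0<x)
      (≤-trans xⁿ≤yⁿ (*-monoˡ-≤ y 0≤y (^-monoˡ-≤ n 0≤y (proj₁ y<x))))

  -- Absolute values

  ∣∣-cases : ∀ x → (0# ≤ x × ∣ x ∣ ≈ x) ⊎ (x ≤ 0# × ∣ x ∣ ≈ - x)
  ∣∣-cases x with ≤-total x (- x)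
  ... | inj₂ -x≤x = inj₁ (*-cancelʳ-≤ two 0<two
          (≤-by (x≤y⇒0≤y-x -x≤x) (solve 1 (λ x → x :* :2 := :0 :* :2 :+ (x :- :- x)) refl x)) ,
          x≥y⇒x⊔y≈x -x≤x)
  ... | inj₁ x≤-x = inj₂ (*-cancelʳ-≤ two 0<two
          (≤-by (x≤y⇒0≤y-x x≤-x) (solve 1 (λ x → :0 :* :2 := x :* :2 :+ (:- x :- x)) refl x)) ,
          x≤y⇒x⊔y≈y x≤-x)

  0≤-x : ∀ {x} → x ≤ 0# → 0# ≤ - x
  0≤-x x≤0 = ≤-trans (x≤y⇒0≤y-x x≤0) (≤-reflexive (+-identityˡ _))

  0≤∣x∣ : ∀ x → 0# ≤ ∣ x ∣
  0≤∣x∣ x with ∣∣-cases x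
  ... | inj₁ (0≤x , eq) = ≤-trans 0≤x (≤-reflexive (sym eq))
  ... | inj₂ (x≤0 , eq) = ≤-trans (0≤-x x≤0) (≤-reflexive (sym eq))

  x≤∣x∣ : ∀ x → x ≤ ∣ x ∣
  x≤∣x∣ x with ∣∣-cases x
  ... | inj₁ (0≤x , eq) = ≤-reflexive (sym eq)
  ... | inj₂ (x≤0 , eq) = ≤-trans x≤0 (≤-trans (0≤-x x≤0) (≤-reflexive (sym eq)))

  -x≤∣x∣ : ∀ x → - x ≤ ∣ x ∣
  -x≤∣x∣ x with ∣∣-cases x
  ... | inj₁ (0≤x , eq) = ≤-trans (neg-mono-≤ 0≤x)
        (≤-trans (≤-reflexive (solve 0 (:- :0 := :0) refl)) (0≤∣x∣ x))
  ... | inj₂ (_ , eq)   = ≤-reflexive (sym eq)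

  ∣x∣≈x : ∀ {x} → 0# ≤ x → ∣ x ∣ ≈ x
  ∣x∣≈x {x} 0≤x with ∣∣-cases x
  ... | inj₁ (_ , eq) = eq
  ... | inj₂ (x≤0 , eq) = trans eq (≤-antisym
          (≤-trans (neg-mono-≤ 0≤x) (≤-trans (≤-reflexive -0≈0) 0≤x))
          (≤-trans x≤0 (0≤-x x≤0)))
    where -0≈0 = solve 0 (:- :0 := :0) refl

  ∣x∣≤c : ∀ {x c} → x ≤ c → - x ≤ c → ∣ x ∣ ≤ c
  ∣x∣≤c {x} x≤c -x≤c with ∣∣-cases x
  ... | inj₁ (_ , eq) = ≤-trans (≤-reflexive eq) x≤c
  ... | inj₂ (_ , eq) = ≤-trans (≤-reflexive eq) -x≤c

  xy≤∣x∣∣y∣ : ∀ x y → x * y ≤ ∣ x ∣ * ∣ y ∣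
  xy≤∣x∣∣y∣ x y with ∣∣-cases x | ∣∣-cases y
  ... | inj₁ (_ , p) | inj₁ (_ , q) = ≤-reflexive (sym (*-cong p q))
  ... | inj₂ (_ , p) | inj₂ (_ , q) = ≤-reflexive (sym (trans (*-cong p q)
        (solve 2 (λ x y → :- x :* :- y := x :* y) refl x y)))
  ... | inj₁ (0≤x , _) | inj₂ (y≤0 , _) = ≤-trans
        (≤-by (0≤x ⊗ 0≤-x y≤0) (solve 2 (λ x y → :0 := x :* y :+ x :* :- y) refl x y))
        (0≤∣x∣ x ⊗ 0≤∣x∣ y)
  ... | inj₂ (x≤0 , _) | inj₁ (0≤y , _) = ≤-trans
        (≤-by (0≤-x x≤0 ⊗ 0≤y) (solve 2 (λ x y → :0 := x :* y :+ :- x :* y) refl x y))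
        (0≤∣x∣ x ⊗ 0≤∣x∣ y)

-- Real powers, from suprema to comparison of integer powers

module RealPowers (em : ExcludedMiddle 0ℓ) (ℝ : CompleteOrderedField) where
  open CompleteOrderedField ℝ hiding (zero)
  open Classical em ℝ
  open OrderedField em ℝ

  -- Suprema

  sup-isSupremum : ∀ {S} → ∃ (IsSupremum S) → IsSupremum S (sup S)
  sup-isSupremum {S} has with em {∃ (IsSupremum S)}
  ... | yes s  = proj₂ s
  ... | no ¬s = ⊥-elim (¬s has)

  isSupremum-unique : ∀ {S s t} → IsSupremum S s → IsSupremum S t → s ≈ t
  isSupremum-unique (ubs , s≤) (ubt , t≤) = ≤-antisym (s≤ _ ubt) (t≤ _ ubs)

  isSupremum-resp : ∀ {S T s} → S ⊆ T → T ⊆ S → IsSupremum S s → IsSupremum T s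
  isSupremum-resp S⊆T T⊆S (ub , least) =
    (λ x x∈T → ub x (T⊆S x∈T)) , λ b ubT → least b λ x x∈S → ubT x (S⊆T x∈S)

  -- `sup` consults `em` separately for each predicate, so even equivalent predicates need an
  -- argument: the mixed cases are contradictory, and otherwise the suprema agree or both values are
  -- the default.
  sup-cong : ∀ {S T : Pred Carrier 0ℓ} → S ⊆ T → T ⊆ S → sup S ≈ sup T
  sup-cong {S} {T} S⊆T T⊆S with em {∃ (IsSupremum S)} | em {∃ (IsSupremum T)}
  ... | yes (s , p) | yes (t , q) = isSupremum-unique (isSupremum-resp {S} {T} S⊆T T⊆S p) q
  ... | yes (s , p) | no ¬t       = ⊥-elim (¬t (s , isSupremum-resp {S} {T} S⊆T T⊆S p))
  ... | no ¬s       | yes (t , q) = ⊥-elim (¬s (t , isSupremum-resp {T} {S} T⊆S S⊆T q))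
  ... | no _        | no _        = refl

  supremum-approximation : ∀ {S s ε} → IsSupremum S s → 0# < ε → ∃ λ y → y ∈ S × s ≤ y + ε
  supremum-approximation {S} {s} {ε} (ub , least) 0<ε with em {∃ λ y → y ∈ S × s ≤ y + ε}
  ... | yes p = p
  ... | no ¬p = ⊥-elim (<⇒≱ 0<ε (≤-by (x≤y⇒0≤y-x s≤s-ε)
                  (solve 2 (λ s ε → :0 := ε :+ ((s :- ε) :- s)) refl s ε)))
    where
    s≤s-ε : s ≤ s - ε
    s≤s-ε = least (s - ε) λ y y∈S → ≤-by-contradiction λ s-ε<y →
      ⊥-elim (¬p (y , y∈S , ≤-by (x≤y⇒0≤y-x (proj₁ s-ε<y))
        (solve 3 (λ s ε y → y :+ ε := s :+ (y :- (s :- ε))) refl s ε y)))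

  -- The restriction ε ≤ 1 keeps perturbed points inside a fixed interval on which a Lipschitz
  -- constant is available.
  ≤-by-small-approximation : ∀ {x y} K → 0# ≤ K →
    (∀ ε → 0# < ε → ε ≤ 1# → x ≤ y + K * ε) → x ≤ y
  ≤-by-small-approximation K 0≤K approx = ≤-by-approximation K 0≤K λ ε 0<ε →
    let δ , 0<δ , δ≤ε , δ≤1 = minimum 0<ε 0<1
    in ≤-trans (approx δ 0<δ δ≤1) (+-mono-≤ ≤-refl (*-monoˡ-≤ K 0≤K δ≤ε))

  -- Roots

  -- The constants satisfy C(n + 1) = B^n + B C(n), the product rule for x · x^n on [0, B].
  ^-lipschitz : ∀ B n → 0# ≤ B → ∃ λ C → 0# ≤ C × (∀ x δ → 0# ≤ x → 0# ≤ δ → x + δ ≤ B →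
    (x + δ) ^ n ≤ x ^ n + C * δ)
  ^-lipschitz B zero 0≤B = 0# , ≤-refl , λ x δ _ _ _ →
    ≤-reflexive (solve 1 (λ δ → :1 := :1 :+ :0 :* δ) refl δ)
  ^-lipschitz B (suc n) 0≤B = B ^ n + B * C , 0≤^ n 0≤B ⊕ 0≤B ⊗ 0≤C , λ x δ 0≤x 0≤δ x+δ≤B →
    let open ≤-Reasoning
        xⁿ≤Bⁿ = ^-monoˡ-≤ n 0≤x (≤-trans (≤-by 0≤δ refl) x+δ≤B)
    in begin
      (x + δ) * (x + δ) ^ n
        ≤⟨ *-monoˡ-≤ (x + δ) (0≤x ⊕ 0≤δ) (IH x δ 0≤x 0≤δ x+δ≤B) ⟩
      (x + δ) * (x ^ n + C * δ)
        ≤⟨ ≤-by (x≤y⇒0≤y-x xⁿ≤Bⁿ ⊗ 0≤δ ⊕ x≤y⇒0≤y-x x+δ≤B ⊗ (0≤C ⊗ 0≤δ))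
             (solve 6 (λ x δ X Bⁿ B C →
               x :* X :+ (Bⁿ :+ B :* C) :* δ
               := (x :+ δ) :* (X :+ C :* δ)
                  :+ ((Bⁿ :- X) :* δ :+ (B :- (x :+ δ)) :* (C :* δ)))
               refl x δ (x ^ n) (B ^ n) B C) ⟩
      x * x ^ n + (B ^ n + B * C) * δ ∎
    where
    C   = proj₁ (^-lipschitz B n 0≤B)
    0≤C = proj₁ (proj₂ (^-lipschitz B n 0≤B))
    IH  = proj₂ (proj₂ (^-lipschitz B n 0≤B))

  -- The root u is the supremum of the y ≥ 0 with y^n ≤ w. Members close to u give u^n ≤ w; the
  -- nonmembers u + ε give w ≤ u^n. Both limits use the Lipschitz bound on [0, u + 1].
  root : ∀ w n → 0# ≤ w → 1 ℕ.≤ n → ∃ λ u → 0# ≤ u × u ^ n ≈ w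
  root w n 0≤w 1≤n = u , 0≤u , ≤-antisym uⁿ≤w w≤uⁿ
    where
    Below : Pred Carrier 0ℓ
    Below y = 0# ≤ y × y ^ n ≤ w
    0≤1+w = 0≤1 ⊕ 0≤w
    0ⁿ≤w : ∀ {n} → 1 ℕ.≤ n → 0# ^ n ≤ w
    0ⁿ≤w (s≤s _) = ≤-trans (≤-reflexive (zeroˡ _)) 0≤w
    bound : IsUpperBound Below (1# + w)
    bound y (0≤y , yⁿ≤w) = ^-cancelˡ-≤ n 0≤y 0≤1+w 1≤n (begin
      y ^ n         ≤⟨ yⁿ≤w ⟩
      w             ≤⟨ ≤-by 0≤1 (+-comm 1# w) ⟩
      1# + w        ≈⟨ *-identityʳ _ ⟨
      (1# + w) ^ 1  ≤⟨ ^-monoʳ-≤ (≤-by 0≤w refl) 1≤n ⟩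
      (1# + w) ^ n  ∎)
      where open ≤-Reasoning
    supremum = complete Below (0# , ≤-refl , 0ⁿ≤w 1≤n) (1# + w , bound)
    u   = proj₁ supremum
    ub  = proj₁ (proj₂ supremum)
    0≤u = ub 0# (≤-refl , 0ⁿ≤w 1≤n)
    lipschitz = ^-lipschitz (u + 1#) n (0≤u ⊕ 0≤1)
    C   = proj₁ lipschitz
    0≤C = proj₁ (proj₂ lipschitz)
    uⁿ≤w : u ^ n ≤ w
    uⁿ≤w = ≤-by-small-approximation C 0≤C λ ε 0<ε ε≤1 →
      let y , (0≤y , yⁿ≤w) , u≤y+ε = supremum-approximation (proj₂ supremum) 0<ε
          open ≤-Reasoning
      in begin
        u ^ n          ≤⟨ ^-monoˡ-≤ n 0≤u u≤y+ε ⟩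
        (y + ε) ^ n    ≤⟨ proj₂ (proj₂ lipschitz) y ε 0≤y (proj₁ 0<ε) (+-mono-≤ (ub y (0≤y , yⁿ≤w)) ε≤1) ⟩
        y ^ n + C * ε  ≤⟨ +-monoˡ-≤ (C * ε) yⁿ≤w ⟩
        w + C * ε      ∎
    w≤uⁿ : w ≤ u ^ n
    w≤uⁿ = ≤-by-small-approximation C 0≤C λ ε 0<ε ε≤1 →
      let 0≤ε = proj₁ 0<ε
          w≤ : w ≤ (u + ε) ^ n
          w≤ = ≤-by-contradiction λ <w → ⊥-elim (<⇒≱ 0<ε
            (≤-by (x≤y⇒0≤y-x (ub (u + ε) (0≤u ⊕ 0≤ε , proj₁ <w)))
              (solve 2 (λ u ε → :0 := ε :+ (u :- (u :+ ε))) refl u ε)))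
      in ≤-trans w≤ (proj₂ (proj₂ lipschitz) u ε 0≤u 0≤ε (+-mono-≤ ≤-refl ε≤1))

  -- Rational approximations of real powers

  -- Expresses x^(a/b) ≤ x^p through the position of a/b relative to p, which depends on the side of
  -- 1 on which x lies. It repackages the side condition in the definition of `_^ᴿ_`, so that its
  -- cases can be matched against those of `Above`.
  data Below (x p : Carrier) (a b : ℕ) : Set where
    large : 1# ≤ x → fromℕ a ≤ fromℕ b * p → Below x p a b
    small : x ≤ 1# → fromℕ b * p ≤ fromℕ a → Below x p a b

  data Above (x p : Carrier) (a b : ℕ) : Set where
    large : 1# ≤ x → fromℕ b * p ≤ fromℕ a → Above x p a b
    small : x ≤ 1# → fromℕ a ≤ fromℕ b * p → Above x p a b

  cross-≤ : ∀ {p a b a′ b′} → fromℕ a′ ≤ fromℕ b′ * p → fromℕ b * p ≤ fromℕ a →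
            a′ ℕ.* b ℕ.≤ a ℕ.* b′
  cross-≤ {p} {a} {b} {a′} {b′} a′≤b′p bp≤a = fromℕ-cancel-≤ (begin
    fromℕ (a′ ℕ.* b)          ≈⟨ fromℕ-* a′ b ⟩
    fromℕ a′ * fromℕ b        ≤⟨ *-monoʳ-≤ (fromℕ b) (0≤fromℕ b) a′≤b′p ⟩
    fromℕ b′ * p * fromℕ b    ≈⟨ solve 3 (λ b′ p b → b′ :* p :* b := b :* p :* b′) refl (fromℕ b′) p (fromℕ b) ⟩
    fromℕ b * p * fromℕ b′    ≤⟨ *-monoʳ-≤ (fromℕ b′) (0≤fromℕ b′) bp≤a ⟩
    fromℕ a * fromℕ b′        ≈⟨ fromℕ-* a b′ ⟨
    fromℕ (a ℕ.* b′)          ∎)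
    where open ≤-Reasoning

  -- Since p separates the two fractions, cross multiplication orders the exponents. In the mixed
  -- cases x is both at most and at least 1, and the two powers are compared through 1.
  Below-Above : ∀ {x p a b a′ b′} → 0# ≤ x → Below x p a′ b′ → Above x p a b →
                x ^ (a′ ℕ.* b) ≤ x ^ (a ℕ.* b′)
  Below-Above {a = a} {b} {a′} {b′} 0≤x (large 1≤x p) (large _ q) =
    ^-monoʳ-≤ 1≤x (cross-≤ {a = a} {b} {a′} {b′} p q)
  Below-Above {a = a} {b} {a′} {b′} 0≤x (small x≤1 p) (small _ q) =
    ^-antiʳ-≤ 0≤x x≤1 (cross-≤ {a = a′} {b′} {a} {b} q p)
  Below-Above {a = a} {b} {a′} {b′} 0≤x (large 1≤x _) (small x≤1 _) =
    ≤-trans (^≤1 (a′ ℕ.* b) 0≤x x≤1) (1≤^ (a ℕ.* b′) 1≤x)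
  Below-Above {a = a} {b} {a′} {b′} 0≤x (small x≤1 _) (large 1≤x _) =
    ≤-trans (^≤1 (a′ ℕ.* b) 0≤x x≤1) (1≤^ (a ℕ.* b′) 1≤x)

  RationalPowersBelow : Carrier → Carrier → Pred Carrier 0ℓ
  RationalPowersBelow x p y =
    0# ≤ y × ∃ λ (a : ℕ) → ∃ λ (b : ℕ) → 1 ℕ.≤ b × y ^ b ≤ x ^ a ×
      ((1# ≤ x × fromℕ a ≤ fromℕ b * p) ⊎ (x ≤ 1# × fromℕ b * p ≤ fromℕ a))

  rational-≤ : ∀ {x p y a b} → 0# ≤ x → RationalPowersBelow x p y → 1 ℕ.≤ b → Above x p a b →
               y ^ b ≤ x ^ a
  rational-≤ {x} {p} {y} {a} {b} 0≤x (0≤y , a′ , b′ , 1≤b′ , yᵇ≤xᵃ , c) 1≤b above =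
    ^-cancelˡ-≤ b′ (0≤^ b 0≤y) (0≤^ a 0≤x) 1≤b′ (begin
      (y ^ b) ^ b′     ≈⟨ ^-assocʳ y b b′ ⟩
      y ^ (b ℕ.* b′)   ≡⟨ ≡.cong (y ^_) (ℕ.*-comm b b′) ⟩
      y ^ (b′ ℕ.* b)   ≈⟨ ^-assocʳ y b′ b ⟨
      (y ^ b′) ^ b     ≤⟨ ^-monoˡ-≤ b (0≤^ b′ 0≤y) yᵇ≤xᵃ ⟩
      (x ^ a′) ^ b     ≈⟨ ^-assocʳ x a′ b ⟩
      x ^ (a′ ℕ.* b)   ≤⟨ Below-Above 0≤x (below c) above ⟩
      x ^ (a ℕ.* b′)   ≈⟨ ^-assocʳ x a b′ ⟨
      (x ^ a) ^ b′     ∎)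
    where
    open ≤-Reasoning
    below : ((1# ≤ x × fromℕ a′ ≤ fromℕ b′ * p) ⊎ (x ≤ 1# × fromℕ b′ * p ≤ fromℕ a′)) →
            Below x p a′ b′
    below (inj₁ (q , r)) = large q r
    below (inj₂ (q , r)) = small q r

  0∈RationalPowersBelow : ∀ {x p} → 0# ≤ x → 0# ≤ p → RationalPowersBelow x p 0#
  0∈RationalPowersBelow {x} {p} 0≤x 0≤p = ≤-refl , belowOne (≤-total 1# x)
    where
    belowOne : (1# ≤ x) ⊎ (x ≤ 1#) → _
    belowOne (inj₁ 1≤x) = 0 , 1 , s≤s z≤n , ≤-trans (≤-reflexive (zeroˡ _)) 0≤1 ,
      inj₁ (1≤x , 0≤fromℕ 1 ⊗ 0≤p)
    belowOne (inj₂ x≤1) = let a , p≤a = archimedean p in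
      a , 1 , s≤s z≤n , ≤-trans (≤-reflexive (zeroˡ _)) (0≤^ a 0≤x) ,
      inj₂ (x≤1 , ≤-trans (≤-reflexive (solve 1 (λ p → (:1 :+ :0) :* p := p) refl p)) p≤a)

  above-exists : ∀ x p → 0# ≤ p → ∃ λ a → Above x p a 1
  above-exists x p 0≤p with ≤-total 1# x
  ... | inj₁ 1≤x = let a , p≤a = archimedean p in a ,
      large 1≤x (≤-trans (≤-reflexive (solve 1 (λ p → (:1 :+ :0) :* p := p) refl p)) p≤a)
  ... | inj₂ x≤1 = 0 , small x≤1 (0≤fromℕ 1 ⊗ 0≤p)

  ^ᴿ-isSupremum : ∀ {x p} → 0# ≤ x → 0# ≤ p → IsSupremum (RationalPowersBelow x p) (x ^ᴿ p)
  ^ᴿ-isSupremum {x} {p} 0≤x 0≤p = sup-isSupremum (complete _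
    (0# , 0∈RationalPowersBelow 0≤x 0≤p)
    (let a , above = above-exists x p 0≤p in x ^ a , λ y y∈ →
      ≤-trans (≤-reflexive (sym (*-identityʳ y))) (rational-≤ {a = a} 0≤x y∈ (s≤s z≤n) above)))

  0≤^ᴿ : ∀ {x p} → 0# ≤ x → 0# ≤ p → 0# ≤ x ^ᴿ p
  0≤^ᴿ 0≤x 0≤p = proj₁ (^ᴿ-isSupremum 0≤x 0≤p) 0# (0∈RationalPowersBelow 0≤x 0≤p)

  -- The b-th root of x^a is itself a member of the set whose supremum is x^p.
  ^≤^ᴿ : ∀ {x p a b} → 0# ≤ x → 0# ≤ p → 1 ℕ.≤ b → Below x p a b → x ^ a ≤ (x ^ᴿ p) ^ b
  ^≤^ᴿ {x} {p} {a} {b} 0≤x 0≤p 1≤b below =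
    let u , 0≤u , uᵇ≈xᵃ = root (x ^ a) b (0≤^ a 0≤x) 1≤b
        u≤ = proj₁ (^ᴿ-isSupremum 0≤x 0≤p) u
               (0≤u , a , b , 1≤b , ≤-reflexive uᵇ≈xᵃ , condition below)
    in ≤-trans (≤-reflexive (sym uᵇ≈xᵃ)) (^-monoˡ-≤ b 0≤u u≤)
    where
    condition : Below x p a b → _
    condition (large q r) = inj₁ (q , r)
    condition (small q r) = inj₂ (q , r)

  -- Dually, the b-th root of x^a is an upper bound of that set, by `rational-≤`.
  ^ᴿ≤^ : ∀ {x p a b} → 0# ≤ x → 0# ≤ p → 1 ℕ.≤ b → Above x p a b → (x ^ᴿ p) ^ b ≤ x ^ a
  ^ᴿ≤^ {x} {p} {a} {b} 0≤x 0≤p 1≤b above =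
    let u , 0≤u , uᵇ≈xᵃ = root (x ^ a) b (0≤^ a 0≤x) 1≤b
        ≤u = proj₂ (^ᴿ-isSupremum 0≤x 0≤p) u λ y y∈ → ^-cancelˡ-≤ b (proj₁ y∈) 0≤u 1≤b
               (≤-trans (rational-≤ 0≤x y∈ 1≤b above) (≤-reflexive (sym uᵇ≈xᵃ)))
    in ≤-trans (^-monoˡ-≤ b (0≤^ᴿ 0≤x 0≤p) ≤u) (≤-reflexive uᵇ≈xᵃ)

  ^ᴿ-congˡ : ∀ {x y} p → x ≈ y → x ^ᴿ p ≈ y ^ᴿ p
  ^ᴿ-congˡ p x≈y = sup-cong (transport x≈y) (transport (sym x≈y))
    where
    transport : ∀ {x y z} → x ≈ y → RationalPowersBelow x p z → RationalPowersBelow y p z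
    transport {x} {y} x≈y (0≤z , a , b , 1≤b , zᵇ≤xᵃ , c) =
      0≤z , a , b , 1≤b , ≤-trans zᵇ≤xᵃ (≤-reflexive (^-congˡ a x≈y)) , side c
      where
      side : _ → _
      side (inj₁ (1≤x , r)) = inj₁ (≤-trans 1≤x (≤-reflexive x≈y) , r)
      side (inj₂ (x≤1 , r)) = inj₂ (≤-trans (≤-reflexive (sym x≈y)) x≤1 , r)

  -- A bound on all natural powers up to a constant factor determines an
  -- inequality; hence x ^ᴿ p is determined by comparing its b-th power
  -- with x ^ ⌊ b p ⌋ up to a constant.
  ^-ratio-bounded⇒≤ : ∀ {x y C} → 0# < y → (∀ n → 1 ℕ.≤ n → x ^ n ≤ C * y ^ n) → x ≤ y
  ^-ratio-bounded⇒≤ {x} {y} {C} 0<y bounded = *-cancelʳ-≤ (y ⁻¹) (0<⁻¹ 0<y) (begin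
    x * y ⁻¹   ≤⟨ ^-bounded⇒≤1 {C = bound} powers ⟩
    1#         ≈⟨ ⁻¹-inverseʳ y (>⇒≉0 0<y) ⟨
    y * y ⁻¹   ∎)
    where
    open ≤-Reasoning
    bound = proj₁ (maximum C 1#)
    powers : ∀ n → (x * y ⁻¹) ^ n ≤ bound
    powers zero = proj₂ (proj₂ (maximum C 1#))
    powers n@(suc _) = *-cancelʳ-≤ (y ^ n) (0<^ n 0<y) (begin
      (x * y ⁻¹) ^ n * y ^ n  ≈⟨ ^-distrib-* (x * y ⁻¹) y n ⟨
      (x * y ⁻¹ * y) ^ n      ≈⟨ ^-congˡ n (trans (*-assoc _ _ _) (trans (*-congˡ (⁻¹-inverseˡ y (>⇒≉0 0<y))) (*-identityʳ x))) ⟩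
      x ^ n                   ≤⟨ bounded n (s≤s z≤n) ⟩
      C * y ^ n               ≤⟨ *-monoʳ-≤ (y ^ n) (proj₁ (0<^ n 0<y)) (proj₁ (proj₂ (maximum C 1#))) ⟩
      bound * y ^ n           ∎)

  -- With a = ⌊b p⌋, the powers z^b and x^a agree up to a factor K independent of b. A positive z is
  -- determined by this (`coarsePower-≤`), and the property is visibly multiplicative, so (x y)^p =
  -- x^p y^p follows without computing with suprema.
  CoarsePower : Carrier → Carrier → Carrier → Set
  CoarsePower x p z = ∃ λ K → 0# ≤ K × (∀ a b → 1 ℕ.≤ b →
    fromℕ a ≤ fromℕ b * p → fromℕ b * p ≤ fromℕ (suc a) →
    z ^ b ≤ K * x ^ a × x ^ a ≤ K * z ^ b)

  ^ᴿ-coarsePower : ∀ {x p} → 0# < x → 0# ≤ p → CoarsePower x p (x ^ᴿ p)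
  ^ᴿ-coarsePower {x} {p} 0<x@(0≤x , _) 0≤p with ≤-total 1# x
  -- For x ≥ 1 the constant is x, the gap between x^a and x^(a+1); for x ≤ 1 the same gap makes it
  -- 1/x.
  ... | inj₁ 1≤x = x , 0≤x , λ a b 1≤b a≤bp bp≤1+a →
        ^ᴿ≤^ {a = suc a} 0≤x 0≤p 1≤b (large 1≤x bp≤1+a) ,
        ≤-trans (^≤^ᴿ {a = a} 0≤x 0≤p 1≤b (large 1≤x a≤bp))
          (≤-by (x≤y⇒0≤y-x 1≤x ⊗ 0≤^ b (0≤^ᴿ 0≤x 0≤p))
            (solve 2 (λ x z → x :* z := z :+ (x :- :1) :* z) refl x ((x ^ᴿ p) ^ b)))
  ... | inj₂ x≤1 = x ⁻¹ , 0≤⁻¹ 0<x , λ a b 1≤b a≤bp bp≤1+a →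
        ≤-trans (^ᴿ≤^ {a = a} 0≤x 0≤p 1≤b (small x≤1 a≤bp))
          (≤-by (x≤y⇒0≤y-x 1≤x⁻¹ ⊗ 0≤^ a 0≤x)
            (solve 2 (λ i X → i :* X := X :+ (i :- :1) :* X) refl (x ⁻¹) (x ^ a))) ,
        ≤-trans (≤-reflexive (trans (sym (*-identityˡ _)) (trans (*-congʳ (sym (⁻¹-inverseˡ x (>⇒≉0 0<x)))) (*-assoc _ _ _))))
          (*-monoˡ-≤ (x ⁻¹) (0≤⁻¹ 0<x) (^≤^ᴿ {a = suc a} 0≤x 0≤p 1≤b (small x≤1 bp≤1+a)))
    where
    1≤x⁻¹ : 1# ≤ x ⁻¹
    1≤x⁻¹ = *-cancelʳ-≤ x 0<x (≤-trans (≤-reflexive (*-identityˡ x))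
              (≤-trans x≤1 (≤-reflexive (sym (⁻¹-inverseˡ x (>⇒≉0 0<x))))))

  coarsePower-≤ : ∀ {x p z w} → 0# ≤ p → 0# < w →
                  CoarsePower x p z → CoarsePower x p w → z ≤ w
  coarsePower-≤ {x} {p} {z} {w} 0≤p 0<w (K , 0≤K , zx) (L , 0≤L , wx) =
    ^-ratio-bounded⇒≤ {C = K * L} 0<w λ b 1≤b →
      let a , a≤bp , bp≤1+a = floor (fromℕ b * p) (0≤fromℕ b ⊗ 0≤p)
          open ≤-Reasoning
      in begin
        z ^ b            ≤⟨ proj₁ (zx a b 1≤b a≤bp bp≤1+a) ⟩
        K * x ^ a        ≤⟨ *-monoˡ-≤ K 0≤K (proj₂ (wx a b 1≤b a≤bp bp≤1+a)) ⟩
        K * (L * w ^ b)  ≈⟨ *-assoc K L (w ^ b) ⟨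
        K * L * w ^ b    ∎

  -- The exponent b = 1 already gives x^a ≤ K z with x^a > 0.
  coarsePower-positive : ∀ {x p z} → 0# < x → 0# ≤ p → 0# ≤ z → CoarsePower x p z → 0# < z
  coarsePower-positive {x} {p} {z} 0<x 0≤p 0≤z (K , 0≤K , zx) with ≤⇒≈⊎< 0≤z
  ... | inj₂ 0<z = 0<z
  ... | inj₁ 0≈z = ⊥-elim (<⇒≱ (0<^ a 0<x) (begin
      x ^ a        ≤⟨ proj₂ (zx a 1 (s≤s z≤n) (proj₁ (proj₂ aa)) (proj₂ (proj₂ aa))) ⟩
      K * z ^ 1    ≈⟨ *-congˡ (*-congʳ 0≈z) ⟨
      K * 0# ^ 1   ≈⟨ solve 1 (λ K → K :* (:0 :* :1) := :0) refl K ⟩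
      0#           ∎))
    where
    open ≤-Reasoning
    aa = floor (fromℕ 1 * p) (0≤fromℕ 1 ⊗ 0≤p)
    a = proj₁ aa

  0<^ᴿ : ∀ {x p} → 0# < x → 0# ≤ p → 0# < x ^ᴿ p
  0<^ᴿ 0<x 0≤p = coarsePower-positive 0<x 0≤p (0≤^ᴿ (proj₁ 0<x) 0≤p) (^ᴿ-coarsePower 0<x 0≤p)

  coarsePower-* : ∀ {x y p z w} → 0# ≤ x → 0# ≤ y → 0# ≤ z → 0# ≤ w →
                  CoarsePower x p z → CoarsePower y p w → CoarsePower (x * y) p (z * w)
  coarsePower-* {x} {y} {p} {z} {w} 0≤x 0≤y 0≤z 0≤w (K , 0≤K , zx) (L , 0≤L , wy) =
    K * L , 0≤K ⊗ 0≤L , λ a b 1≤b l u →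
      let zx₁ , zx₂ = zx a b 1≤b l u
          wy₁ , wy₂ = wy a b 1≤b l u
      in combine {z} {w} {x} {y} b a (0≤^ b 0≤z) (0≤^ b 0≤w) zx₁ wy₁ ,
         combine {x} {y} {z} {w} a b (0≤^ a 0≤x) (0≤^ a 0≤y) zx₂ wy₂
    where
    open ≤-Reasoning
    combine : ∀ {s t u v} m n → 0# ≤ s ^ m → 0# ≤ t ^ m → s ^ m ≤ K * u ^ n → t ^ m ≤ L * v ^ n →
              (s * t) ^ m ≤ K * L * (u * v) ^ n
    combine {s} {t} {u} {v} m n 0≤sm 0≤tm p q = begin
      (s * t) ^ m                ≈⟨ ^-distrib-* s t m ⟩
      s ^ m * t ^ m              ≤⟨ *-mono-≤ 0≤sm 0≤tm p q ⟩
      K * u ^ n * (L * v ^ n)    ≈⟨ solve 4 (λ K L U V → K :* U :* (L :* V) := K :* L :* (U :* V)) refl K L (u ^ n) (v ^ n) ⟩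
      K * L * (u ^ n * v ^ n)    ≈⟨ *-congˡ (^-distrib-* u v n) ⟨
      K * L * (u * v) ^ n        ∎

  ^ᴿ-distrib-*-positive : ∀ {x y p} → 0# < x → 0# < y → 0# ≤ p → (x * y) ^ᴿ p ≈ x ^ᴿ p * y ^ᴿ p
  ^ᴿ-distrib-*-positive {x} {y} {p} 0<x@(0≤x , _) 0<y@(0≤y , _) 0≤p = ≤-antisym
    (coarsePower-≤ 0≤p (0<* (0<^ᴿ 0<x 0≤p) (0<^ᴿ 0<y 0≤p)) left right)
    (coarsePower-≤ 0≤p (0<^ᴿ (0<* 0<x 0<y) 0≤p) right left)
    where
    left  = ^ᴿ-coarsePower (0<* 0<x 0<y) 0≤p
    right = coarsePower-* 0≤x 0≤y (0≤^ᴿ 0≤x 0≤p) (0≤^ᴿ 0≤y 0≤p)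
              (^ᴿ-coarsePower 0<x 0≤p) (^ᴿ-coarsePower 0<y 0≤p)

-- Powers with exponent p > 1: Bernoulli, growth and exponent laws

module PowersAboveOne (em : ExcludedMiddle 0ℓ) (ℝ : CompleteOrderedField)
  (p : CompleteOrderedField.Carrier ℝ)
  (1<p : CompleteOrderedField._<_ ℝ (CompleteOrderedField.1# ℝ) p) where
  open CompleteOrderedField ℝ hiding (zero)
  open Classical em ℝ
  open OrderedField em ℝ
  open RealPowers em ℝ

  1≤p : 1# ≤ p
  1≤p = proj₁ 1<p

  0≤p : 0# ≤ p
  0≤p = ≤-trans 0≤1 1≤p

  0<p : 0# < p
  0<p = <-≤-trans 0<1 1≤p

  private
    1*x≈x : ∀ x → fromℕ 1 * x ≈ x
    1*x≈x = solve 1 (λ x → (:1 :+ :0) :* x := x) refl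

    fromℕ1≤1*p : fromℕ 1 ≤ fromℕ 1 * p
    fromℕ1≤1*p = ≤-trans (≤-reflexive (+-identityʳ 1#)) (≤-trans 1≤p (≤-reflexive (sym (1*x≈x p))))

  ^ᴿ≤id : ∀ {x} → 0# ≤ x → x ≤ 1# → x ^ᴿ p ≤ x
  ^ᴿ≤id {x} 0≤x x≤1 = ≤-trans (≤-reflexive (sym (*-identityʳ _)))
    (≤-trans (^ᴿ≤^ {a = 1} {b = 1} 0≤x 0≤p (s≤s z≤n) (small x≤1 fromℕ1≤1*p))
             (≤-reflexive (*-identityʳ x)))

  0^ᴿ≈0 : ∀ {x} → x ≈ 0# → x ^ᴿ p ≈ 0#
  0^ᴿ≈0 {x} x≈0 = ≤-antisym
    (≤-trans (^ᴿ≤id 0≤x (≤-trans (≤-reflexive x≈0) 0≤1)) (≤-reflexive x≈0)) (0≤^ᴿ 0≤x 0≤p)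
    where 0≤x = ≤-reflexive (sym x≈0)

  1^ᴿ≈1 : 1# ^ᴿ p ≈ 1#
  1^ᴿ≈1 = ≤-antisym (^ᴿ≤id 0≤1 ≤-refl)
    (≤-trans (^≤^ᴿ {a = 0} {b = 1} 0≤1 0≤p (s≤s z≤n) (large ≤-refl (0≤fromℕ 1 ⊗ 0≤p)))
             (≤-reflexive (*-identityʳ _)))

  ^ᴿ-distrib-* : ∀ {x y} → 0# ≤ x → 0# ≤ y → (x * y) ^ᴿ p ≈ x ^ᴿ p * y ^ᴿ p
  ^ᴿ-distrib-* {x} {y} 0≤x 0≤y with ≤⇒≈⊎< 0≤x | ≤⇒≈⊎< 0≤y
  ... | inj₂ 0<x | inj₂ 0<y = ^ᴿ-distrib-*-positive 0<x 0<y 0≤p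
  ... | inj₁ 0≈x | _ = trans (0^ᴿ≈0 (trans (*-congʳ (sym 0≈x)) (zeroˡ y)))
        (sym (trans (*-congʳ (0^ᴿ≈0 (sym 0≈x))) (zeroˡ _)))
  ... | inj₂ _ | inj₁ 0≈y = trans (0^ᴿ≈0 (trans (*-congˡ (sym 0≈y)) (zeroʳ x)))
        (sym (trans (*-congˡ (0^ᴿ≈0 (sym 0≈y))) (zeroʳ _)))

  -- (s ^ n - 1) / n is nondecreasing in n.

  ^-tangent : ∀ {s} n → 0# ≤ s → s ^ suc n + fromℕ (suc n) * s ^ n ≤ 1# + fromℕ (suc n) * (s * s ^ n)
  ^-tangent {s} zero 0≤s = ≤-reflexive
    (solve 1 (λ s → s :* :1 :+ (:1 :+ :0) :* :1 := :1 :+ (:1 :+ :0) :* (s :* :1)) refl s)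
  ^-tangent {s} (suc n) 0≤s = ≤-by
    (0≤s ⊗ x≤y⇒0≤y-x (^-tangent n 0≤s) ⊕ same-sign)
    (solve 3 (λ s S n →
      :1 :+ (:1 :+ (:1 :+ n)) :* (s :* (s :* S)) :=
      (s :* (s :* S) :+ (:1 :+ (:1 :+ n)) :* (s :* S)) :+
      (s :* ((:1 :+ (:1 :+ n) :* (s :* S)) :- (s :* S :+ (:1 :+ n) :* S))
       :+ (s :- :1) :* (s :* S :- :1))) refl s (s ^ n) (fromℕ n))
    where
    same-sign : 0# ≤ (s - 1#) * (s * s ^ n - 1#)
    same-sign with ≤-total 1# s
    ... | inj₁ 1≤s = x≤y⇒0≤y-x 1≤s ⊗ x≤y⇒0≤y-x (1≤^ (suc n) 1≤s)
    ... | inj₂ s≤1 = ≤-trans (x≤y⇒0≤y-x s≤1 ⊗ x≤y⇒0≤y-x (^≤1 (suc n) 0≤s s≤1))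
        (≤-reflexive (solve 2 (λ s S → (:1 :- s) :* (:1 :- S) := (s :- :1) :* (S :- :1)) refl s (s ^ suc n)))

  -- With a = k + b this is (s^b - 1) / b ≤ (s^a - 1) / a, cleared of denominators. Each step of the
  -- induction on k adds the tangent inequality for s^b and a product of two factors of equal sign.
  ^-chord : ∀ {s} b k → 0# ≤ s → 1 ℕ.≤ b →
    fromℕ (k ℕ.+ b) * s ^ b + fromℕ b ≤ fromℕ b * s ^ (k ℕ.+ b) + fromℕ (k ℕ.+ b)
  ^-chord {s} b zero 0≤s 1≤b = ≤-refl
  ^-chord {s} b@(suc c) (suc k) 0≤s 1≤b = ≤-by
    (x≤y⇒0≤y-x (^-chord b k 0≤s 1≤b) ⊕ x≤y⇒0≤y-x (^-tangent c 0≤s) ⊕ 0≤fromℕ b ⊗ same-sign)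
    (solve 6 (λ b a s B A S →
      b :* (s :* A) :+ (:1 :+ a) :=
      ((:1 :+ a) :* B :+ b) :+
      (((b :* A :+ a) :- (a :* B :+ b)) :+ ((:1 :+ b :* (s :* S)) :- (B :+ b :* S))
       :+ b :* ((s :- :1) :* (A :- S))))
      refl (fromℕ b) (fromℕ (k ℕ.+ b)) s (s ^ b) (s ^ (k ℕ.+ b)) (s ^ c))
    where
    c≤k+b = ℕ.≤-trans (ℕ.n≤1+n c) (ℕ.m≤n+m b k)
    same-sign : 0# ≤ (s - 1#) * (s ^ (k ℕ.+ b) - s ^ c)
    same-sign with ≤-total 1# s
    ... | inj₁ 1≤s = x≤y⇒0≤y-x 1≤s ⊗ x≤y⇒0≤y-x (^-monoʳ-≤ 1≤s c≤k+b)
    ... | inj₂ s≤1 = ≤-trans (x≤y⇒0≤y-x s≤1 ⊗ x≤y⇒0≤y-x (^-antiʳ-≤ 0≤s s≤1 c≤k+b))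
        (≤-reflexive (solve 3 (λ s S T → (:1 :- s) :* (S :- T) := (s :- :1) :* (T :- S)) refl s (s ^ c) (s ^ (k ℕ.+ b))))

  -- Writing y = s^b turns y^(a/b), where a = k + b, into the integer power s^a ≤ y^p, and the chord
  -- inequality applies to s.
  ^ᴿ-rational-bernoulli : ∀ {y} b k → 0# ≤ y → 1 ℕ.≤ b → Below y p (k ℕ.+ b) b →
    fromℕ (k ℕ.+ b) * y + fromℕ b ≤ fromℕ b * y ^ᴿ p + fromℕ (k ℕ.+ b)
  ^ᴿ-rational-bernoulli {y} b k 0≤y 1≤b below = withRoot (root y b 0≤y 1≤b)
    where
    open ≤-Reasoning
    withRoot : (∃ λ s → 0# ≤ s × s ^ b ≈ y) → _
    withRoot (s , 0≤s , sᵇ≈y) = begin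
      fromℕ (k ℕ.+ b) * y + fromℕ b              ≈⟨ +-congʳ (*-congˡ (sym sᵇ≈y)) ⟩
      fromℕ (k ℕ.+ b) * s ^ b + fromℕ b          ≤⟨ ^-chord b k 0≤s 1≤b ⟩
      fromℕ b * s ^ (k ℕ.+ b) + fromℕ (k ℕ.+ b)  ≤⟨ +-mono-≤ (*-monoˡ-≤ (fromℕ b) (0≤fromℕ b) sᵃ≤yᵖ) ≤-refl ⟩
      fromℕ b * y ^ᴿ p + fromℕ (k ℕ.+ b)         ∎
      where
      sᵃ≤yᵖ : s ^ (k ℕ.+ b) ≤ y ^ᴿ p
      sᵃ≤yᵖ = ^-cancelˡ-≤ b (0≤^ (k ℕ.+ b) 0≤s) (0≤^ᴿ 0≤y 0≤p) 1≤b (begin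
        (s ^ (k ℕ.+ b)) ^ b    ≈⟨ ^-assocʳ s (k ℕ.+ b) b ⟩
        s ^ ((k ℕ.+ b) ℕ.* b)  ≡⟨ ≡.cong (s ^_) (ℕ.*-comm (k ℕ.+ b) b) ⟩
        s ^ (b ℕ.* (k ℕ.+ b))  ≈⟨ ^-assocʳ s b (k ℕ.+ b) ⟨
        (s ^ b) ^ (k ℕ.+ b)    ≈⟨ ^-congˡ (k ℕ.+ b) sᵇ≈y ⟩
        y ^ (k ℕ.+ b)          ≤⟨ ^≤^ᴿ 0≤y 0≤p 1≤b below ⟩
        (y ^ᴿ p) ^ b           ∎)

  -- The rational case with denominator n misses the claim by at most ∣y - 1∣ / n, so n times the
  -- defect is bounded. The numerator is n p rounded down for y ≥ 1 and up for y ≤ 1, as `Below`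
  -- requires.
  ^ᴿ-bernoulli : ∀ {y} → 0# ≤ y → 1# + p * (y - 1#) ≤ y ^ᴿ p
  ^ᴿ-bernoulli {y} 0≤y = ≤-by (0≤-x (fromℕ-scaled-bounded⇒≤0 {C = ∣ y - 1# ∣} scaled))
    (solve 2 (λ t z → z := t :+ :- (t :- z)) refl (1# + p * (y - 1#)) z)
    where
    z = y ^ᴿ p
    rational : ∀ a b → 1 ℕ.≤ b → b ℕ.≤ a → Below y p a b →
      fromℕ a * y + fromℕ b ≤ fromℕ b * z + fromℕ a
    rational a b 1≤b b≤a below = ≡.subst
      (λ a → Below y p a b → fromℕ a * y + fromℕ b ≤ fromℕ b * z + fromℕ a)
      (ℕ.m∸n+n≡m b≤a) (^ᴿ-rational-bernoulli b (a ℕ.∸ b) 0≤y 1≤b) below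
    n≤np : ∀ n → fromℕ n ≤ fromℕ n * p
    n≤np n = ≤-by (0≤fromℕ n ⊗ x≤y⇒0≤y-x 1≤p)
      (solve 2 (λ n p → n :* p := n :+ n :* (p :- :1)) refl (fromℕ n) p)
    scaled-large : ∀ n a → 1 ℕ.≤ n → 1# ≤ y → fromℕ a ≤ fromℕ n * p → fromℕ n * p ≤ fromℕ (suc a) →
      fromℕ n * (1# + p * (y - 1#) - z) ≤ y - 1#
    scaled-large n a 1≤n 1≤y a≤np np≤1+a = ≤-by
      (x≤y⇒0≤y-x (rational a n 1≤n n≤a (large 1≤y a≤np)) ⊕ x≤y⇒0≤y-x np≤1+a ⊗ x≤y⇒0≤y-x 1≤y)
      (solve 5 (λ n p y z a → y :- :1 :=
         n :* (:1 :+ p :* (y :- :1) :- z)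
         :+ (((n :* z :+ a) :- (a :* y :+ n)) :+ ((:1 :+ a) :- n :* p) :* (y :- :1)))
         refl (fromℕ n) p y z (fromℕ a))
      where
      -- The chord inequality needs n ≤ a although a rounds n p down. Strictness of 1 < p secures
      -- this: a < n would give n p ≤ a + 1 ≤ n.
      n≤a : n ℕ.≤ a
      n≤a = ℕ.≮⇒≥ λ a<n → <⇒≱ (0<* (0<fromℕ 1≤n) (x<y⇒0<y-x 1<p))
        (≤-by (x≤y⇒0≤y-x (≤-trans np≤1+a (fromℕ-mono-≤ a<n)))
          (solve 2 (λ n p → :0 := n :* (p :- :1) :+ (n :- n :* p)) refl (fromℕ n) p))
    scaled-small : ∀ n a → 1 ℕ.≤ n → y ≤ 1# → fromℕ a ≤ fromℕ n * p → fromℕ n * p ≤ fromℕ (suc a) →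
      fromℕ n * (1# + p * (y - 1#) - z) ≤ 1# - y
    scaled-small n a 1≤n y≤1 a≤np np≤1+a = ≤-by
      (x≤y⇒0≤y-x (rational (suc a) n 1≤n n≤1+a (small y≤1 np≤1+a)) ⊕ x≤y⇒0≤y-x a≤np ⊗ x≤y⇒0≤y-x y≤1)
      (solve 5 (λ n p y z a → :1 :- y :=
         n :* (:1 :+ p :* (y :- :1) :- z)
         :+ (((n :* z :+ (:1 :+ a)) :- ((:1 :+ a) :* y :+ n)) :+ (n :* p :- a) :* (:1 :- y)))
         refl (fromℕ n) p y z (fromℕ a))
      where
      n≤1+a : n ℕ.≤ suc a
      n≤1+a = fromℕ-cancel-≤ (≤-trans (n≤np n) np≤1+a)
    dispatch : ∀ n → 1 ℕ.≤ n → (∃ λ a → fromℕ a ≤ fromℕ n * p × fromℕ n * p ≤ fromℕ (suc a)) →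
      (1# ≤ y) ⊎ (y ≤ 1#) → fromℕ n * (1# + p * (y - 1#) - z) ≤ ∣ y - 1# ∣
    dispatch n 1≤n (a , l , u) (inj₁ 1≤y) = ≤-trans (scaled-large n a 1≤n 1≤y l u) (x≤∣x∣ _)
    dispatch n 1≤n (a , l , u) (inj₂ y≤1) = ≤-trans (scaled-small n a 1≤n y≤1 l u)
      (≤-trans (≤-reflexive (solve 1 (λ y → :1 :- y := :- (y :- :1)) refl y)) (-x≤∣x∣ _))
    scaled : ∀ n → fromℕ n * (1# + p * (y - 1#) - z) ≤ ∣ y - 1# ∣
    scaled zero      = ≤-trans (≤-reflexive (zeroˡ _)) (0≤∣x∣ _)
    scaled n@(suc _) = dispatch n (s≤s z≤n) (floor (fromℕ n * p) (0≤fromℕ n ⊗ 0≤p)) (≤-total 1# y)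

  id≤^ᴿ : ∀ {x} → 1# ≤ x → x ≤ x ^ᴿ p
  id≤^ᴿ {x} 1≤x = ≤-trans (≤-by (x≤y⇒0≤y-x 1≤p ⊗ x≤y⇒0≤y-x 1≤x)
    (solve 2 (λ p x → :1 :+ p :* (x :- :1) := x :+ (p :- :1) :* (x :- :1)) refl p x))
    (^ᴿ-bernoulli (≤-trans 0≤1 1≤x))

  ^ᴿ≤1⇒≤1 : ∀ {x} → 0# ≤ x → x ^ᴿ p ≤ 1# → x ≤ 1#
  ^ᴿ≤1⇒≤1 {x} 0≤x xᵖ≤1 = *-cancelˡ-≤ p 0<p (≤-by (x≤y⇒0≤y-x (≤-trans (^ᴿ-bernoulli 0≤x) xᵖ≤1))
    (solve 2 (λ p x → p :* :1 := p :* x :+ (:1 :- (:1 :+ p :* (x :- :1)))) refl p x))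

  -- With t = c / x, Bernoulli gives c^p = x^p t^p ≥ x^p (1 + p (t - 1)), hence x^p - c^p ≤ p x^p (1
  -- - t). For t ≤ 1 this is at most p (x - c) ≤ p ε, because x^p ≤ x on [0, 1].
  ^ᴿ-lipschitz : ∀ {x c ε} → 0# ≤ x → x ≤ 1# → 0# ≤ c → 0# ≤ ε → x ≤ c + ε → x ^ᴿ p ≤ c ^ᴿ p + p * ε
  ^ᴿ-lipschitz {x} {c} {ε} 0≤x x≤1 0≤c 0≤ε x≤c+ε with ≤⇒≈⊎< 0≤x
  ... | inj₁ 0≈x = ≤-trans (≤-reflexive (0^ᴿ≈0 (sym 0≈x))) (0≤^ᴿ 0≤c 0≤p ⊕ 0≤p ⊗ 0≤ε)
  ... | inj₂ 0<x = ≤-by (0≤X ⊗ x≤y⇒0≤y-x (^ᴿ-bernoulli 0≤t) ⊕ 0≤p ⊗ x≤y⇒0≤y-x X[1-t]≤ε)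
      (trans (+-congʳ cᵖ≈XT) (solve 5 (λ X T p t ε → X :* T :+ p :* ε :=
        X :+ (X :* (T :- (:1 :+ p :* (t :- :1))) :+ p :* (ε :- X :* (:1 :- t))))
        refl X (t ^ᴿ p) p t ε))
    where
    t   = c * x ⁻¹
    0≤t = 0≤c ⊗ 0≤⁻¹ 0<x
    X   = x ^ᴿ p
    0≤X = 0≤^ᴿ 0≤x 0≤p
    xt≈c : x * t ≈ c
    xt≈c = trans (solve 3 (λ x c i → x :* (c :* i) := c :* (x :* i)) refl x c (x ⁻¹))
             (trans (*-congˡ (⁻¹-inverseʳ x (>⇒≉0 0<x))) (*-identityʳ c))
    cᵖ≈XT : c ^ᴿ p ≈ X * t ^ᴿ p
    cᵖ≈XT = trans (^ᴿ-congˡ p (sym xt≈c)) (^ᴿ-distrib-* 0≤x 0≤t)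
    X[1-t]≤ε : X * (1# - t) ≤ ε
    X[1-t]≤ε with ≤-total t 1#
    ... | inj₁ t≤1 = ≤-by (x≤y⇒0≤y-x (^ᴿ≤id 0≤x x≤1) ⊗ x≤y⇒0≤y-x t≤1 ⊕ x≤y⇒0≤y-x x≤c+ε)
          (begin
            ε                                              ≈⟨ solve 5 (λ X x t ε c → ε := X :* (:1 :- t) :+ ((x :- X) :* (:1 :- t) :+ ((x :* t :+ ε) :- x))) refl X x t ε c ⟩
            X * (1# - t) + ((x - X) * (1# - t) + ((x * t + ε) - x)) ≈⟨ +-congˡ (+-congˡ (+-congʳ (+-congʳ xt≈c))) ⟩
            X * (1# - t) + ((x - X) * (1# - t) + ((c + ε) - x)) ∎)
      where open ≈-Reasoning
    ... | inj₂ 1≤t = ≤-by (0≤X ⊗ x≤y⇒0≤y-x 1≤t ⊕ 0≤ε)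
          (solve 3 (λ X t ε → ε := X :* (:1 :- t) :+ (X :* (t :- :1) :+ ε)) refl X t ε)

  ^ᴿ-^ : ∀ {x} n → 0# ≤ x → (x ^ n) ^ᴿ p ≈ (x ^ᴿ p) ^ n
  ^ᴿ-^ zero 0≤x = 1^ᴿ≈1
  ^ᴿ-^ {x} (suc n) 0≤x = trans (^ᴿ-distrib-* 0≤x (0≤^ n 0≤x)) (*-congˡ (^ᴿ-^ n 0≤x))

  -- The threshold is a power of 2, where 2 ^ᴿ p ≥ 1 + p = 2 (1 + (p - 1) / 2).
  ^ᴿ-superlinear : ∀ {η} → 0# < η → ∃ λ M → 0# < M × (∀ y → M ≤ y → y ≤ η * y ^ᴿ p)
  ^ᴿ-superlinear {η} 0<η = two ^ k , 0<M , bound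
    where
    open ≤-Reasoning
    u   = (p - 1#) * half
    0<u = 0<* (x<y⇒0<y-x 1<p) 0<half
    -- From k ≥ 1 / (u η) follows η (1 + u)^k ≥ η (1 + k u) ≥ 1, so (2^k)^p ≥ 2^k (1 + u)^k is at
    -- least 2^k / η.
    large-k = archimedean ((u * η) ⁻¹)
    k   = proj₁ large-k
    M   = two ^ k
    0<M = 0<^ k 0<two
    1≤η[1+ku] : 1# ≤ η * (1# + fromℕ k * u)
    1≤η[1+ku] = begin
      1#                        ≈⟨ ⁻¹-inverseˡ (u * η) (>⇒≉0 (0<* 0<u 0<η)) ⟨
      (u * η) ⁻¹ * (u * η)      ≤⟨ *-monoʳ-≤ (u * η) (proj₁ (0<* 0<u 0<η)) (proj₂ large-k) ⟩
      fromℕ k * (u * η)         ≤⟨ ≤-by (proj₁ 0<η) (solve 3 (λ k u η → η :* (:1 :+ k :* u) := k :* (u :* η) :+ η) refl (fromℕ k) u η) ⟩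
      η * (1# + fromℕ k * u)    ∎
    2[1+u]≤2ᵖ : two * (1# + u) ≤ two ^ᴿ p
    2[1+u]≤2ᵖ = begin
      two * (1# + u)              ≈⟨ solve 2 (λ p h → :2 :* (:1 :+ (p :- :1) :* h) := :2 :+ (p :- :1) :* (h :+ h)) refl p half ⟩
      two + (p - 1#) * (half + half) ≈⟨ +-congˡ (*-congˡ half+half≈1) ⟩
      two + (p - 1#) * 1#         ≈⟨ solve 1 (λ p → :2 :+ (p :- :1) :* :1 := :1 :+ p :* (:2 :- :1)) refl p ⟩
      1# + p * (two - 1#)         ≤⟨ ^ᴿ-bernoulli (proj₁ 0<two) ⟩
      two ^ᴿ p                    ∎
    M≤ηMᵖ : M ≤ η * M ^ᴿ p
    M≤ηMᵖ = begin
      M                                 ≈⟨ *-identityʳ M ⟨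
      M * 1#                            ≤⟨ *-monoˡ-≤ M (proj₁ 0<M) 1≤η[1+ku] ⟩
      M * (η * (1# + fromℕ k * u))      ≤⟨ *-monoˡ-≤ M (proj₁ 0<M) (*-monoˡ-≤ η (proj₁ 0<η) (^-bernoulli k (proj₁ 0<u))) ⟩
      M * (η * (1# + u) ^ k)            ≈⟨ solve 3 (λ M η U → M :* (η :* U) := η :* (M :* U)) refl M η _ ⟩
      η * (two ^ k * (1# + u) ^ k)      ≈⟨ *-congˡ (^-distrib-* two (1# + u) k) ⟨
      η * (two * (1# + u)) ^ k          ≤⟨ *-monoˡ-≤ η (proj₁ 0<η) (^-monoˡ-≤ k (proj₁ 0<two ⊗ (0≤1 ⊕ proj₁ 0<u)) 2[1+u]≤2ᵖ) ⟩
      η * (two ^ᴿ p) ^ k                ≈⟨ *-congˡ (^ᴿ-^ k (proj₁ 0<two)) ⟨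
      η * M ^ᴿ p                        ∎
    bound : ∀ y → M ≤ y → y ≤ η * y ^ᴿ p
    bound y M≤y = begin
      y                     ≈⟨ Mt≈y ⟨
      M * t                 ≤⟨ *-mono-≤ (proj₁ 0<M) 0≤t M≤ηMᵖ (id≤^ᴿ 1≤t) ⟩
      η * M ^ᴿ p * t ^ᴿ p   ≈⟨ *-assoc _ _ _ ⟩
      η * (M ^ᴿ p * t ^ᴿ p) ≈⟨ *-congˡ (^ᴿ-distrib-* (proj₁ 0<M) 0≤t) ⟨
      η * (M * t) ^ᴿ p      ≈⟨ *-congˡ (^ᴿ-congˡ p Mt≈y) ⟩
      η * y ^ᴿ p            ∎
      where
      -- Beyond the threshold y = M t with t ≥ 1, and t ≤ t^p carries the inequality from M to y.
      t = y * M ⁻¹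
      Mt≈y : M * t ≈ y
      Mt≈y = trans (solve 3 (λ x c i → x :* (c :* i) := c :* (x :* i)) refl M y (M ⁻¹))
               (trans (*-congˡ (⁻¹-inverseʳ M (>⇒≉0 0<M))) (*-identityʳ y))
      1≤t : 1# ≤ t
      1≤t = *-cancelˡ-≤ M 0<M (≤-trans (≤-reflexive (*-identityʳ M)) (≤-trans M≤y (≤-reflexive (sym Mt≈y))))
      0≤t = ≤-trans 0≤1 1≤t

  q : Carrier
  q = p ⁻¹

  0≤q : 0# ≤ q
  0≤q = 0≤⁻¹ 0<p

  pq≈1 : p * q ≈ 1#
  pq≈1 = ⁻¹-inverseʳ p (>⇒≉0 0<p)

  q≤1 : q ≤ 1#
  q≤1 = *-cancelˡ-≤ p 0<p (≤-trans (≤-reflexive pq≈1) (≤-trans 1≤p (≤-reflexive (sym (*-identityʳ p)))))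

  -- With a = ⌊b p⌋, rounding gives b - 1 ≤ a q and (a + 1) q ≤ b + 1. The b-th powers of the two
  -- sides therefore agree up to a factor x, which `^-ratio-bounded⇒≤` ignores.
  ^ᴿ-q-p : ∀ {x} → 1# ≤ x → (x ^ᴿ q) ^ᴿ p ≈ x
  ^ᴿ-q-p {x} 1≤x = ≤-antisym
    (^-ratio-bounded⇒≤ {C = x} 0<x upper)
    (^-ratio-bounded⇒≤ {C = x} (0<^ᴿ 0<z 0≤p) lower)
    where
    open ≤-Reasoning
    0<x = <-≤-trans 0<1 1≤x
    0≤x = proj₁ 0<x
    z   = x ^ᴿ q
    0<z = 0<^ᴿ 0<x 0≤q
    0≤z = proj₁ 0<z
    1≤z : 1# ≤ z
    1≤z = ≤-trans (^≤^ᴿ {a = 0} {b = 1} 0≤x 0≤q (s≤s z≤n) (large 1≤x (0≤fromℕ 1 ⊗ 0≤q)))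
            (≤-reflexive (*-identityʳ z))
    upper : ∀ b → 1 ℕ.≤ b → (z ^ᴿ p) ^ b ≤ x * x ^ b
    upper b 1≤b = let a , a≤bp , bp≤1+a = floor (fromℕ b * p) (0≤fromℕ b ⊗ 0≤p) in begin
      (z ^ᴿ p) ^ b   ≤⟨ ^ᴿ≤^ {a = suc a} 0≤z 0≤p 1≤b (large 1≤z bp≤1+a) ⟩
      z ^ suc a      ≤⟨ ^ᴿ≤^ {a = suc b} {b = suc a} 0≤x 0≤q (s≤s z≤n) (large 1≤x (begin
        fromℕ (suc a) * q                ≤⟨ ≤-by (x≤y⇒0≤y-x a≤bp ⊗ 0≤q ⊕ x≤y⇒0≤y-x q≤1)
             (solve 4 (λ a b p q → :1 :+ b :* (p :* q) := (:1 :+ a) :* q :+ ((b :* p :- a) :* q :+ (:1 :- q))) refl (fromℕ a) (fromℕ b) p q) ⟩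
        1# + fromℕ b * (p * q)           ≈⟨ +-congˡ (trans (*-congˡ pq≈1) (*-identityʳ _)) ⟩
        fromℕ (suc b)                    ∎)) ⟩
      x ^ suc b      ∎
    lower : ∀ b → 1 ℕ.≤ b → x ^ b ≤ x * (z ^ᴿ p) ^ b
    lower b@(suc c) 1≤b = *-monoˡ-≤ x 0≤x (dispatch (floor (fromℕ b * p) (0≤fromℕ b ⊗ 0≤p)))
      where
      dispatch : (∃ λ a → fromℕ a ≤ fromℕ b * p × fromℕ b * p ≤ fromℕ (suc a)) →
        x ^ c ≤ (z ^ᴿ p) ^ b
      -- In the other case `a` becomes the denominator of a fraction and must be positive. Here b ≤
      -- b p ≤ 1 leaves only b = 1.
      dispatch (zero , _ , bp≤1) = begin
        x ^ c         ≤⟨ ^-monoʳ-≤ 1≤x c≤0 ⟩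
        1#            ≤⟨ ^≤^ᴿ {a = 0} 0≤z 0≤p 1≤b (large 1≤z (0≤fromℕ b ⊗ 0≤p)) ⟩
        (z ^ᴿ p) ^ b  ∎
        where
        c≤0 : c ℕ.≤ 0
        c≤0 = ℕ.s≤s⁻¹ (fromℕ-cancel-≤ {b} {1} (≤-trans (≤-by (0≤fromℕ b ⊗ x≤y⇒0≤y-x 1≤p)
          (solve 2 (λ n p → n :* p := n :+ n :* (p :- :1)) refl (fromℕ b) p)) bp≤1))
      dispatch (a@(suc _) , a≤bp , bp≤1+a) = begin
        x ^ c         ≤⟨ ^≤^ᴿ {a = c} {b = a} 0≤x 0≤q (s≤s z≤n) (large 1≤x c≤aq) ⟩
        z ^ a         ≤⟨ ^≤^ᴿ {a = a} 0≤z 0≤p 1≤b (large 1≤z a≤bp) ⟩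
        (z ^ᴿ p) ^ b  ∎
        where
        c≤aq : fromℕ c ≤ fromℕ a * q
        c≤aq = begin
          fromℕ c                         ≈⟨ solve 1 (λ c → c := (:1 :+ c) :* :1 :- :1) refl (fromℕ c) ⟩
          fromℕ b * 1# - 1#               ≈⟨ +-congʳ (*-congˡ (sym pq≈1)) ⟩
          fromℕ b * (p * q) - 1#          ≤⟨ ≤-by (x≤y⇒0≤y-x bp≤1+a ⊗ 0≤q ⊕ x≤y⇒0≤y-x q≤1)
             (solve 4 (λ a b p q → a :* q := b :* (p :* q) :- :1 :+ (((:1 :+ a) :- b :* p) :* q :+ (:1 :- q))) refl (fromℕ a) (fromℕ b) p q) ⟩
          fromℕ a * q                     ∎

  -- Spelled exactly as in the theorem, so that the two exponents agree definitionally.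
  e : Carrier
  e = fromℕ 2 - fromℕ 2 * q

  0≤e : 0# ≤ e
  0≤e = ≤-trans (0≤fromℕ 2 ⊗ x≤y⇒0≤y-x q≤1)
    (≤-reflexive (solve 2 (λ t q → t :* (:1 :- q) := t :- t :* q) refl (fromℕ 2) q))

  -- The instance e + q + q = 2 of the addition law. Rounding b e once and b q twice down to
  -- integers loses at most 3 in total, whence the constant x^3.
  ^ᴿ-e-q : ∀ {x} → 1# ≤ x → x ^ᴿ e * (x ^ᴿ q * x ^ᴿ q) ≈ x * x
  ^ᴿ-e-q {x} 1≤x = ≤-antisym
    (^-ratio-bounded⇒≤ {C = x ^ 3} (0<* 0<x 0<x) upper)
    (^-ratio-bounded⇒≤ {C = x ^ 3} (0<* (0<^ᴿ 0<x 0≤e) (0<* (0<^ᴿ 0<x 0≤q) (0<^ᴿ 0<x 0≤q))) lower)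
    where
    open ≤-Reasoning
    0<x = <-≤-trans 0<1 1≤x
    0≤x = proj₁ 0<x
    z   = x ^ᴿ e
    w   = x ^ᴿ q
    0≤z = proj₁ (0<^ᴿ 0<x 0≤e)
    0≤w = proj₁ (0<^ᴿ 0<x 0≤q)
    exponents : ∀ b → fromℕ b * e + (fromℕ b * q + fromℕ b * q) ≈ fromℕ b + fromℕ b
    exponents b = solve 2 (λ b q → b :* ((:1 :+ (:1 :+ :0)) :- (:1 :+ (:1 :+ :0)) :* q) :+ (b :* q :+ b :* q) := b :+ b) refl (fromℕ b) q
    split : ∀ b u v → (u * (v * v)) ^ b ≈ u ^ b * (v ^ b * v ^ b)
    split b u v = trans (^-distrib-* u (v * v) b) (*-congˡ (^-distrib-* v v b))
    merge : ∀ i j → x ^ i * (x ^ j * x ^ j) ≈ x ^ (i ℕ.+ (j ℕ.+ j))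
    merge i j = sym (trans (^-homo-* x i (j ℕ.+ j)) (*-congˡ (^-homo-* x j j)))
    fromℕ-merge : ∀ i j → fromℕ (i ℕ.+ (j ℕ.+ j)) ≈ fromℕ i + (fromℕ j + fromℕ j)
    fromℕ-merge i j = trans (fromℕ-+ i (j ℕ.+ j)) (+-congˡ (fromℕ-+ j j))
    cube : ∀ n → x ^ (3 ℕ.+ n) ≈ x ^ 3 * x ^ n
    cube = ^-homo-* x 3
    upper : ∀ b → 1 ℕ.≤ b → (z * (w * w)) ^ b ≤ x ^ 3 * (x * x) ^ b
    upper b 1≤b =
      let i , i≤ , ≤1+i = floor (fromℕ b * e) (0≤fromℕ b ⊗ 0≤e)
          j , j≤ , ≤1+j = floor (fromℕ b * q) (0≤fromℕ b ⊗ 0≤q)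
          wb = ^ᴿ≤^ {a = suc j} 0≤x 0≤q 1≤b (large 1≤x ≤1+j)
          i+2j≤2b : i ℕ.+ (j ℕ.+ j) ℕ.≤ b ℕ.+ b
          i+2j≤2b = fromℕ-cancel-≤ (begin
            fromℕ (i ℕ.+ (j ℕ.+ j))       ≈⟨ fromℕ-merge i j ⟩
            fromℕ i + (fromℕ j + fromℕ j) ≤⟨ +-mono-≤ i≤ (+-mono-≤ j≤ j≤) ⟩
            fromℕ b * e + (fromℕ b * q + fromℕ b * q) ≈⟨ exponents b ⟩
            fromℕ b + fromℕ b             ≈⟨ fromℕ-+ b b ⟨
            fromℕ (b ℕ.+ b)               ∎)
      in begin
        (z * (w * w)) ^ b                   ≈⟨ split b z w ⟩
        z ^ b * (w ^ b * w ^ b)             ≤⟨ *-mono-≤ (0≤^ b 0≤z) (0≤^ b 0≤w ⊗ 0≤^ b 0≤w)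
                                                 (^ᴿ≤^ {a = suc i} 0≤x 0≤e 1≤b (large 1≤x ≤1+i))
                                                 (*-mono-≤ (0≤^ b 0≤w) (0≤^ b 0≤w) wb wb) ⟩
        x ^ suc i * (x ^ suc j * x ^ suc j) ≈⟨ solve 3 (λ x I J → (x :* I) :* ((x :* J) :* (x :* J)) := (x :* (x :* (x :* :1))) :* (I :* (J :* J))) refl x (x ^ i) (x ^ j) ⟩
        x ^ 3 * (x ^ i * (x ^ j * x ^ j))   ≈⟨ *-congˡ (merge i j) ⟩
        x ^ 3 * x ^ (i ℕ.+ (j ℕ.+ j))       ≤⟨ *-monoˡ-≤ (x ^ 3) (0≤^ 3 0≤x) (^-monoʳ-≤ 1≤x i+2j≤2b) ⟩
        x ^ 3 * x ^ (b ℕ.+ b)               ≈⟨ *-congˡ (trans (^-homo-* x b b) (sym (^-distrib-* x x b))) ⟩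
        x ^ 3 * (x * x) ^ b                 ∎
    lower : ∀ b → 1 ℕ.≤ b → (x * x) ^ b ≤ x ^ 3 * (z * (w * w)) ^ b
    lower b 1≤b =
      let i , i≤ , ≤1+i = floor (fromℕ b * e) (0≤fromℕ b ⊗ 0≤e)
          j , j≤ , ≤1+j = floor (fromℕ b * q) (0≤fromℕ b ⊗ 0≤q)
          wb = ^≤^ᴿ {a = j} 0≤x 0≤q 1≤b (large 1≤x j≤)
          2b≤3+i+2j : b ℕ.+ b ℕ.≤ 3 ℕ.+ (i ℕ.+ (j ℕ.+ j))
          2b≤3+i+2j = fromℕ-cancel-≤ (begin
            fromℕ (b ℕ.+ b)               ≈⟨ fromℕ-+ b b ⟩
            fromℕ b + fromℕ b             ≈⟨ exponents b ⟨
            fromℕ b * e + (fromℕ b * q + fromℕ b * q) ≤⟨ +-mono-≤ ≤1+i (+-mono-≤ ≤1+j ≤1+j) ⟩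
            fromℕ (suc i) + (fromℕ (suc j) + fromℕ (suc j)) ≈⟨ solve 2 (λ i j → (:1 :+ i) :+ ((:1 :+ j) :+ (:1 :+ j)) := :1 :+ (:1 :+ (:1 :+ (i :+ (j :+ j))))) refl (fromℕ i) (fromℕ j) ⟩
            1# + (1# + (1# + (fromℕ i + (fromℕ j + fromℕ j)))) ≈⟨ +-congˡ (+-congˡ (+-congˡ (fromℕ-merge i j))) ⟨
            fromℕ (3 ℕ.+ (i ℕ.+ (j ℕ.+ j))) ∎)
      in begin
        (x * x) ^ b                          ≈⟨ trans (^-distrib-* x x b) (sym (^-homo-* x b b)) ⟩
        x ^ (b ℕ.+ b)                        ≤⟨ ^-monoʳ-≤ 1≤x 2b≤3+i+2j ⟩
        x ^ (3 ℕ.+ (i ℕ.+ (j ℕ.+ j)))        ≈⟨ cube (i ℕ.+ (j ℕ.+ j)) ⟩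
        x ^ 3 * x ^ (i ℕ.+ (j ℕ.+ j))        ≈⟨ *-congˡ (merge i j) ⟨
        x ^ 3 * (x ^ i * (x ^ j * x ^ j))    ≤⟨ *-monoˡ-≤ (x ^ 3) (0≤^ 3 0≤x)
                                                  (*-mono-≤ (0≤^ i 0≤x) (0≤^ j 0≤x ⊗ 0≤^ j 0≤x)
                                                    (^≤^ᴿ {a = i} 0≤x 0≤e 1≤b (large 1≤x i≤))
                                                    (*-mono-≤ (0≤^ j 0≤x) (0≤^ j 0≤x) wb wb)) ⟩
        x ^ 3 * (z ^ b * (w ^ b * w ^ b))    ≈⟨ *-congˡ (split b z w) ⟨
        x ^ 3 * (z * (w * w)) ^ b            ∎

-- Finite sums and maxima over finite function types

module FiniteSums (em : ExcludedMiddle 0ℓ) (ℝ : CompleteOrderedField) where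
  open CompleteOrderedField ℝ hiding (zero)
  open OrderedField em ℝ
  open CommutativeMonoidSum +-commutativeMonoid public using ()
    renaming (∑-distrib-+ to sum-+; ∑-comm to sum-swap)
  open SemiringSum semiring public using (*-distribˡ-sum; *-distribʳ-sum)

  sum-cong : ∀ {n} {f g : Vector Carrier n} → (∀ i → f i ≈ g i) → sum f ≈ sum g
  sum-cong = CommutativeMonoidSum.sum-cong-≋ +-commutativeMonoid

  sum-mono-≤ : ∀ {n} {f g : Vector Carrier n} → (∀ i → f i ≤ g i) → sum f ≤ sum g
  sum-mono-≤ {zero}  f≤g = ≤-refl
  sum-mono-≤ {suc n} f≤g = +-mono-≤ (f≤g zero) (sum-mono-≤ (λ i → f≤g (suc i)))

  sum-const : ∀ n x → sum {n} (λ _ → x) ≈ fromℕ n * x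
  sum-const zero    x = sym (zeroˡ x)
  sum-const (suc n) x = trans (+-congˡ (sum-const n x))
    (solve 2 (λ n x → x :+ n :* x := (:1 :+ n) :* x) refl (fromℕ n) x)

  0≤sum : ∀ {n} {f : Vector Carrier n} → (∀ i → 0# ≤ f i) → 0# ≤ sum f
  0≤sum {zero}  0≤f = ≤-refl
  0≤sum {suc n} 0≤f = 0≤f zero ⊕ 0≤sum (λ i → 0≤f (suc i))

  sum-*ˡ : ∀ {n} c (f : Vector Carrier n) → sum (λ i → c * f i) ≈ c * sum f
  sum-*ˡ c f = sym (*-distribˡ-sum c f)

  sum-*ʳ : ∀ {n} c (f : Vector Carrier n) → sum (λ i → f i * c) ≈ sum f * c
  sum-*ʳ c f = sym (*-distribʳ-sum c f)

  term≤sum : ∀ {n} {f : Vector Carrier n} → (∀ i → 0# ≤ f i) → ∀ i → f i ≤ sum f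
  term≤sum 0≤f zero    = ≤-by (0≤sum (λ i → 0≤f (suc i))) refl
  term≤sum {f = f} 0≤f (suc i) = ≤-trans (term≤sum (λ j → 0≤f (suc j)) i)
    (≤-by (0≤f zero) (+-comm _ _))

  indicator : Bool → Carrier
  indicator true  = 1#
  indicator false = 0#

  0≤indicator : ∀ b → 0# ≤ indicator b
  0≤indicator true  = 0≤1
  0≤indicator false = ≤-refl

  indicator≤1 : ∀ b → indicator b ≤ 1#
  indicator≤1 true  = ≤-refl
  indicator≤1 false = 0≤1

  0<indicator⇒true : ∀ {b} → 0# < indicator b → b ≡ true
  0<indicator⇒true {true}  _   = ≡.refl
  0<indicator⇒true {false} 0<0 = ⊥-elim (<⇒≱ 0<0 ≤-refl)

  sum-point : ∀ {n} (v : Fin n) (f : Vector Carrier n) →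
    sum (λ j → indicator (does (j Fin.≟ v)) * f j) ≈ f v
  sum-point {suc n} zero f = trans
    (+-cong (*-identityˡ _) (trans (sum-cong {f = λ j → indicator (does (suc j Fin.≟ zero)) * f (suc j)}
       {g = λ _ → 0#} (λ j → zeroˡ _)) (trans (sum-const n 0#) (zeroʳ _))))
    (+-identityʳ _)
  sum-point {suc n} (suc v) f = trans (+-congʳ (zeroˡ _))
    (trans (+-identityˡ _) (sum-point v (λ j → f (suc j))))

  -- The relation stands in for equality: the intended types are vertex sets and adjacency matrices,
  -- encoded as functions and compared pointwise.
  HasMaximumPrinciple : (A : Set) → (A → A → Set) → Set
  HasMaximumPrinciple A _~_ = ∀ (h : A → Carrier) → (∀ {a b} → a ~ b → h a ≈ h b) →
    ∃ λ a → ∀ b → h b ≤ h a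

  Bool-maximum : HasMaximumPrinciple Bool _≡_
  Bool-maximum h _ with ≤-total (h true) (h false)
  ... | inj₁ p = false , λ { true → p ; false → ≤-refl }
  ... | inj₂ p = true , λ { true → ≤-refl ; false → p }

  Vector-maximum : ∀ {A _~_} n → (∀ {a} → a ~ a) → HasMaximumPrinciple A _~_ →
    HasMaximumPrinciple (Vector A n) (λ f g → ∀ i → f i ~ g i)
  Vector-maximum zero ~-refl maxA h cong =
    (λ ()) , λ f → ≤-reflexive (cong λ ())
  Vector-maximum {A} {_~_} (suc n) ~-refl maxA h cong = cons a (tail a) , λ f → begin
    h f                                ≈⟨ cong (cons-η f) ⟩
    h (cons (f zero) (f ∘ suc))        ≤⟨ proj₂ (best (f zero)) (f ∘ suc) ⟩
    h (cons (f zero) (tail (f zero)))  ≤⟨ proj₂ (maxA (λ a → h (cons a (tail a))) tail-cong) (f zero) ⟩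
    h (cons a (tail a))                ∎
    where
    open ≤-Reasoning
    cons : A → Vector A n → Vector A (suc n)
    cons a f zero    = a
    cons a f (suc i) = f i
    cons-η : ∀ f i → f i ~ cons (f zero) (f ∘ suc) i
    cons-η f zero    = ~-refl
    cons-η f (suc i) = ~-refl
    cons-cong : ∀ {a b f g} → a ~ b → (∀ i → f i ~ g i) → ∀ i → cons a f i ~ cons b g i
    cons-cong p q zero    = p
    cons-cong p q (suc i) = q i
    best : ∀ a → ∃ λ f → ∀ g → h (cons a g) ≤ h (cons a f)
    best a = Vector-maximum n ~-refl maxA (λ f → h (cons a f)) (λ p → cong (cons-cong ~-refl p))
    tail : A → Vector A n
    tail a = proj₁ (best a)
    -- The tails selected for related heads may differ, but each does at least as well as the other,
    -- so the values coincide.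
    tail-cong : ∀ {a b} → a ~ b → h (cons a (tail a)) ≈ h (cons b (tail b))
    tail-cong {a} {b} a~b = ≤-antisym
      (≤-trans (≤-reflexive (cong (cons-cong a~b (λ i → ~-refl)))) (proj₂ (best b) (tail a)))
      (≤-trans (≤-reflexive (sym (cong (cons-cong a~b (λ i → ~-refl))))) (proj₂ (best a) (tail b)))
    a : A
    a = proj₁ (maxA (λ a → h (cons a (tail a))) tail-cong)

-- Complete partite subgraphs in dense weighted graphs

module WeightedErdősStone (em : ExcludedMiddle 0ℓ) (ℝ : CompleteOrderedField) where
  open CompleteOrderedField ℝ hiding (zero)
  open OrderedField em ℝ
  open FiniteSums em ℝ

  degree : ∀ {n} → Graph n → Vector Carrier n → Fin n → Carrier
  degree G w v = sum λ j → indicator (adj G v j) * w j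

  energy : ∀ {n} → Graph n → Vector Carrier n → Carrier
  energy G w = sum λ i → w i * degree G w i

  degree≤sum : ∀ {n} (G : Graph n) {w} → (∀ i → 0# ≤ w i) → ∀ v → degree G w v ≤ sum w
  degree≤sum G {w} 0≤w v = sum-mono-≤ λ j → ≤-trans (*-monoʳ-≤ (w j) (0≤w j) (indicator≤1 (adj G v j)))
    (≤-reflexive (*-identityˡ _))

  energy≤sum² : ∀ {n} (G : Graph n) {w} → (∀ i → 0# ≤ w i) → energy G w ≤ sum w * sum w
  energy≤sum² G {w} 0≤w = ≤-trans
    (sum-mono-≤ λ i → *-monoˡ-≤ (w i) (0≤w i) (degree≤sum G 0≤w i))
    (≤-reflexive (sum-*ʳ (sum w) w))

  DistinctInSupport : ∀ {n} → ℕ → Vector Carrier n → Set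
  DistinctInSupport {n} t w =
    Σ (Fin t → Fin n) λ g → Injective _≡_ _≡_ g × (∀ i → 0# < w (g i))

  -- Pigeonhole: fewer than t positive entries, each at most μ, sum to at most t μ. Applied to
  -- weights it finds the vertices of a part; applied to indicators, the neighbours of a vertex
  -- inside a part.
  select : ∀ {n} t (w : Vector Carrier n) {μ} → 0# ≤ μ → (∀ i → 0# ≤ w i) → (∀ i → w i ≤ μ) →
    DistinctInSupport t w ⊎ sum w ≤ fromℕ t * μ
  select zero w _ _ _ = inj₁ ((λ ()) , (λ {}) , λ ())
  select {zero} (suc t) w 0≤μ _ _ = inj₂ (0≤fromℕ (suc t) ⊗ 0≤μ)
  select {suc n} (suc t) w {μ} 0≤μ 0≤w w≤μ with ≤⇒≈⊎< (0≤w zero)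
  ... | inj₁ 0≈w₀ = shift (select (suc t) (w ∘ suc) 0≤μ (0≤w ∘ suc) (w≤μ ∘ suc))
    where
    shift : DistinctInSupport (suc t) (w ∘ suc) ⊎ sum (w ∘ suc) ≤ fromℕ (suc t) * μ →
            DistinctInSupport (suc t) w ⊎ sum w ≤ fromℕ (suc t) * μ
    shift (inj₁ (g , g-inj , 0<)) = inj₁ (suc ∘ g , (λ p → g-inj (Fin.suc-injective p)) , 0<)
    shift (inj₂ p) = inj₂ (≤-trans (≤-reflexive (trans (+-congʳ (sym 0≈w₀)) (+-identityˡ _))) p)
  ... | inj₂ 0<w₀ = extend (select t (w ∘ suc) 0≤μ (0≤w ∘ suc) (w≤μ ∘ suc))
    where
    extend : DistinctInSupport t (w ∘ suc) ⊎ sum (w ∘ suc) ≤ fromℕ t * μ →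
             DistinctInSupport (suc t) w ⊎ sum w ≤ fromℕ (suc t) * μ
    extend (inj₂ p) = inj₂ (≤-trans (+-mono-≤ (w≤μ zero) p)
      (≤-reflexive (solve 2 (λ t μ → μ :+ t :* μ := (:1 :+ t) :* μ) refl (fromℕ t) μ)))
    extend (inj₁ (g , g-inj , 0<)) = inj₁ (g⁺ , g⁺-inj , 0<⁺)
      where
      g⁺ : Fin (suc t) → Fin (suc n)
      g⁺ zero    = zero
      g⁺ (suc i) = suc (g i)
      g⁺-inj : Injective _≡_ _≡_ g⁺
      g⁺-inj {zero}  {zero}  _ = ≡.refl
      g⁺-inj {suc i} {suc j} p = ≡.cong suc (g-inj (Fin.suc-injective p))
      0<⁺ : ∀ i → 0# < w (g⁺ i)
      0<⁺ zero    = 0<w₀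
      0<⁺ (suc i) = 0< i

  restrict : ∀ {n} → (Fin n → Bool) → Vector Carrier n → Vector Carrier n
  restrict S w v = indicator (S v) * w v

  0≤restrict : ∀ {n} S {w : Vector Carrier n} → (∀ v → 0# ≤ w v) → ∀ v → 0# ≤ restrict S w v
  0≤restrict S 0≤w v = 0≤indicator (S v) ⊗ 0≤w v

  restrict≤ : ∀ {n} S {w : Vector Carrier n} → (∀ v → 0# ≤ w v) → ∀ v → restrict S w v ≤ w v
  restrict≤ S {w} 0≤w v = ≤-trans (*-monoʳ-≤ (w v) (0≤w v) (indicator≤1 (S v)))
    (≤-reflexive (*-identityˡ _))

  restrict-support : ∀ {n} S {w : Vector Carrier n} {v} → 0# < restrict S w v → S v ≡ true
  restrict-support S {w} {v} 0<Sw with S v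
  ... | true  = ≡.refl
  ... | false = ⊥-elim (proj₂ 0<Sw (sym (zeroˡ _)))

  sum-restrict-not : ∀ {n} S (w : Vector Carrier n) →
    sum w ≈ sum (restrict S w) + sum (restrict (Bool.not ∘ S) w)
  sum-restrict-not S w = trans (sum-cong pointwise) (sum-+ (restrict S w) (restrict (Bool.not ∘ S) w))
    where
    pointwise : ∀ v → w v ≈ restrict S w v + restrict (Bool.not ∘ S) w v
    pointwise v with S v
    ... | true  = solve 1 (λ w → w := :1 :* w :+ :0 :* w) refl (w v)
    ... | false = solve 1 (λ w → w := :0 :* w :+ :1 :* w) refl (w v)

  -- Splitting by adjacency to one vertex and keeping the heavier half, for
  -- each of the k vertices in turn.
  homogenize : ∀ {n} (G : Graph n) k (us : Fin k → Fin n) (w : Vector Carrier n) → (∀ v → 0# ≤ w v) →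
    ∃ λ w′ → (∀ v → 0# ≤ w′ v) × (∀ v → w′ v ≤ w v) × sum w ≤ two ^ k * sum w′ ×
      (∀ j u v → 0# < w′ u → 0# < w′ v → adj G u (us j) ≡ adj G v (us j))
  homogenize G zero us w 0≤w = w , 0≤w , (λ _ → ≤-refl) , ≤-reflexive (sym (*-identityˡ _)) , λ ()
  homogenize {n} G (suc k) us w 0≤w =
    combine (homogenize G k (us ∘ suc) w 0≤w)
    where
    Goal = ∃ λ w′ → (∀ v → 0# ≤ w′ v) × (∀ v → w′ v ≤ w v) × sum w ≤ two ^ suc k * sum w′ ×
      (∀ j u v → 0# < w′ u → 0# < w′ v → adj G u (us j) ≡ adj G v (us j))
    combine : (∃ λ x → (∀ v → 0# ≤ x v) × (∀ v → x v ≤ w v) × sum w ≤ two ^ k * sum x ×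
      (∀ j u v → 0# < x u → 0# < x v → adj G u (us (suc j)) ≡ adj G v (us (suc j)))) → Goal
    combine (x , 0≤x , x≤w , W≤2ᵏX , same) =
      choose (≤-total (sum (restrict S x)) (sum (restrict (Bool.not ∘ S) x)))
      where
      S : Fin n → Bool
      S v = adj G v (us zero)
      keep : (T : Fin n → Bool) → (∀ {u v} → T u ≡ true → T v ≡ true → S u ≡ S v) →
        sum x ≤ two * sum (restrict T x) → Goal
      keep T T⇒S X≤2T = restrict T x , 0≤restrict T 0≤x ,
        (λ v → ≤-trans (restrict≤ T 0≤x v) (x≤w v)) ,
        (begin
          sum w                                  ≤⟨ W≤2ᵏX ⟩
          two ^ k * sum x                        ≤⟨ *-monoˡ-≤ _ (proj₁ (0<^ k 0<two)) X≤2T ⟩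
          two ^ k * (two * sum (restrict T x))   ≈⟨ solve 2 (λ t s → t :* (:2 :* s) := :2 :* t :* s) refl (two ^ k) _ ⟩
          two ^ suc k * sum (restrict T x)       ∎) ,
        λ { zero u v 0<u 0<v → T⇒S (restrict-support T {x} 0<u) (restrict-support T {x} 0<v)
          ; (suc j) u v 0<u 0<v → same j u v (<-≤-trans 0<u (restrict≤ T 0≤x u)) (<-≤-trans 0<v (restrict≤ T 0≤x v)) }
        where open ≤-Reasoning
      double : ∀ {a b c} → a ≈ b + c → b ≤ c → a ≤ two * c
      double {a} {b} {c} a≈b+c b≤c = ≤-trans (≤-reflexive a≈b+c)
        (≤-by (x≤y⇒0≤y-x b≤c) (solve 2 (λ b c → :2 :* c := (b :+ c) :+ (c :- b)) refl b c))
      choose : sum (restrict S x) ≤ sum (restrict (Bool.not ∘ S) x) ⊎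
               sum (restrict (Bool.not ∘ S) x) ≤ sum (restrict S x) → Goal
      choose (inj₁ S≤T) = keep (Bool.not ∘ S) (λ p q → not-injective (≡.trans p (≡.sym q)))
        (double (sum-restrict-not S x) S≤T)
        where
        not-injective : ∀ {a b} → Bool.not a ≡ Bool.not b → a ≡ b
        not-injective {true}  {true}  _ = ≡.refl
        not-injective {false} {false} _ = ≡.refl
      choose (inj₂ T≤S) = keep S (λ p q → ≡.trans p (≡.sym q))
        (double (trans (sum-restrict-not S x) (+-comm _ _)) T≤S)

  -- Vertices of different parts are adjacent and hence distinct by `adj-irr`, so injectivity is
  -- asked only within a part. Positive weight is recorded because the degree condition speaks only
  -- of the support.
  CompletePartite : ∀ {n} → Graph n → Vector Carrier n → ℕ → ℕ → Set
  CompletePartite {n} G w s t = Σ (Fin s → Fin t → Fin n) λ φ →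
    (∀ a → Injective _≡_ _≡_ (φ a)) × (∀ a i → 0# < w (φ a i)) ×
    (∀ a b i j → a ≢ b → Adj G (φ a i) (φ b j))

  -- The vertices with at least t neighbours in every part of a complete
  -- s-partite subgraph with large parts carry a positive proportion of the
  -- weight.
  module GoodVertices
    (r s T t : ℕ) (s≤r : s ℕ.≤ r) (1≤r : 1 ℕ.≤ r) (κ : Carrier) (0≤κ : 0# ≤ κ) (κ≤1 : κ ≤ 1#)
    (1≤T : 1 ℕ.≤ T) (2rt≤κT : two * (fromℕ r * fromℕ t) ≤ κ * fromℕ T)
    {n : ℕ} (G : Graph n) (w : Vector Carrier n) (0≤w : ∀ v → 0# ≤ w v)
    (minimumDegree : ∀ v → 0# < w v → (fromℕ r - 1# + κ) * sum w ≤ fromℕ r * degree G w v)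
    (φ : Fin s → Fin T → Fin n) (φ-support : ∀ a i → 0# < w (φ a i))
    where

    W = sum w

    Meets : Fin n → Fin s → Set
    Meets v a = Σ (Fin t → Fin T) λ g → Injective _≡_ _≡_ g × (∀ i → Adj G v (φ a (g i)))

    good : Fin n → Bool
    good v = does (em {∀ a → Meets v a})

    bad : Fin s → Fin n → Bool
    bad a v = Bool.not (does (em {Meets v a}))

    good⇒Meets : ∀ {v} → good v ≡ true → ∀ a → Meets v a
    good⇒Meets {v} p with em {∀ a → Meets v a}
    ... | yes q = q

    meeting : Fin s → Fin n → Carrier
    meeting a v = sum λ i → indicator (adj G v (φ a i))

    -- A union bound in additive form, ready to be multiplied by weights and summed: a vertex that
    -- is not good is bad for some part.
    1≤good+bad : ∀ v → 1# ≤ indicator (good v) + sum (λ a → indicator (bad a v))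
    1≤good+bad v with em {∀ a → Meets v a}
    ... | yes _ = ≤-by (0≤sum λ a → 0≤indicator (bad a v)) refl
    ... | no ¬good = ≤-trans (≤-trans (≤-reflexive isBad) (term≤sum (λ a → 0≤indicator (bad a v)) a))
            (≤-reflexive (sym (+-identityˡ _)))
      where
      counterexample : ∃ λ a → ¬ Meets v a
      counterexample with em {∃ λ a → ¬ Meets v a}
      ... | yes p = p
      ... | no ¬p = ⊥-elim (¬good λ a → stable a)
        where
        stable : ∀ a → Meets v a
        stable a with em {Meets v a}
        ... | yes q = q
        ... | no ¬q = ⊥-elim (¬p (a , ¬q))
      a = proj₁ counterexample
      isBad : 1# ≈ indicator (bad a v)
      isBad with em {Meets v a}
      ... | yes q = ⊥-elim (proj₂ counterexample q)
      ... | no _  = refl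

    -- Two cases in one linear inequality: at most T neighbours in the part in general, at most t of
    -- them for a bad vertex.
    meeting-bound : ∀ a v → meeting a v + fromℕ T * indicator (bad a v) ≤ fromℕ T + fromℕ t * indicator (bad a v)
    meeting-bound a v with em {Meets v a}
    ... | yes _ = +-mono-≤
          (≤-trans (sum-mono-≤ λ i → indicator≤1 (adj G v (φ a i)))
            (≤-reflexive (trans (sum-const T 1#) (*-identityʳ _))))
          (≤-reflexive (trans (zeroʳ _) (sym (zeroʳ _))))
    ... | no ¬meets = few (select t (λ i → indicator (adj G v (φ a i))) 0≤1
            (λ i → 0≤indicator (adj G v (φ a i))) (λ i → indicator≤1 (adj G v (φ a i))))
      where
      few : DistinctInSupport t (λ i → indicator (adj G v (φ a i))) ⊎ meeting a v ≤ fromℕ t * 1# →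
            meeting a v + fromℕ T * 1# ≤ fromℕ T + fromℕ t * 1#
      few (inj₁ (g , g-inj , 0<)) = ⊥-elim (¬meets (g , g-inj , λ i → 0<indicator⇒true (0< i)))
      few (inj₂ p) = ≤-trans (+-mono-≤ p (≤-reflexive (*-identityʳ _))) (≤-reflexive (+-comm _ _))

    badWeight : Fin s → Carrier
    badWeight a = sum (restrict (bad a) w)

    sum-meeting : ∀ a → sum (λ v → w v * meeting a v) ≈ sum (λ i → degree G w (φ a i))
    sum-meeting a = begin
      sum (λ v → w v * meeting a v)
        ≈⟨ sum-cong (λ v → sym (sum-*ˡ (w v) (λ i → indicator (adj G v (φ a i))))) ⟩
      sum (λ v → sum λ i → w v * indicator (adj G v (φ a i)))
        ≈⟨ sum-swap (λ v i → w v * indicator (adj G v (φ a i))) ⟩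
      sum (λ i → sum λ v → w v * indicator (adj G v (φ a i)))
        ≈⟨ sum-cong (λ i → sum-cong λ v → trans (*-comm _ _)
             (*-congʳ (reflexive (≡.cong indicator (adj-sym G v (φ a i)))))) ⟩
      sum (λ i → degree G w (φ a i)) ∎
      where open ≈-Reasoning

    many-meetings : ∀ a → fromℕ T * ((fromℕ r - 1# + κ) * W) ≤ fromℕ r * sum (λ v → w v * meeting a v)
    many-meetings a = begin
      fromℕ T * ((fromℕ r - 1# + κ) * W)            ≈⟨ sum-const T _ ⟨
      sum {T} (λ i → (fromℕ r - 1# + κ) * W)        ≤⟨ sum-mono-≤ (λ i → minimumDegree (φ a i) (φ-support a i)) ⟩
      sum (λ i → fromℕ r * degree G w (φ a i))      ≈⟨ sum-*ˡ (fromℕ r) (λ i → degree G w (φ a i)) ⟩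
      fromℕ r * sum (λ i → degree G w (φ a i))      ≈⟨ *-congˡ (sum-meeting a) ⟨
      fromℕ r * sum (λ v → w v * meeting a v)       ∎
      where open ≤-Reasoning

    few-meetings : ∀ a → sum (λ v → w v * meeting a v) + fromℕ T * badWeight a ≤ fromℕ T * W + fromℕ t * badWeight a
    few-meetings a = begin
      sum (λ v → w v * meeting a v) + fromℕ T * badWeight a
        ≈⟨ linear (fromℕ T) (meeting a) ⟨
      sum (λ v → w v * (meeting a v + fromℕ T * indicator (bad a v)))
        ≤⟨ sum-mono-≤ (λ v → *-monoˡ-≤ (w v) (0≤w v) (meeting-bound a v)) ⟩
      sum (λ v → w v * (fromℕ T + fromℕ t * indicator (bad a v)))
        ≈⟨ linear (fromℕ t) (λ _ → fromℕ T) ⟩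
      sum (λ v → w v * fromℕ T) + fromℕ t * badWeight a
        ≈⟨ +-congʳ (trans (sum-*ʳ (fromℕ T) w) (*-comm _ _)) ⟩
      fromℕ T * W + fromℕ t * badWeight a ∎
      where
      open ≤-Reasoning
      linear : ∀ c (f : Vector Carrier n) →
        sum (λ v → w v * (f v + c * indicator (bad a v))) ≈ sum (λ v → w v * f v) + c * badWeight a
      linear c f = trans (sum-cong λ v → solve 4 (λ w f c b → w :* (f :+ c :* b) := w :* f :+ c :* (b :* w))
          refl (w v) (f v) c (indicator (bad a v)))
        (trans (sum-+ (λ v → w v * f v) (λ v → c * restrict (bad a) w v))
          (+-congˡ (sum-*ˡ c (restrict (bad a) w))))

    -- Weighted edges at the part number at least T (r - 1 + κ) W / r by the degrees, and at most T
    -- W - (T - t) B if the bad vertices weigh B. Hence r (T - t) B ≤ T (1 - κ) W, and 2 r t ≤ κ T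
    -- lets half of κ absorb the term r t B.
    badWeight-bound : ∀ a → two * (fromℕ r * badWeight a) ≤ (two - κ) * W
    badWeight-bound a = *-cancelˡ-≤ (fromℕ T) (0<fromℕ 1≤T) (≤-by
      (proj₁ 0<two ⊗ (x≤y⇒0≤y-x (many-meetings a) ⊕ 0≤fromℕ r ⊗ x≤y⇒0≤y-x (few-meetings a))
        ⊕ x≤y⇒0≤y-x 2rt≤κT ⊗ 0≤sum 0≤w
        ⊕ proj₁ 0<two ⊗ (0≤fromℕ r ⊗ 0≤fromℕ t) ⊗ x≤y⇒0≤y-x (sum-mono-≤ (restrict≤ (bad a) 0≤w)))
      (solve 7 (λ T r t κ W B M →
        T :* ((:2 :- κ) :* W) := T :* (:2 :* (r :* B)) :+
          (:2 :* ((r :* M :- T :* ((r :- :1 :+ κ) :* W)) :+ r :* ((T :* W :+ t :* B) :- (M :+ T :* B)))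
           :+ (κ :* T :- :2 :* (r :* t)) :* W
           :+ :2 :* (r :* t) :* (W :- B)))
        refl (fromℕ T) (fromℕ r) (fromℕ t) κ W (badWeight a) (sum (λ v → w v * meeting a v))))

    W≤good+bad : W ≤ sum (restrict good w) + sum badWeight
    W≤good+bad = begin
      W                                                    ≤⟨ sum-mono-≤ pointwise ⟩
      sum (λ v → restrict good w v + sum (λ a → restrict (bad a) w v))
        ≈⟨ sum-+ (restrict good w) (λ v → sum (λ a → restrict (bad a) w v)) ⟩
      sum (restrict good w) + sum (λ v → sum (λ a → restrict (bad a) w v))
        ≈⟨ +-congˡ (sum-swap (λ v a → restrict (bad a) w v)) ⟩
      sum (restrict good w) + sum badWeight ∎
      where
      open ≤-Reasoning
      pointwise : ∀ v → w v ≤ restrict good w v + sum (λ a → restrict (bad a) w v)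
      pointwise v = begin
        w v                                                              ≈⟨ *-identityˡ _ ⟨
        1# * w v                                                         ≤⟨ *-monoʳ-≤ (w v) (0≤w v) (1≤good+bad v) ⟩
        (indicator (good v) + sum (λ a → indicator (bad a v))) * w v     ≈⟨ distribʳ _ _ _ ⟩
        restrict good w v + sum (λ a → indicator (bad a v)) * w v        ≈⟨ +-congˡ (sum-*ʳ (w v) (λ a → indicator (bad a v))) ⟨
        restrict good w v + sum (λ a → restrict (bad a) w v)             ∎

    -- There are at most r parts, and the vertices bad for one of them weigh at most (1 - κ / 2) W /
    -- r, so κ W / 2 remains. This works for s ≤ r existing parts, which is how r + 1 parts are
    -- reached.
    good-heavy : κ * W ≤ two * sum (restrict good w)
    good-heavy = *-cancelˡ-≤ (fromℕ r) (0<fromℕ 1≤r) (≤-by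
      (x≤y⇒0≤y-x total-bad
        ⊕ proj₁ 0<two ⊗ 0≤fromℕ r ⊗ x≤y⇒0≤y-x W≤good+bad
        ⊕ x≤y⇒0≤y-x (fromℕ-mono-≤ s≤r) ⊗ (x≤y⇒0≤y-x κ≤2 ⊗ 0≤sum 0≤w))
      (solve 6 (λ r κ W g B s → r :* (:2 :* g) := r :* (κ :* W) :+
          ((s :* ((:2 :- κ) :* W) :- :2 :* (r :* B)) :+ :2 :* r :* ((g :+ B) :- W)
           :+ (r :- s) :* ((:2 :- κ) :* W)))
        refl (fromℕ r) κ W (sum (restrict good w)) (sum badWeight) (fromℕ s)))
      where
      κ≤2 : κ ≤ two
      κ≤2 = ≤-trans κ≤1 (≤-by 0≤1 refl)
      total-bad : two * (fromℕ r * sum badWeight) ≤ fromℕ s * ((two - κ) * W)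
      total-bad = begin
        two * (fromℕ r * sum badWeight)                 ≈⟨ *-congˡ (sum-*ˡ (fromℕ r) badWeight) ⟨
        two * sum (λ a → fromℕ r * badWeight a)         ≈⟨ sum-*ˡ two (λ a → fromℕ r * badWeight a) ⟨
        sum (λ a → two * (fromℕ r * badWeight a))       ≤⟨ sum-mono-≤ badWeight-bound ⟩
        sum {s} (λ a → (two - κ) * W)                   ≈⟨ sum-const s _ ⟩
        fromℕ s * ((two - κ) * W)                       ∎
        where open ≤-Reasoning

  HasLargeDegrees : ∀ {n} → ℕ → Carrier → Graph n → Vector Carrier n → Set
  HasLargeDegrees r κ G w = ∀ v → 0# < w v → (fromℕ r - 1# + κ) * sum w ≤ fromℕ r * degree G w v

  extendPartite : ∀ {n} (G : Graph n) (w : Vector Carrier n) s T t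
    (φ : CompletePartite G w s T) (h : Fin (suc t) → Fin n) → Injective _≡_ _≡_ h →
    (∀ i → 0# < w (h i)) →
    (∀ a → Σ (Fin (suc t) → Fin T) λ g → Injective _≡_ _≡_ g ×
      (∀ i j → Adj G (h j) (proj₁ φ a (g i)))) →
    CompletePartite G w (suc s) (suc t)
  extendPartite {n} G w s T t (φ , φ-inj , φ-support , φ-adj) h h-inj h-support meets =
    ψ , ψ-inj , ψ-support , ψ-adj
    where
    g : Fin s → Fin (suc t) → Fin T
    g a = proj₁ (meets a)
    ψ : Fin (suc s) → Fin (suc t) → Fin n
    ψ zero    i = h i
    ψ (suc a) i = φ a (g a i)
    ψ-inj : ∀ a → Injective _≡_ _≡_ (ψ a)
    ψ-inj zero    p = h-inj p
    ψ-inj (suc a) p = proj₁ (proj₂ (meets a)) (φ-inj a p)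
    ψ-support : ∀ a i → 0# < w (ψ a i)
    ψ-support zero    i = h-support i
    ψ-support (suc a) i = φ-support a (g a i)
    ψ-adj : ∀ a b i j → a ≢ b → Adj G (ψ a i) (ψ b j)
    ψ-adj zero    zero    i j a≢b = ⊥-elim (a≢b ≡.refl)
    ψ-adj zero    (suc b) i j _   = proj₂ (proj₂ (meets b)) j i
    ψ-adj (suc a) zero    i j _   = ≡.trans (adj-sym G _ _) (proj₂ (proj₂ (meets a)) i j)
    ψ-adj (suc a) (suc b) i j a≢b = φ-adj a b _ _ (λ p → a≢b (≡.cong suc p))

  -- Induction on the number of parts, with parts of a larger size T in the hypothesis. The good
  -- vertices weigh at least κ W / 2; making them agree on adjacency to all s T chosen vertices
  -- divides this by at most 2^(s T), which still exceeds what t vertices of weight δ W can carry.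
  completePartite : ∀ r → 1 ℕ.≤ r → ∀ κ → 0# < κ → κ ≤ 1# → ∀ s → s ℕ.≤ suc r → ∀ t →
    ∃ λ δ → 0# < δ × (∀ {n} (G : Graph n) w → (∀ v → 0# ≤ w v) → 0# < sum w →
      (∀ v → w v ≤ δ * sum w) → HasLargeDegrees r κ G w → CompletePartite G w s t)
  -- Size 0 is split off because the induction step uses the first vertex of the new part as a
  -- representative.
  completePartite r 1≤r κ 0<κ κ≤1 s s≤r zero = 1# , 0<1 , λ G w _ _ _ _ →
    (λ a ()) , (λ { a {()} }) , (λ a ()) , λ a b ()
  completePartite r 1≤r κ 0<κ κ≤1 zero _ (suc t) = 1# , 0<1 , λ G w _ _ _ _ →
    (λ ()) , (λ ()) , (λ ()) , λ ()
  completePartite r 1≤r κ 0<κ κ≤1 (suc s) (s≤s s≤r) (suc t) = δ , 0<δ , construct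
    where
    open ≤-Reasoning
    0≤κ = proj₁ 0<κ
    t⁺ = suc t
    large = archimedean ((two * (fromℕ r * fromℕ t⁺)) * κ ⁻¹)
    T  = suc (proj₁ large)
    2rt≤κT : two * (fromℕ r * fromℕ t⁺) ≤ κ * fromℕ T
    2rt≤κT = begin
      two * (fromℕ r * fromℕ t⁺)               ≈⟨ trans (*-assoc _ _ _) (trans (*-congˡ (⁻¹-inverseˡ κ (>⇒≉0 0<κ))) (*-identityʳ _)) ⟨
      two * (fromℕ r * fromℕ t⁺) * κ ⁻¹ * κ    ≤⟨ *-monoʳ-≤ κ 0≤κ (proj₂ large) ⟩
      fromℕ (proj₁ large) * κ                  ≤⟨ *-monoʳ-≤ κ 0≤κ (≤-by 0≤1 (+-comm _ _)) ⟩
      fromℕ T * κ                              ≈⟨ *-comm _ _ ⟩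
      κ * fromℕ T                              ∎
    IH = completePartite r 1≤r κ 0<κ κ≤1 s (ℕ.≤-trans s≤r (ℕ.n≤1+n r)) T
    k  = s ℕ.* T
    -- With D δ ≤ κ the surviving weight is at least κ W / 2^(k+1) ≥ (1 + t⁺) δ W; the summand 1
    -- makes it strictly larger than t⁺ δ W.
    D  = two * two ^ k * (1# + fromℕ t⁺)
    0<D : 0# < D
    0<D = 0<* (0<* 0<two (0<^ k 0<two)) (0<1+ (0≤fromℕ t⁺))
    choice = minimum (proj₁ (proj₂ IH)) (0<* 0<κ (0<⁻¹ 0<D))
    δ = proj₁ choice
    0<δ = proj₁ (proj₂ choice)
    Dδ≤κ : D * δ ≤ κ
    Dδ≤κ = begin
      D * δ            ≤⟨ *-monoˡ-≤ D (proj₁ 0<D) (proj₂ (proj₂ (proj₂ choice))) ⟩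
      D * (κ * D ⁻¹)   ≈⟨ solve 3 (λ D κ i → D :* (κ :* i) := κ :* (D :* i)) refl D κ (D ⁻¹) ⟩
      κ * (D * D ⁻¹)   ≈⟨ trans (*-congˡ (⁻¹-inverseʳ D (>⇒≉0 0<D))) (*-identityʳ κ) ⟩
      κ                ∎
    construct : ∀ {n} (G : Graph n) w → (∀ v → 0# ≤ w v) → 0# < sum w →
      (∀ v → w v ≤ δ * sum w) → HasLargeDegrees r κ G w → CompletePartite G w (suc s) t⁺
    construct {n} G w 0≤w 0<W w≤δW degrees = finish (select t⁺ w′ 0≤δW 0≤w′ w′≤δW)
      where
      W = sum w
      0≤δW = proj₁ 0<δ ⊗ proj₁ 0<W
      Φ : CompletePartite G w s T
      Φ = proj₂ (proj₂ IH) G w 0≤w 0<W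
        (λ v → ≤-trans (w≤δW v) (*-monoʳ-≤ W (proj₁ 0<W) (proj₁ (proj₂ (proj₂ choice))))) degrees
      φ = proj₁ Φ
      open GoodVertices r s T t⁺ s≤r 1≤r κ 0≤κ κ≤1 (s≤s z≤n) 2rt≤κT G w 0≤w degrees φ
        (proj₁ (proj₂ (proj₂ Φ))) using (good; good⇒Meets; good-heavy)
      us : Fin k → Fin n
      us x = φ (proj₁ (Fin.remQuot {s} T x)) (proj₂ (Fin.remQuot {s} T x))
      us-combine : ∀ a i → us (Fin.combine a i) ≡ φ a i
      us-combine a i = ≡.cong (λ x → φ (proj₁ x) (proj₂ x)) (Fin.remQuot-combine {s} a i)
      homogeneous = homogenize G k us (restrict good w) (0≤restrict good 0≤w)
      w′ = proj₁ homogeneous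
      0≤w′ = proj₁ (proj₂ homogeneous)
      w′≤good = proj₁ (proj₂ (proj₂ homogeneous))
      w′≤w : ∀ v → w′ v ≤ w v
      w′≤w v = ≤-trans (w′≤good v) (restrict≤ good 0≤w v)
      w′≤δW : ∀ v → w′ v ≤ δ * W
      w′≤δW v = ≤-trans (w′≤w v) (w≤δW v)
      same-adjacency : ∀ {u v} → 0# < w′ u → 0# < w′ v → ∀ a i → adj G u (φ a i) ≡ adj G v (φ a i)
      same-adjacency {u} {v} 0<u 0<v a i = ≡.subst (λ x → adj G u x ≡ adj G v x) (us-combine a i)
        (proj₂ (proj₂ (proj₂ (proj₂ homogeneous))) (Fin.combine a i) u v 0<u 0<v)
      finish : DistinctInSupport t⁺ w′ ⊎ sum w′ ≤ fromℕ t⁺ * (δ * W) → CompletePartite G w (suc s) t⁺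
      finish (inj₁ (h , h-inj , h-support)) =
        -- The neighbours in each old part are chosen for `h zero` alone; equal adjacency makes them
        -- neighbours of every `h j`.
        extendPartite G w s T t Φ h h-inj (λ i → <-≤-trans (h-support i) (w′≤w (h i))) λ a →
          let g , g-inj , g-adj = good⇒Meets v₀-good a in
          g , g-inj , λ i j → ≡.trans (same-adjacency (h-support j) (h-support zero) a (g i)) (g-adj i)
        where
        v₀-good : good (h zero) ≡ true
        v₀-good = restrict-support good {w} (<-≤-trans (h-support zero) (w′≤good (h zero)))
      finish (inj₂ W′≤tδW) = ⊥-elim (<⇒≱ (0<* (0<* (0<* 0<two (0<^ k 0<two)) 0<δ) 0<W) (≤-by
        (x≤y⇒0≤y-x good-heavy
          ⊕ proj₁ 0<two ⊗ x≤y⇒0≤y-x (proj₁ (proj₂ (proj₂ (proj₂ homogeneous))))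
          ⊕ proj₁ 0<two ⊗ 0≤^ k (proj₁ 0<two) ⊗ x≤y⇒0≤y-x W′≤tδW
          ⊕ x≤y⇒0≤y-x Dδ≤κ ⊗ proj₁ 0<W)
        (solve 7 (λ P t δ κ W g W′ → :0 := :2 :* P :* δ :* W :+
            ((:2 :* g :- κ :* W) :+ :2 :* (P :* W′ :- g) :+ :2 :* P :* (t :* (δ :* W) :- W′)
             :+ (κ :- :2 :* P :* (:1 :+ t) :* δ) :* W))
          refl (two ^ k) (fromℕ t⁺) δ κ W (sum (restrict good w)) (sum w′))))

  -- Zeroing weights so as to maximise r · energy - c (Σ w)² leaves only
  -- vertices of large degree.
  module Optimisation {n : ℕ} (r : ℕ) (G : Graph n) (c : Carrier) (0≤c : 0# ≤ c)
    (w : Vector Carrier n) (0≤w : ∀ v → 0# ≤ w v) where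

    excess : Vector Carrier n → Carrier
    excess x = fromℕ r * energy G x - c * (sum x * sum x)

    degree-cong : ∀ {x y} → (∀ i → x i ≈ y i) → ∀ v → degree G x v ≈ degree G y v
    degree-cong x≈y v = sum-cong λ j → *-congˡ (x≈y j)

    energy-cong : ∀ {x y} → (∀ i → x i ≈ y i) → energy G x ≈ energy G y
    energy-cong x≈y = sum-cong λ i → *-cong (x≈y i) (degree-cong x≈y i)

    excess-cong : ∀ {x y} → (∀ i → x i ≈ y i) → excess x ≈ excess y
    excess-cong x≈y = +-cong (*-congˡ (energy-cong x≈y))
      (-‿cong (*-congˡ (*-cong (sum-cong x≈y) (sum-cong x≈y))))

    restrict-cong : ∀ {S T} → (∀ i → S i ≡ T i) → ∀ i → restrict S w i ≈ restrict T w i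
    restrict-cong S≡T i = *-congʳ (reflexive (≡.cong indicator (S≡T i)))

    optimal : ∃ λ S → ∀ T → excess (restrict T w) ≤ excess (restrict S w)
    optimal = Vector-maximum n ≡.refl Bool-maximum (λ S → excess (restrict S w))
      (λ S≡T → excess-cong (restrict-cong S≡T))

    S = proj₁ optimal
    x = restrict S w

    0≤x : ∀ v → 0# ≤ x v
    0≤x = 0≤restrict S 0≤w

    excess-w≤excess-x : excess w ≤ excess x
    excess-w≤excess-x = ≤-trans
      (≤-reflexive (excess-cong λ i → sym (*-identityˡ (w i)))) (proj₂ optimal (λ _ → true))

    module Remove (v : Fin n) where
      T : Fin n → Bool
      T j = S j Bool.∧ Bool.not (does (j Fin.≟ v))

      e : Vector Carrier n
      e j = indicator (does (j Fin.≟ v))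

      y = restrict T w

      y≈ : ∀ j → y j ≈ x j - e j * x j
      y≈ j with S j | does (j Fin.≟ v)
      ... | true  | true  = solve 1 (λ w → :0 :* w := :1 :* w :- :1 :* (:1 :* w)) refl (w j)
      ... | true  | false = solve 1 (λ w → :1 :* w := :1 :* w :- :0 :* (:1 :* w)) refl (w j)
      ... | false | true  = solve 1 (λ w → :0 :* w := :0 :* w :- :1 :* (:0 :* w)) refl (w j)
      ... | false | false = solve 1 (λ w → :0 :* w := :0 :* w :- :0 :* (:0 :* w)) refl (w j)

      sum-removed : ∀ (f : Vector Carrier n) → sum (λ j → f j * y j) ≈ sum (λ j → f j * x j) - f v * x v
      sum-removed f = begin
        sum (λ j → f j * y j)
          ≈⟨ solve 2 (λ a b → a := (a :+ b) :- b) refl _ (sum (λ j → e j * (f j * x j))) ⟩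
        (sum (λ j → f j * y j) + sum (λ j → e j * (f j * x j))) - sum (λ j → e j * (f j * x j))
          ≈⟨ +-cong (sym (sum-+ (λ j → f j * y j) (λ j → e j * (f j * x j)))) (-‿cong (sum-point v (λ j → f j * x j))) ⟩
        sum (λ j → f j * y j + e j * (f j * x j)) - f v * x v
          ≈⟨ +-congʳ (sum-cong λ j → trans (+-congʳ (*-congˡ (y≈ j)))
               (solve 3 (λ f e x → f :* (x :- e :* x) :+ e :* (f :* x) := f :* x) refl (f j) (e j) (x j))) ⟩
        sum (λ j → f j * x j) - f v * x v ∎
        where open ≈-Reasoning

      sum-y : sum y ≈ sum x - x v
      sum-y = begin
        sum y                            ≈⟨ sum-cong (λ j → sym (*-identityˡ (y j))) ⟩
        sum (λ j → 1# * y j)             ≈⟨ sum-removed (λ _ → 1#) ⟩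
        sum (λ j → 1# * x j) - 1# * x v  ≈⟨ +-cong (sum-cong (λ j → *-identityˡ (x j))) (-‿cong (*-identityˡ (x v))) ⟩
        sum x - x v                      ∎
        where open ≈-Reasoning

      -- Deleting v removes its row and its column; the diagonal entry they share vanishes by
      -- `adj-irr`.
      energy-y : energy G y ≈ energy G x - two * (x v * degree G x v)
      energy-y = begin
        sum (λ i → y i * degree G y i)
          ≈⟨ sum-cong (λ i → trans (*-comm _ _) (*-congʳ (sum-removed (λ j → indicator (adj G i j))))) ⟩
        sum (λ i → (degree G x i - indicator (adj G i v) * x v) * y i)
          ≈⟨ sum-removed (λ i → degree G x i - indicator (adj G i v) * x v) ⟩
        sum (λ i → (degree G x i - indicator (adj G i v) * x v) * x i) - (degree G x v - indicator (adj G v v) * x v) * x v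
          ≈⟨ +-cong (sum-cong (λ i → trans (solve 4 (λ d a xv xi → (d :- a :* xv) :* xi := xi :* d :+ (:- xv) :* (a :* xi)) refl _ _ _ _)
                 (+-congˡ (*-congˡ (*-congʳ (reflexive (≡.cong indicator (adj-sym G i v))))))))
               (-‿cong (*-congʳ (+-congˡ (-‿cong (*-congʳ (reflexive (≡.cong indicator (adj-irr G v)))))))) ⟩
        sum (λ i → x i * degree G x i + (- x v) * (indicator (adj G v i) * x i)) - (degree G x v - 0# * x v) * x v
          ≈⟨ +-congʳ (trans (sum-+ (λ i → x i * degree G x i) (λ i → (- x v) * (indicator (adj G v i) * x i)))
               (+-congˡ (sum-*ˡ (- x v) (λ i → indicator (adj G v i) * x i)))) ⟩
        (energy G x + (- x v) * degree G x v) - (degree G x v - 0# * x v) * x v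
          ≈⟨ solve 3 (λ E xv d → (E :+ (:- xv) :* d) :- (d :- :0 :* xv) :* xv := E :- :2 :* (xv :* d)) refl (energy G x) (x v) (degree G x v) ⟩
        energy G x - two * (x v * degree G x v) ∎
        where open ≈-Reasoning

      -- With X the total weight and d the degree of v, optimality against deleting v reads 2 r d
      -- x(v) ≥ c (2 X x(v) - x(v)²). Division by 2 x(v) yields r d ≥ c (X - x(v) / 2).
      large-degree : 0# < x v → c * (sum x - x v) ≤ fromℕ r * degree G x v
      large-degree 0<xv = *-cancelˡ-≤ (two * x v) (0<* 0<two 0<xv) (≤-by
        (x≤y⇒0≤y-x (proj₂ optimal T) ⊕ 0≤c ⊗ (0≤x v ⊗ 0≤x v))
        (begin
          two * x v * (fromℕ r * degree G x v)
            ≈⟨ solve 6 (λ xv r d c W E → :2 :* xv :* (r :* d) := :2 :* xv :* (c :* (W :- xv)) :+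
                 (((r :* E :- c :* (W :* W)) :- (r :* (E :- :2 :* (xv :* d)) :- c :* ((W :- xv) :* (W :- xv)))) :+ c :* (xv :* xv)))
                 refl (x v) (fromℕ r) (degree G x v) c (sum x) (energy G x) ⟩
          two * x v * (c * (sum x - x v)) + ((excess x - (fromℕ r * (energy G x - two * (x v * degree G x v)) - c * ((sum x - x v) * (sum x - x v)))) + c * (x v * x v))
            ≈⟨ +-congˡ (+-congʳ (+-congˡ (-‿cong (+-cong (*-congˡ energy-y) (-‿cong (*-congˡ (*-cong sum-y sum-y))))))) ⟨
          two * x v * (c * (sum x - x v)) + ((excess x - excess y) + c * (x v * x v)) ∎))
        where open ≈-Reasoning

  -- The surplus 4 κ is spent in stages. Maximising with surplus 2 κ in `c` leaves an excess of 2 κ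
  -- L², which keeps the surviving weight X above 2 κ L / r. The degrees then have surplus 2 κ
  -- relative to X minus one vertex weight; lowering it to κ absorbs that weight.
  weighted-Erdős-Stone : ∀ r → 1 ℕ.≤ r → ∀ κ → 0# < κ → κ ≤ 1# → ∀ t →
    ∃ λ δ → 0# < δ × (∀ {n} (G : Graph n) w L → (∀ v → 0# ≤ w v) → 0# < L → sum w ≤ L →
      (∀ v → w v ≤ δ * L) →
      (fromℕ r - 1# + (two * κ + two * κ)) * (L * L) ≤ fromℕ r * energy G w →
      Σ (Fin (suc r) → Fin t → Fin n) λ φ →
        (∀ a → Injective _≡_ _≡_ (φ a)) × (∀ a b i j → a ≢ b → Adj G (φ a i) (φ b j)))
  weighted-Erdős-Stone r 1≤r κ 0<κ κ≤1 t = δ , 0<δ , construct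
    where
    open ≤-Reasoning
    0≤κ = proj₁ 0<κ
    R   = fromℕ r
    0<R = 0<fromℕ 1≤r
    0≤R = proj₁ 0<R
    base = completePartite r 1≤r κ 0<κ κ≤1 (suc r) ℕ.≤-refl t
    δ₀ = proj₁ base
    0<δ₀ = proj₁ (proj₂ base)
    R⁺ = 1# + R
    0<R⁺ = 0<1+ 0≤R
    -- The first bound keeps weights below δ₀ X, the second keeps R + 1 times a weight below κ X,
    -- even if X is only 2 κ L / R.
    choice = minimum (0<* 0<δ₀ 0<κ) (0<* 0<κ 0<κ)
    μ = proj₁ choice
    0<μ = proj₁ (proj₂ choice)
    RR⁺ = R * R⁺
    δ = μ * RR⁺ ⁻¹
    0<δ = 0<* 0<μ (0<⁻¹ (0<* 0<R 0<R⁺))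
    RR⁺δ≈μ : RR⁺ * δ ≈ μ
    RR⁺δ≈μ = trans (solve 3 (λ A μ i → A :* (μ :* i) := μ :* (A :* i)) refl RR⁺ μ (RR⁺ ⁻¹))
      (trans (*-congˡ (⁻¹-inverseʳ RR⁺ (>⇒≉0 (0<* 0<R 0<R⁺)))) (*-identityʳ μ))
    RR⁺δ≤δ₀κ : RR⁺ * δ ≤ δ₀ * κ
    RR⁺δ≤δ₀κ = ≤-trans (≤-reflexive RR⁺δ≈μ) (proj₁ (proj₂ (proj₂ choice)))
    RR⁺δ≤κ² : RR⁺ * δ ≤ κ * κ
    RR⁺δ≤κ² = ≤-trans (≤-reflexive RR⁺δ≈μ) (proj₂ (proj₂ (proj₂ choice)))
    c = R - 1# + two * κ
    0≤c : 0# ≤ c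
    0≤c = x≤y⇒0≤y-x (1≤fromℕ 1≤r) ⊕ proj₁ 0<two ⊗ 0≤κ
    construct : ∀ {n} (G : Graph n) w L → (∀ v → 0# ≤ w v) → 0# < L → sum w ≤ L → (∀ v → w v ≤ δ * L) →
      (R - 1# + (two * κ + two * κ)) * (L * L) ≤ R * energy G w →
      Σ (Fin (suc r) → Fin t → Fin n) λ φ →
        (∀ a → Injective _≡_ _≡_ (φ a)) × (∀ a b i j → a ≢ b → Adj G (φ a i) (φ b j))
    construct G w L 0≤w 0<L W≤L w≤δL dense =
      let φ , φ-inj , _ , φ-adj = proj₂ (proj₂ base) G x 0≤x 0<X x≤δ₀X degrees in φ , φ-inj , φ-adj
      where
      open Optimisation r G c 0≤c w 0≤w
      X = sum x
      0≤X = 0≤sum 0≤x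
      0≤L = proj₁ 0<L
      x≤δL : ∀ v → x v ≤ δ * L
      x≤δL v = ≤-trans (restrict≤ S 0≤w v) (w≤δL v)
      X≤L : X ≤ L
      X≤L = ≤-trans (sum-mono-≤ (restrict≤ S 0≤w)) W≤L
      2κL²≤excess : two * κ * (L * L) ≤ excess x
      2κL²≤excess = ≤-trans (≤-by
        (x≤y⇒0≤y-x dense ⊕ 0≤c ⊗ x≤y⇒0≤y-x (*-mono-≤ (0≤sum 0≤w) (0≤sum 0≤w) W≤L W≤L))
        (solve 5 (λ R κ L E W → R :* E :- (R :- :1 :+ :2 :* κ) :* (W :* W) := :2 :* κ :* (L :* L) :+
          ((R :* E :- (R :- :1 :+ (:2 :* κ :+ :2 :* κ)) :* (L :* L))
           :+ (R :- :1 :+ :2 :* κ) :* (L :* L :- W :* W))) refl R κ L (energy G w) (sum w)))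
        excess-w≤excess-x
      -- The excess is at most R X² ≤ R X L, and one factor L cancels.
      2κL≤RX : two * κ * L ≤ R * X
      2κL≤RX = *-cancelʳ-≤ L 0<L (≤-by
        (x≤y⇒0≤y-x 2κL²≤excess ⊕ 0≤c ⊗ (0≤X ⊗ 0≤X) ⊕ 0≤R ⊗ x≤y⇒0≤y-x (energy≤sum² G 0≤x)
          ⊕ 0≤R ⊗ 0≤X ⊗ x≤y⇒0≤y-x X≤L)
        (solve 6 (λ R κ L E X c → R :* X :* L := :2 :* κ :* L :* L :+
          (((R :* E :- c :* (X :* X)) :- :2 :* κ :* (L :* L)) :+ c :* (X :* X)
           :+ R :* (X :* X :- E) :+ R :* X :* (L :- X))) refl R κ L (energy G x) X c))
      0<X : 0# < X
      0<X = 0≤X , λ 0≈X → <⇒≱ (0<* (0<* 0<two 0<κ) 0<L)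
        (≤-trans 2κL≤RX (≤-reflexive (trans (*-congˡ (sym 0≈X)) (zeroʳ R))))
      -- Both bounds follow from L ≤ R X / (2 κ).
      bound : ∀ v {β} → 0# ≤ β → RR⁺ * δ ≤ β * κ → R⁺ * x v ≤ β * X
      bound v {β} 0≤β RR⁺δ≤βκ = *-cancelˡ-≤ (two * κ) (0<* 0<two 0<κ) (≤-by
        (proj₁ 0<two ⊗ 0≤κ ⊗ (proj₁ 0<R⁺ ⊗ x≤y⇒0≤y-x (x≤δL v))
          ⊕ proj₁ 0<R⁺ ⊗ proj₁ 0<δ ⊗ x≤y⇒0≤y-x 2κL≤RX
          ⊕ x≤y⇒0≤y-x RR⁺δ≤βκ ⊗ 0≤X
          ⊕ 0≤β ⊗ 0≤κ ⊗ 0≤X)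
        (solve 8 (λ κ β X R xv δ L R⁺ → :2 :* κ :* (β :* X) := :2 :* κ :* (R⁺ :* xv) :+
          (:2 :* κ :* (R⁺ :* (δ :* L :- xv)) :+ R⁺ :* δ :* (R :* X :- :2 :* κ :* L)
           :+ (β :* κ :- R :* R⁺ :* δ) :* X :+ β :* κ :* X)) refl κ β X R (x v) δ L R⁺))
      x≤δ₀X : ∀ v → x v ≤ δ₀ * X
      x≤δ₀X v = ≤-trans (≤-by (0≤R ⊗ 0≤x v) (solve 2 (λ R x → (:1 :+ R) :* x := x :+ R :* x) refl R (x v)))
        (bound v (proj₁ 0<δ₀) RR⁺δ≤δ₀κ)
      degrees : HasLargeDegrees r κ G x
      degrees v 0<xv = ≤-trans (≤-by
        (x≤y⇒0≤y-x (bound v 0≤κ RR⁺δ≤κ²) ⊕ proj₁ 0<two ⊗ x≤y⇒0≤y-x κ≤1 ⊗ 0≤x v)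
        (solve 4 (λ R κ X xv → (R :- :1 :+ :2 :* κ) :* (X :- xv) := (R :- :1 :+ κ) :* X :+
          ((κ :* X :- (:1 :+ R) :* xv) :+ :2 :* (:1 :- κ) :* xv)) refl R κ X (x v)))
        (Remove.large-degree v 0<xv)

-- Cluster points in the unit cube

module Compactness (em : ExcludedMiddle 0ℓ) (ℝ : CompleteOrderedField) where
  open CompleteOrderedField ℝ hiding (zero)
  open OrderedField em ℝ
  open RealPowers em ℝ using (supremum-approximation)

  -- The first coordinate of the cluster point is the largest t such that
  -- every F ε has a point with first coordinate at least t.
  clusterPoint : ∀ n {A : Set} (coord : A → Vector Carrier n) (F : Carrier → Pred A 0ℓ) →
    (∀ {ε ε′ a} → ε ≤ ε′ → F ε a → F ε′ a) →
    (∀ ε → 0# < ε → ∃ (F ε)) →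
    (∀ {ε a} → F ε a → ∀ i → 0# ≤ coord a i × coord a i ≤ 1#) →
    ∃ λ (c : Vector Carrier n) → ∀ ε → 0# < ε →
      ∃ λ a → F ε a × (∀ i → c i ≤ coord a i + ε × coord a i ≤ c i + ε)
  clusterPoint zero coord F mono nonempty inBox =
    (λ ()) , λ ε 0<ε → let a , a∈ = nonempty ε 0<ε in a , a∈ , λ ()
  clusterPoint (suc n) {A} coord F mono nonempty inBox = c , near-c
    where
    head : A → Carrier
    head a = coord a zero
    Reached : Pred Carrier 0ℓ
    Reached t = ∀ ε → 0# < ε → ∃ λ a → F ε a × t ≤ head a
    supremum = complete Reached
      (0# , λ ε 0<ε → let a , a∈ = nonempty ε 0<ε in a , a∈ , proj₁ (inBox a∈ zero))
      (1# , λ t reached → let a , a∈ , t≤a = reached 1# 0<1 in ≤-trans t≤a (proj₂ (inBox a∈ zero)))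
    c₀ = proj₁ supremum
    F′ : Carrier → Pred A 0ℓ
    F′ ε a = F ε a × (c₀ ≤ head a + ε × head a ≤ c₀ + ε)
    mono′ : ∀ {ε ε′ a} → ε ≤ ε′ → F′ ε a → F′ ε′ a
    mono′ ε≤ε′ (a∈ , l , u) = mono ε≤ε′ a∈ ,
      ≤-trans l (+-mono-≤ ≤-refl ε≤ε′) , ≤-trans u (+-mono-≤ ≤-refl ε≤ε′)
    nonempty′ : ∀ ε → 0# < ε → ∃ (F′ ε)
    nonempty′ ε 0<ε =
      let t , reached , c₀≤t+ε = supremum-approximation (proj₂ supremum) 0<ε
          ε₀ , 0<ε₀ , excluded = unreached
          ε′ , 0<ε′ , ε′≤ε , ε′≤ε₀ = minimum 0<ε 0<ε₀
          a , a∈ , t≤a = reached ε′ 0<ε′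
      in a , mono ε′≤ε a∈ , ≤-trans c₀≤t+ε (+-monoˡ-≤ ε t≤a) ,
         proj₁ (≰⇒> (excluded a (mono ε′≤ε₀ a∈)))
      where
      -- As c₀ + ε exceeds the supremum, some ε₀ admits no point with so large a first coordinate;
      -- monotonicity passes this on to smaller parameters.
      unreached : ∃ λ ε₀ → 0# < ε₀ × (∀ a → F ε₀ a → ¬ (c₀ + ε ≤ head a))
      unreached with em {∃ λ ε₀ → 0# < ε₀ × (∀ a → F ε₀ a → ¬ (c₀ + ε ≤ head a))}
      ... | yes q = q
      ... | no ¬q = ⊥-elim (<⇒≱ 0<ε (≤-by (x≤y⇒0≤y-x (proj₁ (proj₂ supremum) (c₀ + ε) reached))
              (solve 2 (λ c ε → :0 := ε :+ (c :- (c :+ ε))) refl c₀ ε)))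
        where
        reached : Reached (c₀ + ε)
        reached ε₀ 0<ε₀ with em {∃ λ a → F ε₀ a × c₀ + ε ≤ head a}
        ... | yes q = q
        ... | no ¬r = ⊥-elim (¬q (ε₀ , 0<ε₀ , λ a a∈ c₀+ε≤a → ¬r (a , a∈ , c₀+ε≤a)))
    -- The recursion drops a coordinate but keeps the points in `A`, and `F′` remembers closeness in
    -- the dropped one, so a single point is close in all coordinates.
    rest = clusterPoint n (λ a → coord a ∘ suc) F′ mono′ nonempty′ (λ a∈ i → inBox (proj₁ a∈) (suc i))
    c : Vector Carrier (suc n)
    c zero    = c₀
    c (suc i) = proj₁ rest i
    near-c : ∀ ε → 0# < ε → ∃ λ a → F ε a × (∀ i → c i ≤ coord a i + ε × coord a i ≤ c i + ε)
    near-c ε 0<ε = let a , (a∈ , near₀) , near = proj₂ rest ε 0<ε in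
      a , a∈ , λ { zero → near₀ ; (suc i) → near i }

-- Existence of maximising vectors and extremal graphs

module SpectralRadius (em : ExcludedMiddle 0ℓ) (ℝ : CompleteOrderedField)
  (p : CompleteOrderedField.Carrier ℝ)
  (1<p : CompleteOrderedField._<_ ℝ (CompleteOrderedField.1# ℝ) p) where
  open CompleteOrderedField ℝ hiding (zero)
  open Classical em ℝ
  open OrderedField em ℝ
  open RealPowers em ℝ
  open PowersAboveOne em ℝ p 1<p
  open FiniteSums em ℝ
  open WeightedErdősStone em ℝ
  open Compactness em ℝ

  max-isMaximum : ∀ {S} → ∃ (IsMaximum S) → IsMaximum S (max S)
  max-isMaximum {S} has with em {∃ (IsMaximum S)}
  ... | yes s  = proj₂ s
  ... | no ¬s = ⊥-elim (¬s has)

  -- The upper triangular sum plus its transpose covers each ordered pair of distinct vertices once;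
  -- the diagonal contributes nothing by `adj-irr`.
  2edgeSum≈energy : ∀ {n} (G : Graph n) x → fromℕ 2 * edgeSum G x ≈ energy G x
  2edgeSum≈energy {n} G x = begin
    fromℕ 2 * edgeSum G x                              ≈⟨ solve 1 (λ s → (:1 :+ (:1 :+ :0)) :* s := s :+ s) refl (edgeSum G x) ⟩
    edgeSum G x + edgeSum G x                          ≈⟨ +-congˡ (sum-swap U) ⟩
    sum (λ i → sum (U i)) + sum (λ i → sum λ j → U j i) ≈⟨ sum-+ (λ i → sum (U i)) (λ i → sum λ j → U j i) ⟨
    sum (λ i → sum (U i) + sum (λ j → U j i))          ≈⟨ sum-cong (λ i → sym (sum-+ (U i) (λ j → U j i))) ⟩
    sum (λ i → sum λ j → U i j + U j i)                ≈⟨ sum-cong (λ i → sum-cong λ j → sym (pointwise i j)) ⟩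
    sum (λ i → sum λ j → x i * (indicator (adj G i j) * x j))
      ≈⟨ sum-cong (λ i → sum-*ˡ (x i) (λ j → indicator (adj G i j) * x j)) ⟩
    energy G x ∎
    where
    open ≈-Reasoning
    U : Fin n → Fin n → Carrier
    U i j = if does (toℕ i ℕ.<? toℕ j) Bool.∧ adj G i j then x i * x j else 0#
    Exclusive : Bool → Bool → Bool → Set
    Exclusive b c a = (b ≡ true × c ≡ false) ⊎ (b ≡ false × c ≡ true) ⊎ a ≡ false
    combine : ∀ y z b c a → Exclusive b c a →
      y * (indicator a * z) ≈ (if b Bool.∧ a then y * z else 0#) + (if c Bool.∧ a then z * y else 0#)
    combine y z _ _ true (inj₁ (≡.refl , ≡.refl)) = solve 2 (λ y z → y :* (:1 :* z) := y :* z :+ :0) refl y z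
    combine y z _ _ true (inj₂ (inj₁ (≡.refl , ≡.refl))) = solve 2 (λ y z → y :* (:1 :* z) := :0 :+ z :* y) refl y z
    combine y z true true false _ = solve 2 (λ y z → y :* (:0 :* z) := :0 :+ :0) refl y z
    combine y z true false false _ = solve 2 (λ y z → y :* (:0 :* z) := :0 :+ :0) refl y z
    combine y z false true false _ = solve 2 (λ y z → y :* (:0 :* z) := :0 :+ :0) refl y z
    combine y z false false false _ = solve 2 (λ y z → y :* (:0 :* z) := :0 :+ :0) refl y z
    exclusive : ∀ i j → Exclusive (does (toℕ i ℕ.<? toℕ j)) (does (toℕ j ℕ.<? toℕ i)) (adj G i j)
    exclusive i j with ℕ.<-cmp (toℕ i) (toℕ j)
    ... | tri< i<j _ j≮i = inj₁ (dec-true (toℕ i ℕ.<? toℕ j) i<j , dec-false (toℕ j ℕ.<? toℕ i) j≮i)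
    ... | tri> i≮j _ j<i = inj₂ (inj₁ (dec-false (toℕ i ℕ.<? toℕ j) i≮j , dec-true (toℕ j ℕ.<? toℕ i) j<i))
    ... | tri≈ _ i≡j _ = inj₂ (inj₂ (≡.trans (≡.cong (adj G i) (≡.sym (Fin.toℕ-injective i≡j))) (adj-irr G i)))
    pointwise : ∀ i j → x i * (indicator (adj G i j) * x j) ≈ U i j + U j i
    pointwise i j = trans
      (combine (x i) (x j) (does (toℕ i ℕ.<? toℕ j)) (does (toℕ j ℕ.<? toℕ i)) (adj G i j) (exclusive i j))
      (+-congˡ (reflexive (≡.cong (λ a → if does (toℕ j ℕ.<? toℕ i) Bool.∧ a then x j * x i else 0#) (adj-sym G i j))))

  energy≤energy-∣∣ : ∀ {n} (G : Graph n) x → energy G x ≤ energy G (λ i → ∣ x i ∣)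
  energy≤energy-∣∣ G x = ≤-trans (≤-reflexive (sum-cong λ i → sym (expand x i)))
    (≤-trans (sum-mono-≤ λ i → sum-mono-≤ λ j → term i j)
      (≤-reflexive (sum-cong λ i → expand (λ i → ∣ x i ∣) i)))
    where
    expand : ∀ y i → sum (λ j → indicator (adj G i j) * (y i * y j)) ≈ y i * degree G y i
    expand y i = trans (sum-cong λ j → solve 3 (λ a b c → a :* (b :* c) := b :* (a :* c)) refl (indicator (adj G i j)) (y i) (y j))
      (sum-*ˡ (y i) (λ j → indicator (adj G i j) * y j))
    term : ∀ i j → indicator (adj G i j) * (x i * x j) ≤ indicator (adj G i j) * (∣ x i ∣ * ∣ x j ∣)
    term i j = *-monoˡ-≤ _ (0≤indicator (adj G i j)) (xy≤∣x∣∣y∣ (x i) (x j))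

  Feasible : ∀ {n} → Vector Carrier n → Set
  Feasible x = (∀ i → 0# ≤ x i) × sum (λ i → x i ^ᴿ p) ≈ 1#

  feasible≤1 : ∀ {n} {x : Vector Carrier n} → Feasible x → ∀ i → x i ≤ 1#
  feasible≤1 {x = x} (0≤x , norm≈1) i = ^ᴿ≤1⇒≤1 (0≤x i)
    (≤-trans (term≤sum (λ j → 0≤^ᴿ (0≤x j) 0≤p) i) (≤-reflexive norm≈1))

  feasible-energy≤ : ∀ {n} (G : Graph n) {x} → Feasible x → energy G x ≤ fromℕ n * fromℕ n
  feasible-energy≤ {n} G {x} feasible@(0≤x , _) = ≤-trans (energy≤sum² G 0≤x)
    (*-mono-≤ (0≤sum 0≤x) (0≤sum 0≤x) X≤n X≤n)
    where
    X≤n : sum x ≤ fromℕ n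
    X≤n = ≤-trans (sum-mono-≤ (feasible≤1 feasible)) (≤-reflexive (trans (sum-const n 1#) (*-identityʳ _)))

  unit-feasible : ∀ {n} (v : Fin n) → Feasible (λ i → indicator (does (i Fin.≟ v)))
  unit-feasible v = (λ i → 0≤indicator (does (i Fin.≟ v))) ,
    trans (sum-cong λ i → power (does (i Fin.≟ v))) (sum-point v (λ _ → 1#))
    where
    power : ∀ b → indicator b ^ᴿ p ≈ indicator b * 1#
    power true  = trans 1^ᴿ≈1 (sym (*-identityʳ 1#))
    power false = trans (0^ᴿ≈0 refl) (sym (zeroˡ 1#))

  -- Serves to bound the energy of the cluster point c from below by that of near-maximisers x close
  -- to it.
  energy-upper-semicontinuous : ∀ {n} (G : Graph n) {x c : Vector Carrier n} {ε} →
    (∀ i → 0# ≤ x i) → (∀ i → 0# ≤ c i) → (∀ i → c i ≤ 1#) → 0# ≤ ε → ε ≤ 1# →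
    (∀ i → x i ≤ c i + ε) → energy G x ≤ energy G c + fromℕ n * (fromℕ 3 * fromℕ n) * ε
  energy-upper-semicontinuous {n} G {x} {c} {ε} 0≤x 0≤c c≤1 0≤ε ε≤1 x≤c+ε = begin
    energy G x                                             ≤⟨ sum-mono-≤ term ⟩
    sum (λ i → c i * degree G c i + fromℕ 3 * fromℕ n * ε) ≈⟨ sum-+ (λ i → c i * degree G c i) (λ _ → fromℕ 3 * fromℕ n * ε) ⟩
    energy G c + sum {n} (λ i → fromℕ 3 * fromℕ n * ε)     ≈⟨ +-congˡ (trans (sum-const n _) (sym (*-assoc _ _ _))) ⟩
    energy G c + fromℕ n * (fromℕ 3 * fromℕ n) * ε         ∎
    where
    open ≤-Reasoning
    N = fromℕ n
    degree≤N : ∀ i → degree G c i ≤ N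
    degree≤N i = ≤-trans (degree≤sum G 0≤c i)
      (≤-trans (sum-mono-≤ c≤1) (≤-reflexive (trans (sum-const n 1#) (*-identityʳ _))))
    0≤degree : ∀ {y : Vector Carrier n} → (∀ i → 0# ≤ y i) → ∀ i → 0# ≤ degree G y i
    0≤degree 0≤y i = 0≤sum λ j → 0≤indicator (adj G i j) ⊗ 0≤y j
    degree-x≤ : ∀ i → degree G x i ≤ degree G c i + N * ε
    degree-x≤ i = begin
      degree G x i                                          ≤⟨ sum-mono-≤ (λ j → summand (adj G i j) (x≤c+ε j)) ⟩
      sum (λ j → indicator (adj G i j) * c j + ε)           ≈⟨ sum-+ (λ j → indicator (adj G i j) * c j) (λ _ → ε) ⟩
      degree G c i + sum {n} (λ _ → ε)                      ≈⟨ +-congˡ (sum-const n ε) ⟩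
      degree G c i + N * ε                                  ∎
      where
      summand : ∀ b {y d} → y ≤ d + ε → indicator b * y ≤ indicator b * d + ε
      summand true {y} {d} y≤d+ε = ≤-trans (≤-reflexive (*-identityˡ y)) (≤-trans y≤d+ε (≤-reflexive (+-congʳ (sym (*-identityˡ d)))))
      summand false {y} {d} _ = ≤-by 0≤ε (solve 3 (λ y d ε → :0 :* d :+ ε := :0 :* y :+ ε) refl y d ε)
    term : ∀ i → x i * degree G x i ≤ c i * degree G c i + fromℕ 3 * N * ε
    term i = begin
      x i * degree G x i                   ≤⟨ *-mono-≤ (0≤x i) (0≤degree 0≤x i) (x≤c+ε i) (degree-x≤ i) ⟩
      -- Expanding gives three extra terms, each at most N ε, because c ≤ 1, the degree is at most N
      -- and ε ≤ 1; hence the 3.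
      (c i + ε) * (degree G c i + N * ε)   ≤⟨ ≤-by
          (0≤fromℕ n ⊗ 0≤ε ⊗ x≤y⇒0≤y-x (c≤1 i) ⊕ 0≤ε ⊗ x≤y⇒0≤y-x (degree≤N i)
            ⊕ 0≤fromℕ n ⊗ 0≤ε ⊗ x≤y⇒0≤y-x ε≤1)
          (solve 4 (λ c d N ε → c :* d :+ (:1 :+ (:1 :+ (:1 :+ :0))) :* N :* ε :=
              (c :+ ε) :* (d :+ N :* ε) :+ (N :* ε :* (:1 :- c) :+ ε :* (N :- d) :+ N :* ε :* (:1 :- ε)))
            refl (c i) (degree G c i) N ε) ⟩
      c i * degree G c i + fromℕ 3 * N * ε ∎

  module Attained {n : ℕ} (G : Graph (suc n)) where
    Energies : Pred Carrier 0ℓ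
    Energies v = Σ (Vector Carrier (suc n)) λ x → Feasible x × v ≈ energy G x

    supremum : ∃ (IsSupremum Energies)
    supremum = complete Energies
      (_ , _ , unit-feasible zero , refl)
      (_ , λ { v (x , feasible , v≈) → ≤-trans (≤-reflexive v≈) (feasible-energy≤ G feasible) })

    s : Carrier
    s = proj₁ supremum

    Near : Carrier → Pred (Vector Carrier (suc n)) 0ℓ
    Near ε x = Feasible x × s ≤ energy G x + ε

    -- The cluster point inherits norm 1 from the near-maximisers by the Lipschitz bound on p-th
    -- powers, and the supremal energy by semicontinuity. In dimension 0 no vector has norm 1, which
    -- is why the graph has `suc n` vertices.
    cluster : ∃ λ (c : Vector Carrier (suc n)) → ∀ ε → 0# < ε →
      ∃ λ x → Near ε x × (∀ i → c i ≤ x i + ε × x i ≤ c i + ε)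
    cluster = clusterPoint (suc n) (λ x → x) Near
      (λ ε≤ε′ (feasible , s≤) → feasible , ≤-trans s≤ (+-mono-≤ ≤-refl ε≤ε′))
      (λ ε 0<ε → let v , (x , feasible , v≈) , s≤v+ε = supremum-approximation (proj₂ supremum) 0<ε in
        x , feasible , ≤-trans s≤v+ε (+-monoˡ-≤ ε (≤-reflexive v≈)))
      (λ (feasible , _) i → proj₁ feasible i , feasible≤1 feasible i)

    c : Vector Carrier (suc n)
    c = proj₁ cluster

    0≤c : ∀ i → 0# ≤ c i
    0≤c i = ≤-by-approximation 1# 0≤1 λ ε 0<ε →
      let x , ((feasible , _) , near) = proj₂ cluster ε 0<ε in
      ≤-trans (proj₁ feasible i) (≤-trans (proj₂ (near i)) (≤-reflexive (+-congˡ (sym (*-identityˡ ε)))))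

    c≤1 : ∀ i → c i ≤ 1#
    c≤1 i = ≤-by-approximation 1# 0≤1 λ ε 0<ε →
      let x , ((feasible , _) , near) = proj₂ cluster ε 0<ε in
      ≤-trans (proj₁ (near i)) (+-mono-≤ (feasible≤1 feasible i) (≤-reflexive (sym (*-identityˡ ε))))

    norm : Vector Carrier (suc n) → Carrier
    norm x = sum λ i → x i ^ᴿ p

    norm-lipschitz : ∀ {x y ε} → (∀ i → 0# ≤ x i) → (∀ i → x i ≤ 1#) → (∀ i → 0# ≤ y i) → 0# ≤ ε →
      (∀ i → x i ≤ y i + ε) → norm x ≤ norm y + fromℕ (suc n) * p * ε
    norm-lipschitz {x} {y} {ε} 0≤x x≤1 0≤y 0≤ε x≤y+ε = begin
      norm x                                     ≤⟨ sum-mono-≤ (λ i → ^ᴿ-lipschitz (0≤x i) (x≤1 i) (0≤y i) 0≤ε (x≤y+ε i)) ⟩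
      sum (λ i → y i ^ᴿ p + p * ε)               ≈⟨ sum-+ (λ i → y i ^ᴿ p) (λ _ → p * ε) ⟩
      norm y + sum {suc n} (λ _ → p * ε)         ≈⟨ +-congˡ (trans (sum-const (suc n) (p * ε)) (sym (*-assoc _ _ _))) ⟩
      norm y + fromℕ (suc n) * p * ε             ∎
      where open ≤-Reasoning

    c-feasible : Feasible c
    c-feasible = 0≤c , ≤-antisym
      (≤-by-approximation K 0≤K λ ε 0<ε →
        let x , ((feasible , _) , near) = proj₂ cluster ε 0<ε in
        ≤-trans (norm-lipschitz 0≤c c≤1 (proj₁ feasible) (proj₁ 0<ε) (λ i → proj₁ (near i)))
          (+-monoˡ-≤ _ (≤-reflexive (proj₂ feasible))))
      (≤-by-approximation K 0≤K λ ε 0<ε →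
        let x , ((feasible , _) , near) = proj₂ cluster ε 0<ε in
        ≤-trans (≤-reflexive (sym (proj₂ feasible)))
          (norm-lipschitz (proj₁ feasible) (feasible≤1 feasible) 0≤c (proj₁ 0<ε) (λ i → proj₂ (near i))))
      where
      K = fromℕ (suc n) * p
      0≤K = 0≤fromℕ (suc n) ⊗ 0≤p

    s≤energy-c : s ≤ energy G c
    s≤energy-c = ≤-by-small-approximation (K + 1#) (0≤K ⊕ 0≤1) λ ε 0<ε ε≤1 →
      let x , ((feasible , s≤) , near) = proj₂ cluster ε 0<ε
          open ≤-Reasoning
      in begin
        s                           ≤⟨ s≤ ⟩
        energy G x + ε              ≤⟨ +-monoˡ-≤ ε (energy-upper-semicontinuous G (proj₁ feasible) 0≤c c≤1
                                         (proj₁ 0<ε) ε≤1 (λ i → proj₂ (near i))) ⟩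
        energy G c + K * ε + ε      ≈⟨ solve 3 (λ E K ε → E :+ K :* ε :+ ε := E :+ (K :+ :1) :* ε) refl (energy G c) K ε ⟩
        energy G c + (K + 1#) * ε   ∎
      where
      K = fromℕ (suc n) * (fromℕ 3 * fromℕ (suc n))
      0≤K = 0≤fromℕ (suc n) ⊗ (0≤fromℕ 3 ⊗ 0≤fromℕ (suc n))

    energy≤energy-c : ∀ {x} → Feasible x → energy G x ≤ energy G c
    energy≤energy-c {x} feasible =
      ≤-trans (proj₁ (proj₂ supremum) _ (x , feasible , refl)) s≤energy-c

  Values : ∀ {n} → Graph n → Pred Carrier 0ℓ
  Values {n} G v = Σ (Vector Carrier n) λ x →
    sum (λ i → ∣ x i ∣ ^ᴿ p) ≈ 1# × v ≈ fromℕ 2 * edgeSum G x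

  ∣∣-feasible : ∀ {n} {x : Vector Carrier n} → sum (λ i → ∣ x i ∣ ^ᴿ p) ≈ 1# → Feasible (λ i → ∣ x i ∣)
  ∣∣-feasible {x = x} norm≈1 = (λ i → 0≤∣x∣ (x i)) , norm≈1

  feasible-∣∣ : ∀ {n} {x : Vector Carrier n} → Feasible x → sum (λ i → ∣ x i ∣ ^ᴿ p) ≈ 1#
  feasible-∣∣ (0≤x , norm≈1) = trans (sum-cong λ i → ^ᴿ-congˡ p (∣x∣≈x (0≤x i))) norm≈1

  spectralRadius-isMaximum : ∀ {n} (G : Graph (suc n)) → IsMaximum (Values G) (spectralRadius p G)
  spectralRadius-isMaximum G = max-isMaximum
    (fromℕ 2 * edgeSum G c , (c , feasible-∣∣ c-feasible , refl) , λ { v (x , norm≈1 , v≈) → begin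
      v                            ≈⟨ v≈ ⟩
      fromℕ 2 * edgeSum G x        ≈⟨ 2edgeSum≈energy G x ⟩
      energy G x                   ≤⟨ energy≤energy-∣∣ G x ⟩
      energy G (λ i → ∣ x i ∣)     ≤⟨ energy≤energy-c (∣∣-feasible {x = x} norm≈1) ⟩
      energy G c                   ≈⟨ 2edgeSum≈energy G c ⟨
      fromℕ 2 * edgeSum G c        ∎ })
    where
    open Attained G
    open ≤-Reasoning

  energy≤spectralRadius : ∀ {n} (G : Graph (suc n)) {x} → Feasible x → energy G x ≤ spectralRadius p G
  energy≤spectralRadius G {x} feasible = ≤-trans (≤-reflexive (sym (2edgeSum≈energy G x)))
    (proj₂ (spectralRadius-isMaximum G) _ (x , feasible-∣∣ feasible , refl))

  spectralRadius-attained : ∀ {n} (G : Graph (suc n)) →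
    ∃ λ x → Feasible x × spectralRadius p G ≤ energy G x
  spectralRadius-attained G =
    let x , norm≈1 , ρ≈ = proj₁ (spectralRadius-isMaximum G) in
    (λ i → ∣ x i ∣) , ∣∣-feasible {x = x} norm≈1 ,
    ≤-trans (≤-reflexive (trans ρ≈ (2edgeSum≈energy G x))) (energy≤energy-∣∣ G x)

  energy-adj-cong : ∀ {n} (G H : Graph n) (x : Vector Carrier n) →
    (∀ i j → adj G i j ≡ adj H i j) → energy G x ≈ energy H x
  energy-adj-cong G H x G≡H =
    sum-cong λ i → *-congˡ (sum-cong λ j → *-congʳ {x j} (reflexive (≡.cong indicator (G≡H i j))))

  -- Graphs with the same adjacency matrix are not known to be equal as records, so the search over
  -- matrices relies on this invariance.
  spectralRadius-mono : ∀ {n} (G H : Graph (suc n)) → (∀ i j → adj G i j ≡ adj H i j) →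
    spectralRadius p G ≤ spectralRadius p H
  spectralRadius-mono G H G≡H =
    let x , feasible , ρ≤ = spectralRadius-attained G in
    ≤-trans ρ≤ (≤-trans (≤-reflexive (energy-adj-cong G H x G≡H)) (energy≤spectralRadius H feasible))

  module Extremal {m : ℕ} (F : Graph m) {n : ℕ} (G₀ : Graph (suc n)) (G₀-free : ¬ Contains G₀ F) where

    -- The search for an extremal graph runs over Boolean matrices, to which `Vector-maximum`
    -- applies; this predicate singles out those of `F`-free graphs.
    Realises : (Fin (suc n) → Fin (suc n) → Bool) → Set
    Realises A = Σ (Graph (suc n)) λ G → ¬ Contains G F × (∀ i j → A i j ≡ adj G i j)

    -- Matrices that are not the adjacency matrix of an F-free graph get the
    -- value of G₀.
    value : ∀ {A} → Dec (Realises A) → Carrier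
    value (yes (G , _)) = spectralRadius p G
    value (no _)        = spectralRadius p G₀

    value-cong : ∀ {A B} (a : Dec (Realises A)) (b : Dec (Realises B)) →
      (∀ i j → A i j ≡ B i j) → value a ≤ value b
    value-cong (yes (G , _ , A≡G)) (yes (H , _ , B≡H)) A≡B = spectralRadius-mono G H
      λ i j → ≡.trans (≡.sym (A≡G i j)) (≡.trans (A≡B i j) (B≡H i j))
    value-cong (yes (G , free , A≡G)) (no ¬b) A≡B =
      ⊥-elim (¬b (G , free , λ i j → ≡.trans (≡.sym (A≡B i j)) (A≡G i j)))
    value-cong (no ¬a) (yes (H , free , B≡H)) A≡B =
      ⊥-elim (¬a (H , free , λ i j → ≡.trans (A≡B i j) (B≡H i j)))
    value-cong (no _) (no _) _ = ≤-refl

    decide : ∀ A → Dec (Realises A)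
    decide A = em

    h : (Fin (suc n) → Fin (suc n) → Bool) → Carrier
    h A = value {A} (decide A)

    h-cong : ∀ {A B} → (∀ i j → A i j ≡ B i j) → h A ≈ h B
    h-cong {A} {B} A≡B = ≤-antisym (value-cong {A} {B} (decide A) (decide B) A≡B)
      (value-cong {B} {A} (decide B) (decide A) (λ i j → ≡.sym (A≡B i j)))

    best : ∃ λ A → ∀ B → h B ≤ h A
    best = Vector-maximum (suc n) (λ _ → ≡.refl)
      (Vector-maximum (suc n) ≡.refl Bool-maximum) h h-cong

    value-realised : ∀ {A} (a : Dec (Realises A)) →
      Σ (Graph (suc n)) λ G → ¬ Contains G F × value a ≈ spectralRadius p G
    value-realised (yes (G , free , _)) = G , free , refl
    value-realised (no _)               = G₀ , G₀-free , refl

    spectralRadius≤value : ∀ G → ¬ Contains G F → (a : Dec (Realises (adj G))) → spectralRadius p G ≤ value a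
    spectralRadius≤value G free (yes (H , _ , G≡H)) = spectralRadius-mono G H G≡H
    spectralRadius≤value G free (no ¬a) = ⊥-elim (¬a (G , free , λ _ _ → ≡.refl))

    FreeRadii : Pred Carrier 0ℓ
    FreeRadii v = Σ (Graph (suc n)) λ G → ¬ Contains G F × v ≈ spectralRadius p G

    best-isMaximum : ∀ A → (∀ B → h B ≤ h A) → IsMaximum FreeRadii (h A)
    best-isMaximum A A-best = value-realised {A} (decide A) , λ v (G , free , v≈) →
      ≤-trans (≤-reflexive v≈) (≤-trans (spectralRadius≤value G free (decide (adj G))) (A-best (adj G)))

    ex-isMaximum : IsMaximum FreeRadii (ex p (suc n) F)
    ex-isMaximum = max-isMaximum {FreeRadii} (h (proj₁ best) , best-isMaximum (proj₁ best) (proj₂ best))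

-- Turán graphs and embeddings of F

Adj-turán⇒≢ : ∀ r .{{_ : NonZero r}} {n} (i j : Fin n) → Adj (turán r n) i j → toℕ i % r ≢ toℕ j % r
Adj-turán⇒≢ r i j adjacent i≡j
  with ≡.trans (≡.sym adjacent) (≡.cong Bool.not (dec-true (toℕ i % r ℕ.≟ toℕ j % r) i≡j))
... | ()

-- A copy of `F` would pull the residues mod r back to a proper r-colouring of `F`.
turán-free : ∀ r .{{_ : NonZero r}} {m n} {F : Graph m} → HasChromaticNumber F (suc r) →
  ¬ Contains (turán r n) F
turán-free r {m} {n} {F} (_ , least) (f , _ , f-adj) = ℕ.1+n≰n (least r (colour , proper))
  where
  colour : Fin m → Fin r
  colour i = Fin.fromℕ< (m%n<n (toℕ (f i)) r)
  toℕ-colour : ∀ i → toℕ (colour i) ≡ toℕ (f i) % r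
  toℕ-colour i = Fin.toℕ-fromℕ< (m%n<n (toℕ (f i)) r)
  proper : ∀ i j → Adj F i j → colour i ≢ colour j
  proper i j adjacent ci≡cj = Adj-turán⇒≢ r (f i) (f j) (f-adj i j adjacent)
    (≡.trans (≡.sym (toℕ-colour i)) (≡.trans (≡.cong toℕ ci≡cj) (toℕ-colour j)))

does-true⇒ : ∀ {P : Set} (d : Dec P) → does d ≡ true → P
does-true⇒ (yes holds) _ = holds

-- The elements of a residue class have distinct quotients.
residueClass-small : ∀ r .{{_ : NonZero r}} n k (g : Fin (suc (suc (n / r))) → Fin n) →
  Injective _≡_ _≡_ g → (∀ i → k ≡ toℕ (g i) % r) → ⊥
residueClass-small r n k g g-inj g-class = ℕ.1+n≰n (Fin.injective⇒≤ quotient-inj)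
  where
  quotient< : ∀ i → toℕ (g i) / r ℕ.< suc (n / r)
  quotient< i = s≤s (/-mono-≤ {o = r} {p = r} (ℕ.<⇒≤ (Fin.toℕ<n (g i))) ℕ.≤-refl)
  quotient : Fin (suc (suc (n / r))) → Fin (suc (n / r))
  quotient i = Fin.fromℕ< (quotient< i)
  quotient-inj : Injective _≡_ _≡_ quotient
  quotient-inj {i} {j} qi≡qj = g-inj (Fin.toℕ-injective (begin
    toℕ (g i)                                     ≡⟨ m≡m%n+[m/n]*n (toℕ (g i)) r ⟩
    toℕ (g i) % r ℕ.+ (toℕ (g i) / r) ℕ.* r       ≡⟨ ≡.cong₂ (λ a b → a ℕ.+ b ℕ.* r) (≡.trans (≡.sym (g-class i)) (g-class j)) quotients ⟩
    toℕ (g j) % r ℕ.+ (toℕ (g j) / r) ℕ.* r       ≡⟨ m≡m%n+[m/n]*n (toℕ (g j)) r ⟨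
    toℕ (g j)                                     ∎))
    where
    open ≡.≡-Reasoning
    quotients : toℕ (g i) / r ≡ toℕ (g j) / r
    quotients = ≡.trans (≡.sym (Fin.toℕ-fromℕ< (quotient< i)))
      (≡.trans (≡.cong toℕ qi≡qj) (Fin.toℕ-fromℕ< (quotient< j)))

-- Each part has as many slots as `F` has vertices, and vertex i takes slot i in the part of its
-- colour. Vertices of equal colour therefore never collide, and those of different colours are kept
-- apart by `adj-irr`.
partite-Contains : ∀ {m n s} (F : Graph m) (G : Graph n) → Colourable F s →
  (φ : Fin s → Fin m → Fin n) → (∀ a → Injective _≡_ _≡_ (φ a)) →
  (∀ a b i j → a ≢ b → Adj G (φ a i) (φ b j)) → Contains G F
partite-Contains {m} {n} F G (c , proper) φ φ-inj φ-adj =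
  f , f-inj , λ i j adjacent → φ-adj (c i) (c j) i j (proper i j adjacent)
  where
  f : Fin m → Fin n
  f i = φ (c i) i
  f-inj : Injective _≡_ _≡_ f
  f-inj {i} {j} fi≡fj with c i Fin.≟ c j
  ... | yes ci≡cj = φ-inj (c i) (≡.trans fi≡fj (≡.cong (λ a → φ a j) (≡.sym ci≡cj)))
  ... | no ci≢cj with ≡.trans (≡.sym (adj-irr G (f j)))
                       (≡.subst (λ v → adj G v (f j) ≡ true) fi≡fj (φ-adj (c i) (c j) i j ci≢cj))
  ...   | ()

-- Lower and upper bounds on spectral radii for large n

module Asymptotics (em : ExcludedMiddle 0ℓ) (ℝ : CompleteOrderedField)
  (p : CompleteOrderedField.Carrier ℝ)
  (1<p : CompleteOrderedField._<_ ℝ (CompleteOrderedField.1# ℝ) p) where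
  open CompleteOrderedField ℝ hiding (zero)
  open Classical em ℝ
  open OrderedField em ℝ
  open RealPowers em ℝ
  open PowersAboveOne em ℝ p 1<p
  open FiniteSums em ℝ
  open WeightedErdősStone em ℝ
  open SpectralRadius em ℝ p 1<p

  shrink : ∀ {ε} C → 0# < ε → 0# < C → ∃ λ κ → 0# < κ × κ ≤ 1# × C * κ ≤ ε
  shrink {ε} C 0<ε 0<C =
    let κ , 0<κ , κ≤1 , κ≤ε/C = minimum 0<1 (0<* 0<ε (0<⁻¹ 0<C))
        open ≤-Reasoning
    in κ , 0<κ , κ≤1 , (begin
      C * κ            ≤⟨ *-monoˡ-≤ C (proj₁ 0<C) κ≤ε/C ⟩
      C * (ε * C ⁻¹)   ≈⟨ solve 3 (λ C ε i → C :* (ε :* i) := ε :* (C :* i)) refl C ε (C ⁻¹) ⟩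
      ε * (C * C ⁻¹)   ≈⟨ trans (*-congˡ (⁻¹-inverseʳ C (>⇒≉0 0<C))) (*-identityʳ ε) ⟩
      ε                ∎)

  archimedean-* : ∀ x {ε} → 0# < ε → ∃ λ N → ∀ n → N ℕ.≤ n → x ≤ ε * fromℕ n
  archimedean-* x {ε} 0<ε = let N , xε⁻¹≤N = archimedean (x * ε ⁻¹) in N , λ n N≤n → begin
    x               ≈⟨ trans (*-assoc _ _ _) (trans (*-congˡ (⁻¹-inverseˡ ε (>⇒≉0 0<ε))) (*-identityʳ x)) ⟨
    x * ε ⁻¹ * ε    ≤⟨ *-monoʳ-≤ ε (proj₁ 0<ε) (≤-trans xε⁻¹≤N (fromℕ-mono-≤ N≤n)) ⟩
    fromℕ n * ε     ≈⟨ *-comm _ _ ⟩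
    ε * fromℕ n     ∎
    where open ≤-Reasoning

  classSize : (r : ℕ) .{{_ : NonZero r}} (n k : ℕ) → Carrier
  classSize r n k = sum {n} λ j → indicator (does (k ℕ.≟ toℕ j % r))

  -- `select` limits a residue class to `n / r` + 2 elements; the resulting error 2 r is of lower
  -- order than n.
  classSize-bound : ∀ r .{{_ : NonZero r}} n k →
    fromℕ r * classSize r n k ≤ fromℕ n + two * fromℕ r
  classSize-bound r n k = bound (select (suc (suc (n / r))) (λ j → indicator (does (k ℕ.≟ toℕ j % r)))
      0≤1 (λ j → 0≤indicator (does (k ℕ.≟ toℕ j % r))) (λ j → indicator≤1 (does (k ℕ.≟ toℕ j % r))))
    where
    member : ∀ j → does (k ℕ.≟ toℕ {n} j % r) ≡ true → k ≡ toℕ j % r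
    member j = does-true⇒ (k ℕ.≟ toℕ j % r)
    bound : DistinctInSupport (suc (suc (n / r))) (λ j → indicator (does (k ℕ.≟ toℕ {n} j % r))) ⊎
      classSize r n k ≤ fromℕ (suc (suc (n / r))) * 1# → fromℕ r * classSize r n k ≤ fromℕ n + two * fromℕ r
    bound (inj₁ (g , g-inj , 0<)) = ⊥-elim (residueClass-small r n k g g-inj
      λ i → member (g i) (0<indicator⇒true (0< i)))
    bound (inj₂ size≤) = begin
      fromℕ r * classSize r n k                     ≤⟨ *-monoˡ-≤ (fromℕ r) (0≤fromℕ r) size≤ ⟩
      fromℕ r * (fromℕ (suc (suc (n / r))) * 1#)    ≈⟨ solve 2 (λ r q → r :* ((:1 :+ (:1 :+ q)) :* :1) := q :* r :+ :2 :* r) refl (fromℕ r) (fromℕ (n / r)) ⟩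
      fromℕ (n / r) * fromℕ r + two * fromℕ r       ≈⟨ +-congʳ (fromℕ-* (n / r) r) ⟨
      fromℕ ((n / r) ℕ.* r) + two * fromℕ r         ≤⟨ +-monoˡ-≤ _ (fromℕ-mono-≤ (m/n*n≤m n r)) ⟩
      fromℕ n + two * fromℕ r                       ∎
      where open ≤-Reasoning

  turán-energy : ∀ r .{{_ : NonZero r}} n {u} → 0# ≤ u →
    fromℕ n * (u * u) * ((fromℕ r - 1#) * fromℕ n - two * fromℕ r) ≤ fromℕ r * energy (turán r n) (λ _ → u)
  turán-energy r n {u} 0≤u = begin
    fromℕ n * (u * u) * ((R - 1#) * fromℕ n - two * R)     ≈⟨ trans (*-assoc _ _ _) (sym (sum-const n _)) ⟩
    sum {n} (λ i → u * u * ((R - 1#) * fromℕ n - two * R)) ≤⟨ sum-mono-≤ (λ i → *-monoˡ-≤ _ (0≤u ⊗ 0≤u) (neighbours i)) ⟩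
    sum {n} (λ i → u * u * (R * count i))                  ≈⟨ sum-cong (λ i → trans (solve 3 (λ u R c → u :* u :* (R :* c) := R :* (u :* (c :* u))) refl u R (count i))
                                                               (*-congˡ (*-congˡ (sym (sum-*ʳ u (λ j → indicator (adj T i j))))))) ⟩
    sum (λ i → R * (u * degree T (λ _ → u) i))             ≈⟨ sum-*ˡ R (λ i → u * degree T (λ _ → u) i) ⟩
    R * energy T (λ _ → u)                                 ∎
    where
    open ≤-Reasoning
    R = fromℕ r
    T = turán r n
    count : Fin n → Carrier
    count i = sum λ j → indicator (adj T i j)
    indicator-not : ∀ b → indicator (Bool.not b) + indicator b ≈ 1#
    indicator-not true  = +-identityˡ 1#
    indicator-not false = +-identityʳ 1#
    count+class : ∀ i → count i + classSize r n (toℕ i % r) ≈ fromℕ n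
    count+class i = trans (sym (sum-+ (λ j → indicator (adj T i j)) (λ j → indicator (does (toℕ i % r ℕ.≟ toℕ j % r)))))
      (trans (sum-cong {n} λ j → indicator-not (does (toℕ i % r ℕ.≟ toℕ j % r)))
        (trans (sum-const n 1#) (*-identityʳ _)))
    split-R*count : ∀ i → R * count i ≈
      ((R - 1#) * fromℕ n - two * R) + ((fromℕ n + two * R) - R * classSize r n (toℕ i % r))
    split-R*count i = trans
      (solve 3 (λ R c s → R :* c := ((R :- :1) :* (c :+ s) :- :2 :* R) :+ ((c :+ s :+ :2 :* R) :- R :* s))
        refl R (count i) (classSize r n (toℕ i % r)))
      (+-cong (+-congʳ (*-congˡ (count+class i))) (+-congʳ (+-congʳ (count+class i))))
    neighbours : ∀ i → (R - 1#) * fromℕ n - two * R ≤ R * count i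
    neighbours i = ≤-by (x≤y⇒0≤y-x (classSize-bound r n (toℕ i % r))) (split-R*count i)

  module Scale (n : ℕ) (1≤n : 1 ℕ.≤ n) where
    N = fromℕ n ^ᴿ q
    Z = fromℕ n ^ᴿ e
    u = N ⁻¹

    0<n : 0# < fromℕ n
    0<n = 0<fromℕ 1≤n

    0<N : 0# < N
    0<N = 0<^ᴿ 0<n 0≤q

    0<Z : 0# < Z
    0<Z = 0<^ᴿ 0<n 0≤e

    0≤u : 0# ≤ u
    0≤u = 0≤⁻¹ 0<N

    Nu≈1 : N * u ≈ 1#
    Nu≈1 = ⁻¹-inverseʳ N (>⇒≉0 0<N)

    Nᵖ≈n : N ^ᴿ p ≈ fromℕ n
    Nᵖ≈n = ^ᴿ-q-p (1≤fromℕ 1≤n)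

    ZN²≈n² : Z * (N * N) ≈ fromℕ n * fromℕ n
    ZN²≈n² = ^ᴿ-e-q (1≤fromℕ 1≤n)

    -- Shows that n^(2-2/p) is the energy scale of the constant unit vector: n² ordered pairs, each
    -- contributing u².
    Z≈n²u² : Z ≈ fromℕ n * fromℕ n * (u * u)
    Z≈n²u² = begin
      Z                                ≈⟨ solve 1 (λ Z → Z := Z :* (:1 :* :1)) refl Z ⟩
      Z * (1# * 1#)                    ≈⟨ *-congˡ (*-cong Nu≈1 Nu≈1) ⟨
      Z * (N * u * (N * u))            ≈⟨ solve 3 (λ Z N u → Z :* (N :* u :* (N :* u)) := Z :* (N :* N) :* (u :* u)) refl Z N u ⟩
      Z * (N * N) * (u * u)            ≈⟨ *-congʳ ZN²≈n² ⟩
      fromℕ n * fromℕ n * (u * u)      ∎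
      where open ≈-Reasoning

    constant-feasible : Feasible {n} (λ _ → u)
    constant-feasible = (λ _ → 0≤u) , (begin
      sum {n} (λ _ → u ^ᴿ p)   ≈⟨ sum-const n (u ^ᴿ p) ⟩
      fromℕ n * u ^ᴿ p         ≈⟨ *-congʳ Nᵖ≈n ⟨
      N ^ᴿ p * u ^ᴿ p          ≈⟨ ^ᴿ-distrib-* (proj₁ 0<N) 0≤u ⟨
      (N * u) ^ᴿ p             ≈⟨ ^ᴿ-congˡ p Nu≈1 ⟩
      1# ^ᴿ p                  ≈⟨ 1^ᴿ≈1 ⟩
      1#                       ∎)
      where open ≈-Reasoning

  turán-lowerBound : ∀ r .{{_ : NonZero r}} {ε} → 0# < ε → ∃ λ n₀ → ∀ n → n₀ ℕ.≤ n → 1 ℕ.≤ n →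
    (fromℕ r - 1# - ε) * fromℕ n ^ᴿ e ≤ fromℕ r * spectralRadius p (turán r n)
  turán-lowerBound r {ε} 0<ε =
    let n₀ , 2r≤εn = archimedean-* (two * fromℕ r) 0<ε in n₀ , λ n n₀≤n 1≤n → bound n (2r≤εn n n₀≤n) 1≤n
    where
    bound : ∀ n → two * fromℕ r ≤ ε * fromℕ n → 1 ℕ.≤ n →
      (fromℕ r - 1# - ε) * fromℕ n ^ᴿ e ≤ fromℕ r * spectralRadius p (turán r n)
    bound n@(suc _) 2r≤εn 1≤n = begin
      (R - 1# - ε) * Z                                     ≈⟨ *-congˡ Z≈n²u² ⟩
      (R - 1# - ε) * (fromℕ n * fromℕ n * (u * u))         ≤⟨ ≤-by (x≤y⇒0≤y-x 2r≤εn ⊗ (0≤fromℕ n ⊗ (0≤u ⊗ 0≤u)))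
          (solve 4 (λ R ε n u → n :* (u :* u) :* ((R :- :1) :* n :- :2 :* R) :=
              (R :- :1 :- ε) :* (n :* n :* (u :* u)) :+ (ε :* n :- :2 :* R) :* (n :* (u :* u))) refl R ε (fromℕ n) u) ⟩
      fromℕ n * (u * u) * ((R - 1#) * fromℕ n - two * R)   ≤⟨ turán-energy r n 0≤u ⟩
      R * energy (turán r n) (λ _ → u)                     ≤⟨ *-monoˡ-≤ R (0≤fromℕ r) (energy≤spectralRadius (turán r n) constant-feasible) ⟩
      R * spectralRadius p (turán r n)                     ∎
      where
      open ≤-Reasoning
      open Scale n 1≤n
      R = fromℕ r

  -- The z i play the role of y i ^ᴿ p: above the threshold M the weights
  -- contribute little.
  truncate : ∀ {n} (G : Graph n) (y z : Vector Carrier n) {M η L} → 0# ≤ M → 0# ≤ η →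
    (∀ i → 0# ≤ y i) → (∀ i → 0# ≤ z i) → sum y ≤ L → sum z ≤ L → (∀ i → M ≤ y i → y i ≤ η * z i) →
    ∃ λ u → (∀ i → 0# ≤ u i) × (∀ i → u i ≤ M) × sum u ≤ L ×
      energy G y ≤ energy G u + two * η * (L * L)
  truncate {n} G y z {M} {η} {L} 0≤M 0≤η 0≤y 0≤z Y≤L Z≤L tail =
    u , 0≤u , u≤M , U≤L , energy-bound
    where
    open ≤-Reasoning
    S : Fin n → Bool
    S i = does (y i ≤? M)
    u = restrict S y
    0≤u = 0≤restrict S 0≤y
    u≤M : ∀ i → u i ≤ M
    u≤M i with y i ≤? M
    ... | yes y≤M = ≤-trans (≤-reflexive (*-identityˡ _)) y≤M
    ... | no  _   = ≤-trans (≤-reflexive (zeroˡ _)) 0≤M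
    y≤u+ηz : ∀ i → y i ≤ u i + η * z i
    y≤u+ηz i with y i ≤? M
    ... | yes _  = ≤-by (0≤η ⊗ 0≤z i) (+-congʳ (*-identityˡ _))
    ... | no y≰M = ≤-trans (tail i (proj₁ (≰⇒> y≰M)))
          (≤-reflexive (sym (trans (+-congʳ (zeroˡ _)) (+-identityˡ _))))
    U≤L : sum u ≤ L
    U≤L = ≤-trans (sum-mono-≤ (restrict≤ S 0≤y)) Y≤L
    degree-y≤ : ∀ i → degree G y i ≤ degree G u i + η * L
    degree-y≤ i = begin
      degree G y i                                                  ≤⟨ sum-mono-≤ (λ j → summand (adj G i j) j) ⟩
      sum (λ j → indicator (adj G i j) * u j + η * z j)             ≈⟨ sum-+ (λ j → indicator (adj G i j) * u j) (λ j → η * z j) ⟩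
      degree G u i + sum (λ j → η * z j)                            ≈⟨ +-congˡ (sum-*ˡ η z) ⟩
      degree G u i + η * sum z                                      ≤⟨ +-mono-≤ ≤-refl (*-monoˡ-≤ η 0≤η Z≤L) ⟩
      degree G u i + η * L                                          ∎
      where
      summand : ∀ b j → indicator b * y j ≤ indicator b * u j + η * z j
      summand true  j = ≤-trans (≤-reflexive (*-identityˡ _)) (≤-trans (y≤u+ηz j) (≤-reflexive (+-congʳ (sym (*-identityˡ _)))))
      summand false j = ≤-by (0≤η ⊗ 0≤z j) (+-congʳ (trans (zeroˡ _) (sym (zeroˡ _))))
    -- One factor is truncated at a time: the degree changes by at most η L, then y i by at most η z
    -- i. Each change costs η L² after summation, hence the factor 2.
    term : ∀ i → y i * degree G y i ≤ (u i * degree G u i + η * z i * L) + y i * (η * L)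
    term i = ≤-trans (*-monoˡ-≤ (y i) (0≤y i) (degree-y≤ i)) (≤-by
      (x≤y⇒0≤y-x (y≤u+ηz i) ⊗ 0≤d ⊕ 0≤η ⊗ 0≤z i ⊗ x≤y⇒0≤y-x d≤L)
      (solve 6 (λ y u d η z L → (u :* d :+ η :* z :* L) :+ y :* (η :* L) :=
          y :* (d :+ η :* L) :+ ((u :+ η :* z :- y) :* d :+ η :* z :* (L :- d)))
        refl (y i) (u i) (degree G u i) η (z i) L))
      where
      0≤d = 0≤sum λ j → 0≤indicator (adj G i j) ⊗ 0≤u j
      d≤L = ≤-trans (degree≤sum G 0≤u i) U≤L
    0≤L : 0# ≤ L
    0≤L = ≤-trans (0≤sum 0≤y) Y≤L
    energy-bound : energy G y ≤ energy G u + two * η * (L * L)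
    energy-bound = begin
      energy G y                                                                       ≤⟨ sum-mono-≤ term ⟩
      sum (λ i → (u i * degree G u i + η * z i * L) + y i * (η * L))                   ≈⟨ sum-+ (λ i → u i * degree G u i + η * z i * L) (λ i → y i * (η * L)) ⟩
      sum (λ i → u i * degree G u i + η * z i * L) + sum (λ i → y i * (η * L))         ≈⟨ +-cong (sum-+ (λ i → u i * degree G u i) (λ i → η * z i * L)) (sum-*ʳ (η * L) y) ⟩
      (energy G u + sum (λ i → η * z i * L)) + sum y * (η * L)                         ≈⟨ +-congʳ (+-congˡ (trans (sum-*ʳ L (λ i → η * z i)) (*-congʳ (sum-*ˡ η z)))) ⟩
      (energy G u + η * sum z * L) + sum y * (η * L)                                   ≤⟨ ≤-by
          (0≤η ⊗ 0≤L ⊗ x≤y⇒0≤y-x Z≤L ⊕ 0≤η ⊗ 0≤L ⊗ x≤y⇒0≤y-x Y≤L)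
          (solve 5 (λ E η L Z Y → E :+ :2 :* η :* (L :* L) := ((E :+ η :* Z :* L) :+ Y :* (η :* L)) :+
              (η :* L :* (L :- Z) :+ η :* L :* (L :- Y))) refl (energy G u) η L (sum z) (sum y)) ⟩
      energy G u + two * η * (L * L)                                                   ∎

  free-upperBound : ∀ r → 1 ℕ.≤ r → ∀ {m} (F : Graph m) → Colourable F (suc r) → ∀ {ε} → 0# < ε →
    ∃ λ n₀ → ∀ n → n₀ ℕ.≤ n → 1 ℕ.≤ n → ∀ (G : Graph n) → ¬ Contains G F →
      fromℕ r * spectralRadius p G ≤ (fromℕ r - 1# + ε) * fromℕ n ^ᴿ e
  free-upperBound r 1≤r {m} F colourable {ε} 0<ε =
    proj₁ n-large , λ n n₀≤n 1≤n G free → bound n (proj₂ n-large n n₀≤n) 1≤n G free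
    where
    R = fromℕ r
    0≤R = 0≤fromℕ r
    -- The error ε is split evenly: 8 κ ≤ ε makes the density surplus 4 κ at most ε / 2, and 4 R η ≤
    -- ε makes the truncation loss 2 R η at most ε / 2.
    κ-choice = shrink (fromℕ 8) 0<ε (0<fromℕ {8} (s≤s z≤n))
    κ = proj₁ κ-choice
    η-choice = shrink (fromℕ 4 * R) 0<ε (0<* (0<fromℕ {4} (s≤s z≤n)) (0<fromℕ 1≤r))
    η = proj₁ η-choice
    0≤η = proj₁ (proj₁ (proj₂ η-choice))
    threshold = ^ᴿ-superlinear (proj₁ (proj₂ η-choice))
    M = proj₁ threshold
    stone = weighted-Erdős-Stone r 1≤r κ (proj₁ (proj₂ κ-choice)) (proj₁ (proj₂ (proj₂ κ-choice))) m
    δ = proj₁ stone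
    -- The truncation level M is independent of n, so it falls below the weight cap δ n once n ≥ M /
    -- δ.
    n-large = archimedean-* M (proj₁ (proj₂ stone))
    bound : ∀ n → M ≤ δ * fromℕ n → 1 ℕ.≤ n → (G : Graph n) → ¬ Contains G F →
      R * spectralRadius p G ≤ (R - 1# + ε) * fromℕ n ^ᴿ e
    bound n@(suc _) M≤δn 1≤n G free = *-cancelʳ-≤ (N * N) (0<* 0<N 0<N) (begin
      R * spectralRadius p G * (N * N)               ≤⟨ *-monoʳ-≤ (N * N) (proj₁ (0<* 0<N 0<N)) (*-monoˡ-≤ R 0≤R (proj₂ (proj₂ attained))) ⟩
      R * energy G x * (N * N)                       ≈⟨ *-assoc R (energy G x) (N * N) ⟩
      R * (energy G x * (N * N))                     ≈⟨ *-congˡ scaled-energy ⟩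
      R * energy G y                                 ≤⟨ *-monoˡ-≤ R 0≤R (proj₂ (proj₂ (proj₂ (proj₂ truncated)))) ⟩
      R * (energy G w + two * η * (L * L))           ≤⟨ *-cancelʳ-≤ two 0<two (≤-by
          (proj₁ 0<two ⊗ x≤y⇒0≤y-x sparse
            ⊕ x≤y⇒0≤y-x (proj₂ (proj₂ (proj₂ κ-choice))) ⊗ (0≤L ⊗ 0≤L)
            ⊕ x≤y⇒0≤y-x (proj₂ (proj₂ (proj₂ η-choice))) ⊗ (0≤L ⊗ 0≤L))
          (solve 6 (λ R E η κ L ε →
             (R :- :1 :+ ε) :* (L :* L) :* :2 := R :* (E :+ :2 :* η :* (L :* L)) :* :2 :+
               (:2 :* ((R :- :1 :+ (:2 :* κ :+ :2 :* κ)) :* (L :* L) :- R :* E)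
                :+ (ε :- :8 :* κ) :* (L :* L)
                :+ (ε :- :4 :* R :* η) :* (L :* L)))
             refl R (energy G w) η κ L ε)) ⟩
      (R - 1# + ε) * (L * L)                         ≈⟨ *-congˡ ZN²≈n² ⟨
      (R - 1# + ε) * (Z * (N * N))                   ≈⟨ *-assoc (R - 1# + ε) Z (N * N) ⟨
      (R - 1# + ε) * Z * (N * N)                     ∎)
      where
      open ≤-Reasoning
      open Scale n 1≤n
      :4 :8 : Polynomial 6
      :4 = :1 :+ (:1 :+ (:1 :+ (:1 :+ :0)))
      :8 = :1 :+ (:1 :+ (:1 :+ (:1 :+ :4)))
      L = fromℕ n
      0≤L = 0≤fromℕ n
      attained = spectralRadius-attained G
      x = proj₁ attained
      0≤x = proj₁ (proj₁ (proj₂ attained))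
      norm≈1 : sum (λ i → x i ^ᴿ p) ≈ 1#
      norm≈1 = proj₂ (proj₁ (proj₂ attained))
      y : Vector Carrier n
      y i = N * x i
      0≤y : ∀ i → 0# ≤ y i
      0≤y i = proj₁ 0<N ⊗ 0≤x i
      scaled-energy : energy G x * (N * N) ≈ energy G y
      scaled-energy = trans (sym (sum-*ʳ (N * N) (λ i → x i * degree G x i))) (sum-cong λ i →
        trans (solve 3 (λ x d N → x :* d :* (N :* N) := N :* x :* (N :* d)) refl (x i) (degree G x i) N)
          (*-congˡ (trans (sym (sum-*ˡ N (λ j → indicator (adj G i j) * x j)))
            (sum-cong λ j → solve 3 (λ N a x → N :* (a :* x) := a :* (N :* x)) refl N (indicator (adj G i j)) (x j)))))
      sum-yᵖ : sum (λ i → y i ^ᴿ p) ≈ L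
      sum-yᵖ = trans (sum-cong λ i → trans (^ᴿ-distrib-* (proj₁ 0<N) (0≤x i)) (*-congʳ Nᵖ≈n))
        (trans (sum-*ˡ L (λ i → x i ^ᴿ p)) (trans (*-congˡ norm≈1) (*-identityʳ L)))
      sum-y≤L : sum y ≤ L
      sum-y≤L = *-cancelˡ-≤ p 0<p (≤-by (x≤y⇒0≤y-x tangent)
        (solve 3 (λ p Y L → p :* L := p :* Y :+ (L :- (L :+ p :* (Y :- L)))) refl p (sum y) L))
        where
        tangent : L + p * (sum y - L) ≤ L
        tangent = begin
          L + p * (sum y - L)                          ≈⟨ solve 3 (λ p Y L → L :+ p :* (Y :- L) := L :* (:1 :- p) :+ p :* Y) refl p (sum y) L ⟩
          L * (1# - p) + p * sum y                     ≈⟨ +-cong (sum-const n (1# - p)) (sum-*ˡ p y) ⟨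
          sum {n} (λ _ → 1# - p) + sum (λ i → p * y i) ≈⟨ sum-+ (λ _ → 1# - p) (λ i → p * y i) ⟨
          sum (λ i → (1# - p) + p * y i)               ≤⟨ sum-mono-≤ (λ i → ≤-trans
              (≤-reflexive (solve 2 (λ p y → (:1 :- p) :+ p :* y := :1 :+ p :* (y :- :1)) refl p (y i)))
              (^ᴿ-bernoulli (0≤y i))) ⟩
          sum (λ i → y i ^ᴿ p)                         ≈⟨ sum-yᵖ ⟩
          L                                            ∎
      truncated : ∃ λ u → (∀ i → 0# ≤ u i) × (∀ i → u i ≤ M) × sum u ≤ L ×
        energy G y ≤ energy G u + two * η * (L * L)
      truncated = truncate G y (λ i → y i ^ᴿ p) (proj₁ (proj₁ (proj₂ threshold))) 0≤η 0≤y
        (λ i → 0≤^ᴿ (0≤y i) 0≤p) sum-y≤L (≤-reflexive sum-yᵖ)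
        (λ i → proj₂ (proj₂ threshold) (y i))
      w = proj₁ truncated
      sparse : R * energy G w ≤ (R - 1# + (two * κ + two * κ)) * (L * L)
      sparse = ≤-by-contradiction λ dense →
        let φ , φ-inj , φ-adj = proj₂ (proj₂ stone) G w L (proj₁ (proj₂ truncated)) 0<n
              (proj₁ (proj₂ (proj₂ (proj₂ truncated))))
              (λ v → ≤-trans (proj₁ (proj₂ (proj₂ truncated)) v) M≤δn) (proj₁ dense)
        in ⊥-elim (free (partite-Contains F G colourable φ φ-inj φ-adj))

-- Both asymptotic formulas from the two-sided bounds

theorem3p10 :
    (em : ExcludedMiddle 0ℓ) (ℝ : CompleteOrderedField) →
    let open CompleteOrderedField ℝ
        open Classical em ℝ
    in
    (r : ℕ) .{{_ : NonZero r}} →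
    {m : ℕ} (F : Graph m) → HasChromaticNumber F (suc r) →
    (p : Carrier) → 1# < p →
    let e : Carrier
        e = fromℕ 2 - fromℕ 2 * p ⁻¹
    in
    ((λ n → ex p n F - spectralRadius p (turán r n)) =o (λ n → fromℕ n ^ᴿ e))
    ×
    (∃ λ (δ : ℕ → Carrier) → (δ =o (λ _ → 1#)) ×
      (∀ n → n ≥ 1 →
        ex p n F ≈ ((1# - fromℕ r ⁻¹) + δ n) * fromℕ n ^ᴿ e))
theorem3p10 em ℝ r {m} F χF≡r+1 p 1<p = difference , δ , δ-small , expansion
  where
  open CompleteOrderedField ℝ hiding (zero)
  open Classical em ℝ
  open OrderedField em ℝ
  open RealPowers em ℝ
  open PowersAboveOne em ℝ p 1<p
  open SpectralRadius em ℝ p 1<p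
  open Asymptotics em ℝ p 1<p
  open ≤-Reasoning

  R : Carrier
  R = fromℕ r

  1≤r : 1 ℕ.≤ r
  1≤r = ℕ.>-nonZero⁻¹ r

  0<R : 0# < R
  0<R = 0<fromℕ 1≤r

  Z : ℕ → Carrier
  Z n = fromℕ n ^ᴿ e

  0<Z : ∀ n → 1 ℕ.≤ n → 0# < Z n
  0<Z n 1≤n = 0<^ᴿ (0<fromℕ 1≤n) 0≤e

  ρT : ℕ → Carrier
  ρT n = spectralRadius p (turán r n)

  ρT≤ex : ∀ n → 1 ℕ.≤ n → ρT n ≤ ex p n F
  ρT≤ex (suc n) _ = proj₂ (ex-isMaximum) _ (turán r (suc n) , turán-free r {F = F} χF≡r+1 , refl)
    where open Extremal F (turán r (suc n)) (turán-free r {F = F} χF≡r+1)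

  ex-attained : ∀ n → 1 ℕ.≤ n → Σ (Graph n) λ G → ¬ Contains G F × ex p n F ≈ spectralRadius p G
  ex-attained (suc n) _ = proj₁ ex-isMaximum
    where open Extremal F (turán r (suc n)) (turán-free r {F = F} χF≡r+1)

  Sandwich : Carrier → ℕ → Set
  Sandwich ε n = (R - 1# - ε) * Z n ≤ R * ρT n × ρT n ≤ ex p n F ×
    R * ex p n F ≤ (R - 1# + ε) * Z n

  sandwich : ∀ ε → 0# < ε → ∃ λ n₀ → ∀ n → n₀ ℕ.≤ n → 1 ℕ.≤ n × Sandwich ε n
  sandwich ε 0<ε =
    let n₁ , lower = turán-lowerBound r 0<ε
        n₂ , upper = free-upperBound r 1≤r F (proj₁ χF≡r+1) 0<ε
    -- The successor ensures n ≥ 1, where the maxima exist and `Z n` is positive.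
    in suc (n₁ ℕ.+ n₂) , λ n n₀≤n →
      let 1≤n  = ℕ.≤-trans (s≤s z≤n) n₀≤n
          n₁≤n = ℕ.≤-trans (ℕ.m≤m+n n₁ n₂) (ℕ.≤-trans (ℕ.n≤1+n _) n₀≤n)
          n₂≤n = ℕ.≤-trans (ℕ.m≤n+m n₂ n₁) (ℕ.≤-trans (ℕ.n≤1+n _) n₀≤n)
          G , free , ex≈ρG = ex-attained n 1≤n
      in 1≤n , lower n n₁≤n 1≤n , ρT≤ex n 1≤n ,
         ≤-trans (≤-reflexive (*-congˡ ex≈ρG)) (upper n n₂≤n 1≤n G free)

  difference : (λ n → ex p n F - ρT n) =o Z
  difference ε 0<ε =
    -- The two outer bounds contribute ε / 2 each, and X - T ≤ R (X - T) because R ≥ 1.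
    let n₀ , between = sandwich (ε * half) (0<* 0<ε 0<half) in n₀ , λ n n₀≤n →
      let 1≤n , lower , T≤X , upper = between n n₀≤n
          0≤Z = proj₁ (0<Z n 1≤n)
      in bound (Z n) (ρT n) (ex p n F) 0≤Z lower T≤X upper
    where
    bound : ∀ Z T X → 0# ≤ Z → (R - 1# - ε * half) * Z ≤ R * T → T ≤ X →
      R * X ≤ (R - 1# + ε * half) * Z → ∣ X - T ∣ ≤ ε * ∣ Z ∣
    bound Z T X 0≤Z lower T≤X upper = begin
      ∣ X - T ∣                           ≈⟨ ∣x∣≈x (x≤y⇒0≤y-x T≤X) ⟩
      X - T                               ≤⟨ ≤-by
          (x≤y⇒0≤y-x (1≤fromℕ 1≤r) ⊗ x≤y⇒0≤y-x T≤X ⊕ x≤y⇒0≤y-x upper ⊕ x≤y⇒0≤y-x lower)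
          (solve 6 (λ R ε h Z T X → ε :* (h :+ h) :* Z := (X :- T) :+ ((R :- :1) :* (X :- T)
              :+ ((R :- :1 :+ ε :* h) :* Z :- R :* X) :+ (R :* T :- (R :- :1 :- ε :* h) :* Z)))
            refl R ε half Z T X) ⟩
      ε * (half + half) * Z               ≈⟨ *-cong (trans (*-congˡ half+half≈1) (*-identityʳ ε)) (sym (∣x∣≈x 0≤Z)) ⟩
      ε * ∣ Z ∣                           ∎

  -- The error term is found by solving the expansion for it, since `Z n` is invertible for n ≥ 1.
  δ : ℕ → Carrier
  δ n = ex p n F * Z n ⁻¹ - (1# - R ⁻¹)

  expansion : ∀ n → n ≥ 1 → ex p n F ≈ ((1# - R ⁻¹) + δ n) * Z n
  expansion n 1≤n = sym (begin-equality
    ((1# - R ⁻¹) + δ n) * Z n        ≈⟨ *-congʳ (solve 2 (λ a b → a :+ (b :- a) := b) refl (1# - R ⁻¹) (ex p n F * Z n ⁻¹)) ⟩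
    ex p n F * Z n ⁻¹ * Z n          ≈⟨ *-assoc _ _ _ ⟩
    ex p n F * (Z n ⁻¹ * Z n)        ≈⟨ *-congˡ (⁻¹-inverseˡ (Z n) (>⇒≉0 (0<Z n 1≤n))) ⟩
    ex p n F * 1#                    ≈⟨ *-identityʳ _ ⟩
    ex p n F                         ∎)

  δ-small : δ =o (λ _ → 1#)
  δ-small ε 0<ε =
    let n₀ , between = sandwich ε 0<ε in n₀ , λ n n₀≤n →
      let 1≤n , lower , T≤X , upper = between n n₀≤n in
      bound (Z n) (0<Z n 1≤n) (δ n) (ex p n F) (expansion n 1≤n)
        (≤-trans lower (*-monoˡ-≤ R (proj₁ 0<R) T≤X)) upper
    where
    bound : ∀ Z → 0# < Z → ∀ d X → X ≈ ((1# - R ⁻¹) + d) * Z → (R - 1# - ε) * Z ≤ R * X →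
      R * X ≤ (R - 1# + ε) * Z → ∣ d ∣ ≤ ε * ∣ 1# ∣
    bound Z 0<Z d X X≈ lower upper = ≤-trans (∣x∣≤c d≤ε -d≤ε)
      (≤-reflexive (sym (trans (*-congˡ (∣x∣≈x 0≤1)) (*-identityʳ ε))))
      where
      0<RZ = 0<* 0<R 0<Z
      RX≈ : R * X ≈ (R - 1# + R * d) * Z
      RX≈ = begin-equality
        R * X                                    ≈⟨ *-congˡ X≈ ⟩
        R * (((1# - R ⁻¹) + d) * Z)              ≈⟨ solve 4 (λ R i d Z → R :* (((:1 :- i) :+ d) :* Z) := (R :- R :* i :+ R :* d) :* Z) refl R (R ⁻¹) d Z ⟩
        (R - R * R ⁻¹ + R * d) * Z               ≈⟨ *-congʳ (+-congʳ (+-congˡ (-‿cong (⁻¹-inverseʳ R (>⇒≉0 0<R))))) ⟩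
        (R - 1# + R * d) * Z                     ∎
      -- The bounds confine R d to [- ε, ε]; the slack (R - 1) ε Z is what is given away in passing
      -- to ∣d∣ ≤ ε.
      0≤slack = x≤y⇒0≤y-x (1≤fromℕ 1≤r) ⊗ proj₁ 0<ε ⊗ proj₁ 0<Z
      d≤ε : d ≤ ε
      d≤ε = *-cancelʳ-≤ (R * Z) 0<RZ (≤-by
        (x≤y⇒0≤y-x (≤-trans (≤-reflexive (sym RX≈)) upper) ⊕ 0≤slack)
        (solve 4 (λ R Z d ε → ε :* (R :* Z) := d :* (R :* Z) :+
            (((R :- :1 :+ ε) :* Z :- (R :- :1 :+ R :* d) :* Z) :+ (R :- :1) :* ε :* Z)) refl R Z d ε))
      -d≤ε : - d ≤ ε
      -d≤ε = *-cancelʳ-≤ (R * Z) 0<RZ (≤-by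
        (x≤y⇒0≤y-x (≤-trans lower (≤-reflexive RX≈)) ⊕ 0≤slack)
        (solve 4 (λ R Z d ε → ε :* (R :* Z) := :- d :* (R :* Z) :+
            (((R :- :1 :+ R :* d) :* Z :- (R :- :1 :- ε) :* Z) :+ (R :- :1) :* ε :* Z)) refl R Z d ε))
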